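{- Let $r\geq1$ be an integer. As formal power series in $x,y,z$, $$C^{(r)}(x,y,z)=e^{(1-z)y^rx}\,A^{(r)}(x,y,z).$$
   Context: Ehrhart series: for $\mathcal{X}\subset\mathbb{R}^n$ (here a convex integral polytope with possibly some faces removed), $E(\mathcal{X},t)$ denotes the polynomial in $t$ such that $E(\mathcal{X},t)=\#(t\mathcal{X}\cap\mathbb{Z}^n)$ for every integer $t>0$; and $E^*(\mathcal{X},z):=(1-z)^{n+1}\sum_{t\geq 0}E(\mathcal{X},t)z^t$ (the value at $t=0$ is that of the polynomial). For $n\geq1$ and $1\leq k\leq rn$ let $\mathcal{A}^{(r)}_{n,k}=\{v\in[0,r)^n : k-1\leq\sum_i v_i<k\}$ and $A^{(r)}_{n,k}(z)=E^*(\mathcal{A}^{(r)}_{n,k},z)$. By convention $A^{(r)}_{n,0}(z)=\delta_{n0}$ (Kronecker delta) for all $n\ge 0$. Define $$A^{(r)}(x,y,z)=\sum_{n\geq0}\Big(\sum_{k=0}^{rn}A^{(r)}_{n,k}(z)y^k\Big)\frac{x^n}{n!}.$$ Colored permutations: $\mathfrak{S}_n^{(r)}$ is the set of pairs $(\sigma,c)$ with $\sigma\in\mathfrak{S}_n$ and $c=(c_1,\dots,c_n)\in\{0,1,\dots,r-1\}^n$. Define $\mathrm{fexc}(\sigma,c)=r\cdot\#\{i\in\{1,\dots,n\}:\sigma_i>i\text{ and }c_i=0\}+\sum_{i=1}^n c_i$; $\mathrm{des}^*(\sigma,c)=\#\{i : 1\leq i\leq n-1,\ c_i<c_{i+1}\text{,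 or }c_i=c_{i+1}\text{ and }\sigma_i>\sigma_{i+1}\}$; $\mathrm{fdes}^*(\sigma,c)=r\cdot\mathrm{des}^*(\sigma,c)+c_1$. For $n\geq1$, $1\leq k\leq rn$, let $$C^{(r)}_{n,k}(z)=\sum_{(\sigma,c)\in\mathfrak{S}^{(r)}_n,\ \mathrm{fexc}(\sigma,c)=rn-k} z^{\lceil\mathrm{fdes}^*(\sigma,c)/r\rceil},$$ and by convention $C^{(r)}_{n,0}(z)=\delta_{n0}$ for all $n\ge0$. Define $$C^{(r)}(x,y,z)=\sum_{n\geq0}\Big(\sum_{k=0}^{rn}C^{(r)}_{n,k}(z)y^k\Big)\frac{x^n}{n!}.$$ -}

module Defs where

open import Algebra.Bundles.Raw using (RawRing)
import Algebra.Definitions.RawSemiring as RawSemiringDefinitions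
open import Data.Bool.Base using (if_then_else_)
open import Data.Fin.Base using (Fin; zero; suc; toℕ; inject₁)
import Data.Fin.Properties as Fin
open import Data.Integer.Base using (ℤ; +_)
open import Data.List.Base as List using (List; []; _∷_; length; filter; allFin; cartesianProduct; cartesianProductWith)
open import Data.List.Membership.Propositional using (_∈_)
open import Data.List.Relation.Unary.Unique.Propositional using (Unique)
open import Data.Nat.Base as ℕ using (ℕ; zero; suc; NonZero; _∸_; _!)
import Data.Nat.DivMod as ℕ
import Data.Nat.Properties as ℕ
open import Data.Product.Base using (_×_; _,_; ∃-syntax)
open import Data.Rational.Base as ℚ using (ℚ; 0ℚ; 1ℚ)
open import Data.Sum.Base using (_⊎_)
open import Data.Vec.Base as Vec using (Vec; lookup)
open import Data.Vec.Relation.Unary.All using (All)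
import Data.Vec.Relation.Unary.AllPairs as AllPairs
open import Data.Vec.Relation.Unary.Unique.Propositional using () renaming (Unique to UniqueVec)
open import Function.Bundles using (_⇔_)
open import Level using (0ℓ)
open import Relation.Binary.PropositionalEquality using (_≡_)
open import Relation.Nullary.Decidable using (¬?; _×-dec_; _⊎-dec_)
open import Relation.Unary using (Pred; Decidable)

fromℤ : ℤ → ℚ
fromℤ a = a ℚ./ 1

fromℕ : ℕ → ℚ
fromℕ n = fromℤ (+ n)

1/_! : ℕ → ℚ
1/ n ! = ((+ 1) ℚ./ (n !)) {{n ℕ.!≢0}}

------------------------------------------------------------------------
-- Formal power series

module _ {c ℓ} (R : RawRing c ℓ) where
  open RawRing R
  open RawSemiringDefinitions rawSemiring using (sum)

  constant : Carrier → ℕ → Carrier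
  constant a zero    = a
  constant a (suc _) = 0#

  indeterminate : ℕ → Carrier
  indeterminate zero    = 0#
  indeterminate (suc n) = constant 1# n

  -- A series is its sequence of coefficients; equality is coefficientwise.
  powerSeries : RawRing c ℓ
  powerSeries = record
    { Carrier = ℕ → Carrier
    ; _≈_     = λ f g → ∀ n → f n ≈ g n
    ; _+_     = λ f g n → f n + g n
    ; _*_     = λ f g n → sum {suc n} (λ i → f (toℕ i) * g (n ∸ toℕ i))
    ; -_      = λ f n → - f n
    ; 0#      = λ _ → 0#
    ; 1#      = constant 1#
    }

ℚ⟦z⟧ ℚ⟦z⟧⟦y⟧ ℚ⟦z⟧⟦y⟧⟦x⟧ : RawRing 0ℓ 0ℓ
ℚ⟦z⟧       = powerSeries ℚ.+-*-rawRing
ℚ⟦z⟧⟦y⟧    = powerSeries ℚ⟦z⟧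
ℚ⟦z⟧⟦y⟧⟦x⟧ = powerSeries ℚ⟦z⟧⟦y⟧

private
  module Z  = RawRing ℚ⟦z⟧
  module Z^ = RawSemiringDefinitions Z.rawSemiring
  module Y  = RawRing ℚ⟦z⟧⟦y⟧
  module Y^ = RawSemiringDefinitions Y.rawSemiring

-- Unqualified ring operations are those of ℚ⟦z⟧⟦y⟧⟦x⟧, here and for importers.
open RawRing ℚ⟦z⟧⟦y⟧⟦x⟧ public
  using (_≈_; _+_; _*_; -_; 1#)
  renaming (Carrier to Series)
open RawSemiringDefinitions (RawRing.rawSemiring ℚ⟦z⟧⟦y⟧⟦x⟧) public
  using (_^_)

infixl 6 _-_
_-_ : Series → Series → Series
f - g = f + (- g)

z₁ : Z.Carrier
z₁ = indeterminate ℚ.+-*-rawRing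

x y z : Series
x = indeterminate ℚ⟦z⟧⟦y⟧
y = constant ℚ⟦z⟧⟦y⟧ (indeterminate ℚ⟦z⟧)
z = constant ℚ⟦z⟧⟦y⟧ (constant ℚ⟦z⟧ z₁)

_•_ : ℚ → Y.Carrier → Y.Carrier
(a • f) k j = a ℚ.* f k j

-- Σ_m f^m / m!, for f without constant term in x: then f^m has no terms of
-- x-degree below m, so the coefficient of x^n only involves m ≤ n.
exp : Series → Series
exp f n = Y^.sum {suc n} (λ m → 1/ toℕ m ! • (f ^ toℕ m) n)

-- Σ_n (Σ_{k=0}^{rn} P_{n,k}(z) y^k) x^n / n!
generatingFunction : ℕ → (ℕ → ℕ → Z.Carrier) → Series
generatingFunction r P n =
  1/ n ! • (λ k → if k ℕ.≤ᵇ r ℕ.* n then P n k else Z.0#)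

δ₀ : ℕ → Z.Carrier
δ₀ zero    = Z.1#
δ₀ (suc _) = Z.0#

------------------------------------------------------------------------
-- Ehrhart theory

-- The rational points of a subset of ℝⁿ.  For an integer t > 0 the lattice
-- points of t𝒳 are t times rational points of 𝒳, so these are all that
-- matter for Ehrhart polynomials.
Region : ℕ → Set₁
Region n = Pred (Vec ℚ n) 0ℓ

dilate : ∀ {n} → ℕ → Region n → Region n
dilate t 𝒳 w = ∃[ v ] 𝒳 v × w ≡ Vec.map (fromℕ t ℚ.*_) v

latticePoints : ∀ {n} → Region n → Pred (Vec ℤ n) 0ℓ
latticePoints 𝒳 a = 𝒳 (Vec.map fromℤ a)

HasCardinality : {A : Set} → Pred A 0ℓ → ℕ → Set
HasCardinality P N =
  ∃[ as ] Unique as × (∀ a → a ∈ as ⇔ P a) × length as ≡ N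

-- Coefficient lists, constant coefficient first.
Polynomial : Set
Polynomial = List ℚ

eval : Polynomial → ℚ → ℚ
eval p t = List.foldr (λ a b → a ℚ.+ t ℚ.* b) 0ℚ p

-- The values at t > 0 determine p as a function, hence also its value at 0.
IsEhrhartPolynomial : ∀ {n} → Region n → Polynomial → Set
IsEhrhartPolynomial 𝒳 p = ∀ t → 1 ℕ.≤ t →
  ∃[ N ] HasCardinality (latticePoints (dilate t 𝒳)) N × eval p (fromℕ t) ≡ fromℕ N

-- E*(𝒳, z) for 𝒳 ⊂ ℝⁿ with Ehrhart polynomial p.
E* : ℕ → Polynomial → Z.Carrier
E* n p = (Z.1# Z.+ (Z.- z₁)) Z^.^ suc n Z.* (λ t → eval p (fromℕ t))

𝒜 : ℕ → (n : ℕ) → ℕ → Region n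
𝒜 r n k v =
  All (λ a → 0ℚ ℚ.≤ a × a ℚ.< fromℕ r) v ×
  fromℕ k ℚ.- 1ℚ ℚ.≤ Σv × Σv ℚ.< fromℕ k
  where Σv = Vec.foldr′ ℚ._+_ 0ℚ v

-- E n k stands for the Ehrhart polynomial of 𝒜 r n k.
A-poly : (ℕ → ℕ → Polynomial) → ℕ → ℕ → Z.Carrier
A-poly E n zero      = δ₀ n
A-poly E n k@(suc _) = E* n (E n k)

A : ℕ → (ℕ → ℕ → Polynomial) → Series
A r E = generatingFunction r (A-poly E)

------------------------------------------------------------------------
-- Colored permutations

words : (m n : ℕ) → List (Vec (Fin m) n)
words m zero    = Vec.[] ∷ []
words m (suc n) = cartesianProductWith Vec._∷_ (allFin m) (words m n)

-- One-line notation σ₁…σₙ, with positions and values counted from 0.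
permutations : (n : ℕ) → List (Vec (Fin n) n)
permutations n = filter unique? (words n n)
  where
  unique? : Decidable (UniqueVec {n = n})
  unique? = AllPairs.allPairs? (λ i j → ¬? (i Fin.≟ j))

Colored : ℕ → ℕ → Set
Colored r n = Vec (Fin n) n × Vec (Fin r) n

coloredPermutations : (r n : ℕ) → List (Colored r n)
coloredPermutations r n = cartesianProduct (permutations n) (words r n)

#_ : ∀ {n} {P : Pred (Fin n) 0ℓ} → Decidable P → ℕ
# P? = length (filter P? (allFin _))

fexc : ∀ {r n} → Colored r n → ℕ
fexc {r} (σ , c) =
  r ℕ.* # (λ i → (toℕ i ℕ.<? toℕ (lookup σ i)) ×-dec (toℕ (lookup c i) ℕ.≟ 0))
  ℕ.+ Vec.sum (Vec.map toℕ c)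

des* : ∀ {r n} → Colored r (suc n) → ℕ
des* {n = n} (σ , c) = # descent?
  where
  Descent : Pred (Fin n) 0ℓ
  Descent i =
    toℕ (lookup c (inject₁ i)) ℕ.< toℕ (lookup c (suc i)) ⊎
    (lookup c (inject₁ i) ≡ lookup c (suc i) ×
     toℕ (lookup σ (inject₁ i)) ℕ.> toℕ (lookup σ (suc i)))

  descent? : Decidable Descent
  descent? i =
    (toℕ (lookup c (inject₁ i)) ℕ.<? toℕ (lookup c (suc i))) ⊎-dec
    ((lookup c (inject₁ i) Fin.≟ lookup c (suc i)) ×-dec
     (toℕ (lookup σ (suc i)) ℕ.<? toℕ (lookup σ (inject₁ i))))

fdes* : ∀ {r n} → Colored r (suc n) → ℕ
fdes* {r} (σ , c) = r ℕ.* des* (σ , c) ℕ.+ toℕ (lookup c zero)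

⌈_/_⌉ : (a r : ℕ) .{{_ : NonZero r}} → ℕ
⌈ a / r ⌉ = (a ℕ.+ (r ∸ 1)) ℕ./ r

-- Used only for k ≤ r n, where r n ∸ k is the integer r n - k; the case
-- n = 0 < k is a dummy value.
C-poly : (r : ℕ) .{{_ : NonZero r}} → ℕ → ℕ → Z.Carrier
C-poly r n       zero      = δ₀ n
C-poly r zero    (suc _)   = Z.0#
C-poly r (suc n) k@(suc _) =
  List.foldr Z._+_ Z.0#
    (List.map (λ π → z₁ Z^.^ ⌈ fdes* π / r ⌉)
      (filter (λ π → fexc π ℕ.≟ r ℕ.* suc n ∸ k) (coloredPermutations r (suc n))))

C : (r : ℕ) .{{_ : NonZero r}} → Series
C r = generatingFunction r (C-poly r)

-- Divided by (1 - z)^{n+1}, both sides of the identity are series Σ_t f(t) z^t with f polynomial,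
-- so it suffices to compare values at t > 0; the value at 0 is then forced.
--
-- A colored permutation together with a chain compatible with its descents is the stable
-- sort of a word over {0, …, rt}: hence C_{n,k} / (1 - z)^{n+1} counts the words w of length n
-- with stat w = rn - k, where stat is the flag excedance of the sorting permutation colored by
-- the letters modulo r. To compute Σ_w u^{|w|} q^{stat w}, eliminate the letters one by one,
-- smallest first. The nonzero letters displaced in a step carry a weight h, and eliminating a
-- letter with weights x (non-excedance) and y (excedance) turns h into h (1 - y) / ((1 - x) (1 - h y)),
-- which is affine in 1/h. The series Σ_w u^{|w|} q^{⌊(Σw - 1)/t⌋} satisfies a linear
-- first-step equation with the same solution, so the two statistics are equidistributed.
-- Choosing the places of the zero letters and complementing the others turns
-- ⌊(Σw - 1)/t⌋ = rn - k into a count of lattice points in dilated slabs: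
--   C_{n,k} = Σ_m (n choose m) (1 - z)^m A_{n-m, k-rm},
-- the coefficient form of the identity.
module Submission where

-- Deleting the letter 0 does not simply leave a shorter word, because the statistic compares places
-- with sorted places. The way out is a cut after as many letters as there are nonzero ones: before
-- it a zero is never an excedance, behind it a nonzero letter always is. A nonzero letter from
-- behind the cut can therefore fill the hole of a zero with a weight independent of its place.
-- Words are enlarged by such displaced letters, of weight `(h - 1) * y`, so that behind the cut an
-- ordinary and a displaced letter together weigh `h * y`. This class is closed under deletion, and
-- `h` times the sum of all weights is invariant. Over the empty alphabet the sum is 1; so, starting
-- from `h = 1`, the last `h` is the generating function. The denominators require inverses of
-- `1 - u * c`. Comparing series in `u` only below degree n + 1 makes `u` nilpotent and geometric
-- series finite, and keeps the coefficient of degree n. Both generating functions then turn out to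
-- be inverse to the same element `κ t`.

-- Ring identities with integer coefficients

module IntegerSolver where
  open import Algebra.Bundles using (CommutativeRing)
  open import Algebra.Solver.Ring.AlmostCommutativeRing using (_-Raw-AlmostCommutative⟶_; fromCommutativeRing)
  import Algebra.Solver.Ring
  import Algebra.Properties.Ring
  import Algebra.Properties.Semiring.Mult.TCOptimised
  open import Data.Integer.Base as ℤ using (ℤ; +_; -[1+_]; 0ℤ; 1ℤ)
  import Data.Integer.Properties as ℤ
  open import Data.Maybe.Base using (Maybe; just; nothing)
  open import Data.Nat.Base as ℕ using (ℕ; zero; suc)
  import Data.Nat.Properties as ℕ
  open import Data.Product.Base using (_×_)
  open import Relation.Nullary using (yes; no)
  open import Relation.Binary.PropositionalEquality as ≡ using (_≡_)

  module IntegerCoefficients {c ℓ} (S : CommutativeRing c ℓ) where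
    open CommutativeRing S
    open Algebra.Properties.Ring ring
    open Algebra.Properties.Semiring.Mult.TCOptimised semiring using (×-homo-+; ×1-homo-*; 1+×) renaming (_×_ to _×#_)
    open import Relation.Binary.Reasoning.Setoid setoid

    ⟦_⟧ℤ : ℤ → Carrier
    ⟦ + n ⟧ℤ      = n ×# 1#
    ⟦ -[1+ n ] ⟧ℤ = - (suc n ×# 1#)

    negate : ∀ a → ⟦ ℤ.- a ⟧ℤ ≈ - ⟦ a ⟧ℤ
    negate (+ zero)    = sym -0#≈0#
    negate (+ (suc n)) = refl
    negate -[1+ n ]    = sym (-‿involutive _)

    diff : ∀ m n → ⟦ m ℤ.⊖ n ⟧ℤ ≈ m ×# 1# - n ×# 1#
    diff zero    zero    = sym (-‿inverseʳ 0#)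
    diff zero    (suc n) = sym (+-identityˡ _)
    diff (suc m) zero    = sym (trans (+-congˡ -0#≈0#) (+-identityʳ _))
    diff (suc m) (suc n) rewrite ℤ.[1+m]⊖[1+n]≡m⊖n m n = begin
      ⟦ m ℤ.⊖ n ⟧ℤ                             ≈⟨ diff m n ⟩
      m ×# 1# - n ×# 1#                        ≈⟨ +-congʳ (sym (xyx⁻¹≈y 1# _)) ⟩
      (1# + m ×# 1# - 1#) - n ×# 1#            ≈⟨ +-assoc _ _ _ ⟩
      (1# + m ×# 1#) + (- 1# - n ×# 1#)        ≈⟨ +-congˡ (-‿+-comm _ _) ⟩
      (1# + m ×# 1#) - (1# + n ×# 1#)          ≈⟨ +-cong (1+× m 1#) (-‿cong (1+× n 1#)) ⟨
      suc m ×# 1# - suc n ×# 1#                ∎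

    homo-+ : ∀ a b → ⟦ a ℤ.+ b ⟧ℤ ≈ ⟦ a ⟧ℤ + ⟦ b ⟧ℤ
    homo-+ (+ m)    (+ n)    = ×-homo-+ 1# m n
    homo-+ (+ m)    -[1+ n ] = diff m (suc n)
    homo-+ -[1+ m ] (+ n)    = trans (diff n (suc m)) (+-comm _ _)
    homo-+ -[1+ m ] -[1+ n ] = begin
      - (suc (suc (m ℕ.+ n)) ×# 1#)        ≡⟨ ≡.cong (λ k → - (suc k ×# 1#)) (≡.sym (ℕ.+-suc m n)) ⟩
      - ((suc m ℕ.+ suc n) ×# 1#)          ≈⟨ -‿cong (×-homo-+ 1# (suc m) (suc n)) ⟩
      - (suc m ×# 1# + suc n ×# 1#)        ≈⟨ sym (-‿+-comm _ _) ⟩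
      - (suc m ×# 1#) - suc n ×# 1#        ∎

    homo-*⁺ : ∀ m b → ⟦ + m ℤ.* b ⟧ℤ ≈ (m ×# 1#) * ⟦ b ⟧ℤ
    homo-*⁺ m (+ n) rewrite ≡.sym (ℤ.pos-* m n) = ×1-homo-* m n
    homo-*⁺ m -[1+ n ] = begin
      ⟦ + m ℤ.* (ℤ.- (+ suc n)) ⟧ℤ       ≡⟨ ≡.cong ⟦_⟧ℤ (≡.sym (ℤ.neg-distribʳ-* (+ m) (+ suc n))) ⟩
      ⟦ ℤ.- (+ m ℤ.* + suc n) ⟧ℤ         ≈⟨ negate (+ m ℤ.* + suc n) ⟩
      - ⟦ + m ℤ.* + suc n ⟧ℤ             ≈⟨ -‿cong (homo-*⁺ m (+ suc n)) ⟩
      - ((m ×# 1#) * (suc n ×# 1#))      ≈⟨ -‿distribʳ-* _ _ ⟩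
      (m ×# 1#) * - (suc n ×# 1#)        ∎

    homo-* : ∀ a b → ⟦ a ℤ.* b ⟧ℤ ≈ ⟦ a ⟧ℤ * ⟦ b ⟧ℤ
    homo-* (+ m)    b = homo-*⁺ m b
    homo-* -[1+ m ] b = begin
      ⟦ (ℤ.- (+ suc m)) ℤ.* b ⟧ℤ    ≡⟨ ≡.cong ⟦_⟧ℤ (≡.sym (ℤ.neg-distribˡ-* (+ suc m) b)) ⟩
      ⟦ ℤ.- (+ suc m ℤ.* b) ⟧ℤ      ≈⟨ negate (+ suc m ℤ.* b) ⟩
      - ⟦ + suc m ℤ.* b ⟧ℤ          ≈⟨ -‿cong (homo-*⁺ (suc m) b) ⟩
      - ((suc m ×# 1#) * ⟦ b ⟧ℤ)    ≈⟨ -‿distribˡ-* _ _ ⟩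
      - (suc m ×# 1#) * ⟦ b ⟧ℤ      ∎

    morphism : ℤ.+-*-rawRing -Raw-AlmostCommutative⟶ fromCommutativeRing S
    morphism = record
      { ⟦_⟧    = ⟦_⟧ℤ
      ; +-homo = homo-+
      ; *-homo = homo-*
      ; -‿homo = negate
      ; 0-homo = refl
      ; 1-homo = refl
      }

    equal? : ∀ a b → Maybe (⟦ a ⟧ℤ ≈ ⟦ b ⟧ℤ)
    equal? a b with a ℤ.≟ b
    ... | yes a≡b = just (reflexive (≡.cong ⟦_⟧ℤ a≡b))
    ... | no _    = nothing

  module RingSolver {c ℓ} (S : CommutativeRing c ℓ) where
    open Algebra.Solver.Ring ℤ.+-*-rawRing (fromCommutativeRing S)
      (IntegerCoefficients.morphism S) (IntegerCoefficients.equal? S) public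
      using (solve; _:=_; _:+_; _:*_; :-_; _:-_; con)

  -- Identities also used over rings of power series, where the solver would unfold the operations.
  module Identities {c ℓ} (S : CommutativeRing c ℓ) where
    open CommutativeRing S
    open RingSolver S

    +-interchange : ∀ a b c d → (a + b) + (c + d) ≈ (a + c) + (b + d)
    +-interchange = solve 4 (λ a b c d → (a :+ b) :+ (c :+ d) := (a :+ c) :+ (b :+ d)) refl

    +-swap : ∀ a b c → a + (b + c) ≈ b + (a + c)
    +-swap = solve 3 (λ a b c → a :+ (b :+ c) := b :+ (a :+ c)) refl

    +-cancelˡ : ∀ a b → (a + b) - a ≈ b
    +-cancelˡ = solve 2 (λ a b → (a :+ b) :- a := b) refl

    -0# : ∀ a → a - 0# ≈ a
    -0# = solve 1 (λ a → a :- con 0ℤ := a) refl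

    1-*-expand : ∀ z f → (1# - z) * f ≈ f - z * f
    1-*-expand = solve 2 (λ z f → (con 1ℤ :- z) :* f := f :- z :* f) refl

    *-rotate : ∀ a b c → a * b * c ≈ b * (a * c)
    *-rotate = solve 3 (λ a b c → a :* b :* c := b :* (a :* c)) refl

    *-swap : ∀ a b c → a * (b * c) ≈ b * (a * c)
    *-swap = solve 3 (λ a b c → a :* (b :* c) := b :* (a :* c)) refl

    regroup : ∀ n b f m g j → n * b * ((f * m) * (g * j)) ≈ (b * (f * g)) * n * (m * j)
    regroup = solve 6 (λ n b f m g j → (n :* b :* ((f :* m) :* (g :* j))) := ((b :* (f :* g)) :* n :* (m :* j))) refl

-- Finite sums and linear summation functionals

module Summation where
  open IntegerSolver
  open import Algebra.Bundles using (CommutativeRing)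
  open import Data.Bool.Base using (Bool; if_then_else_)
  open import Data.List.Base using (List; []; _∷_; _++_; length)
  open import Data.Nat.Base as ℕ using (ℕ; zero; suc; _≤_; _<_; z≤n; s≤s; _≡ᵇ_)
  import Data.Nat.Properties as ℕ
  open import Function.Base using (_∘_)
  import Level
  open import Relation.Binary.PropositionalEquality as ≡ using (_≡_)

  module FiniteSums {c ℓ} (S : CommutativeRing c ℓ) where
    open CommutativeRing S
    open import Algebra.Properties.Semiring.Exp semiring public using (_^_; ^-homo-*; ^-congˡ)
    open import Relation.Binary.Reasoning.Setoid setoid

    ind : Bool → Carrier
    ind b = if b then 1# else 0#

    ∑< : ℕ → (ℕ → Carrier) → Carrier
    ∑< zero    f = 0#
    ∑< (suc n) f = f 0 + ∑< n (f ∘ suc)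

    -- Sums over an initial segment, over tokens, over words and over lists are all of this kind and
    -- so share the laws of scaling and exchange.
    record Linear {A : Set} (I : (A → Carrier) → Carrier) : Set (c Level.⊔ ℓ) where
      field
        cong  : ∀ {f g} → (∀ a → f a ≈ g a) → I f ≈ I g
        add   : ∀ f g → I (λ a → f a + g a) ≈ I f + I g
        scale : ∀ k f → I (λ a → k * f a) ≈ k * I f

      scaleʳ : ∀ k f → I (λ a → f a * k) ≈ I f * k
      scaleʳ k f = trans (cong λ a → *-comm _ _) (trans (scale k f) (*-comm _ _))

      vanish : ∀ {f} → (∀ a → f a ≈ 0#) → I f ≈ 0#
      vanish {f} f≈0 = begin
        I f                   ≈⟨ cong (λ a → trans (f≈0 a) (sym (zeroˡ 0#))) ⟩
        I (λ _ → 0# * 0#)     ≈⟨ scale 0# _ ⟩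
        0# * I (λ _ → 0#)     ≈⟨ zeroˡ _ ⟩
        0#                    ∎

      ∑-swap : ∀ n (f : A → ℕ → Carrier) →
               I (λ a → ∑< n (f a)) ≈ ∑< n (λ i → I (λ a → f a i))
      ∑-swap zero    f = vanish (λ _ → refl)
      ∑-swap (suc n) f = trans (add _ _) (+-congˡ (∑-swap n (λ a → f a ∘ suc)))

    ∑-cong< : ∀ n {f g} → (∀ i → i < n → f i ≈ g i) → ∑< n f ≈ ∑< n g
    ∑-cong< zero    eq = refl
    ∑-cong< (suc n) eq = +-cong (eq 0 (s≤s z≤n)) (∑-cong< n (λ i i<n → eq (suc i) (s≤s i<n)))

    ∑-linear : ∀ n → Linear (∑< n)
    ∑-linear n = record { cong = λ eq → ∑-cong< n (λ i _ → eq i) ; add = add n ; scale = scale n }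
      where
      add : ∀ n f g → ∑< n (λ a → f a + g a) ≈ ∑< n f + ∑< n g
      add zero    f g = sym (+-identityˡ 0#)
      add (suc n) f g = trans (+-congˡ (add n _ _))
        (Identities.+-interchange S _ _ _ _)
      scale : ∀ n k f → ∑< n (λ a → k * f a) ≈ k * ∑< n f
      scale zero    k f = sym (zeroʳ k)
      scale (suc n) k f = trans (+-congˡ (scale n k _)) (sym (distribˡ k _ _))

    ∑-cong : ∀ n {f g} → (∀ i → f i ≈ g i) → ∑< n f ≈ ∑< n g
    ∑-cong n = Linear.cong (∑-linear n)

    ∑-last : ∀ n f → ∑< (suc n) f ≈ ∑< n f + f n
    ∑-last zero    f = +-comm _ _
    ∑-last (suc n) f = trans (+-congˡ (∑-last n (f ∘ suc))) (sym (+-assoc _ _ _))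

    ∑-split : ∀ m n f → ∑< (m ℕ.+ n) f ≈ ∑< m f + ∑< n (λ i → f (m ℕ.+ i))
    ∑-split zero    n f = sym (+-identityˡ _)
    ∑-split (suc m) n f = trans (+-congˡ (∑-split m n (f ∘ suc))) (sym (+-assoc _ _ _))

    ∑-blocks : ∀ m k f → ∑< (m ℕ.* k) f ≈ ∑< m (λ i → ∑< k (λ j → f (i ℕ.* k ℕ.+ j)))
    ∑-blocks zero    k f = refl
    ∑-blocks (suc m) k f = trans (∑-split k (m ℕ.* k) f) (+-congˡ (trans (∑-blocks m k _)
      (∑-cong m λ i → ∑-cong k λ j → reflexive (≡.cong f (≡.sym (ℕ.+-assoc k (i ℕ.* k) j))))))

    ∑-zero< : ∀ n {f} → (∀ i → i < n → f i ≈ 0#) → ∑< n f ≈ 0#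
    ∑-zero< n eq = trans (∑-cong< n eq) (Linear.vanish (∑-linear n) (λ _ → refl))

    -- Both sides are the sum of the first `k + n` values, split once after `k` and once after `n`
    -- terms. This turns sums over pairs of lengths into sums over total lengths.
    ∑-shift : ∀ k n f → (∀ i → i < k → f i ≈ 0#) → (∀ i → n ≤ i → f i ≈ 0#) →
              ∑< n (λ i → f (k ℕ.+ i)) ≈ ∑< n f
    ∑-shift k n f low high = begin
      ∑< n (λ i → f (k ℕ.+ i))                ≈⟨ sym (+-identityˡ _) ⟩
      0# + ∑< n (λ i → f (k ℕ.+ i))           ≈⟨ +-congʳ (sym (∑-zero< k low)) ⟩
      ∑< k f + ∑< n (λ i → f (k ℕ.+ i))       ≈⟨ sym (∑-split k n f) ⟩
      ∑< (k ℕ.+ n) f                          ≡⟨ ≡.cong (λ m → ∑< m f) (ℕ.+-comm k n) ⟩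
      ∑< (n ℕ.+ k) f                          ≈⟨ ∑-split n k f ⟩
      ∑< n f + ∑< k (λ i → f (n ℕ.+ i))       ≈⟨ +-congˡ (∑-zero< k (λ i _ → high _ (ℕ.m≤m+n n i))) ⟩
      ∑< n f + 0#                             ≈⟨ +-identityʳ _ ⟩
      ∑< n f                                  ∎

    ∑-ind : ∀ n k → k < n → (f : ℕ → Carrier) → ∑< n (λ i → ind (k ≡ᵇ i) * f i) ≈ f k
    ∑-ind (suc n) zero (s≤s _) f = begin
      1# * f 0 + ∑< n (λ i → 0# * f (suc i))    ≈⟨ +-cong (*-identityˡ _) (∑-zero< n (λ i _ → zeroˡ _)) ⟩
      f 0 + 0#                                  ≈⟨ +-identityʳ _ ⟩
      f 0                                       ∎
    ∑-ind (suc n) (suc k) (s≤s k<n) f = begin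
      0# * f 0 + ∑< n (λ i → ind (k ≡ᵇ i) * f (suc i))   ≈⟨ +-cong (zeroˡ _) (∑-ind n k k<n (f ∘ suc)) ⟩
      0# + f (suc k)                                     ≈⟨ +-identityˡ _ ⟩
      f (suc k)                                          ∎

    -- The functional `I` sums over one letter; leaving it open covers plain letters and tokens
    -- alike.
    ∑words : {A : Set} → ((A → Carrier) → Carrier) → ℕ → (List A → Carrier) → Carrier
    ∑words I zero    F = F []
    ∑words I (suc n) F = I (λ a → ∑words I n (λ w → F (a ∷ w)))

    module _ {A : Set} {I : (A → Carrier) → Carrier} (lin : Linear I) where
      private module I = Linear lin

      ∑words-cong : ∀ n {F G} → (∀ w → length w ≡ n → F w ≈ G w) → ∑words I n F ≈ ∑words I n G
      ∑words-cong zero    eq = eq [] ≡.refl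
      ∑words-cong (suc n) eq = I.cong λ a → ∑words-cong n λ w |w|≡n → eq (a ∷ w) (≡.cong suc |w|≡n)

      ∑words-linear : ∀ n → Linear (∑words I n)
      ∑words-linear n = record
        { cong  = λ eq → ∑words-cong n (λ w _ → eq w)
        ; add   = add n
        ; scale = scale n
        }
        where
        add : ∀ n F G → ∑words I n (λ w → F w + G w) ≈ ∑words I n F + ∑words I n G
        add zero    F G = refl
        add (suc n) F G = trans (I.cong λ a → add n _ _) (I.add _ _)
        scale : ∀ n k F → ∑words I n (λ w → k * F w) ≈ k * ∑words I n F
        scale zero    k F = refl
        scale (suc n) k F = trans (I.cong λ a → scale n k _) (I.scale k _)

      ∑words-++ : ∀ m n F → ∑words I (m ℕ.+ n) F ≈ ∑words I m (λ v → ∑words I n (λ w → F (v ++ w)))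
      ∑words-++ zero    n F = refl
      ∑words-++ (suc m) n F = I.cong λ a → ∑words-++ m n (λ w → F (a ∷ w))

-- Cutting and merging words, and the factorisation of their weights

module Tokens where
  open IntegerSolver
  open Summation
  open import Algebra.Bundles using (CommutativeRing)
  open import Data.Bool.Base using (Bool; true; false; if_then_else_)
  open import Data.Bool.Properties using (T-≡)
  open import Data.Empty using (⊥-elim)
  open import Data.Integer.Base using (1ℤ)
  open import Data.List.Base using (List; []; _∷_; _++_; length)
  import Data.List.Properties as List
  open import Data.Nat.Base as ℕ using (ℕ; zero; suc; _≤_; _<_; z≤n; s≤s; _≡ᵇ_; _≤ᵇ_; _<ᵇ_; _∸_; pred)
  import Data.Nat.Properties as ℕ
  open import Function.Base using (_∘_)
  open import Function.Bundles using (Equivalence)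
  import Level
  open import Relation.Binary.PropositionalEquality as ≡ using (_≡_)
  open import Relation.Nullary using (yes; no)

  -- A letter of a word over ℕ, either in its own place (pure) or moved into the place of a
  -- deleted letter; see merge.
  data Token : Set where
    pure moved : ℕ → Token

  letter : Token → ℕ
  letter (pure b)  = b
  letter (moved b) = b

  isPure : ℕ → Token → Bool
  isPure b (pure c)  = b ≡ᵇ c
  isPure b (moved c) = false

  count : {A : Set} → (A → Bool) → List A → ℕ
  count p []      = 0
  count p (a ∷ w) = if p a then suc (count p w) else count p w

  count-++ : {A : Set} (p : A → Bool) → ∀ v w → count p (v ++ w) ≡ count p v ℕ.+ count p w
  count-++ p []      w = ≡.refl
  count-++ p (a ∷ v) w with p a
  ... | true  = ≡.cong suc (count-++ p v w)
  ... | false = count-++ p v w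

  greater : ℕ → List Token → ℕ
  greater b = count (λ τ → b <ᵇ letter τ)

  zeros : List Token → ℕ
  zeros = count (λ τ → letter τ ≡ᵇ 0)

  nonzeros : List Token → ℕ
  nonzeros = greater 0

  equals : ℕ → List Token → ℕ
  equals b = count (λ τ → b ≡ᵇ letter τ)

  pures : ℕ → List Token → ℕ
  pures b = count (isPure b)

  -- A stable sort into decreasing order takes the letter b from place p to place
  -- s + (p ∸ others), for s letters greater than b and others earlier letters different
  -- from b: it does not move to the left exactly if others ≤ s.
  seen : Token → (ℕ → ℕ) → ℕ → ℕ
  seen τ others b = if isPure b τ then others b else suc (others b)

  seenAll : List Token → (ℕ → ℕ) → ℕ → ℕ
  seenAll []      others = others
  seenAll (τ ∷ w) others = seenAll w (seen τ others)

  -- To delete the letter 0, cut a word after as many letters as it has nonzero ones. The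
  -- nonzero letters of the tail are then as many as the zeros of the head: they take over
  -- the places of those zeros, all other letters are lowered by one.
  merge : List Token → List ℕ → List Token
  merge []                _       = []
  merge (pure (suc b) ∷ w)  f       = pure b ∷ merge w f
  merge (moved (suc b) ∷ w) f       = moved b ∷ merge w f
  merge (pure zero ∷ w)     []      = []
  merge (moved zero ∷ w)    []      = []
  merge (pure zero ∷ w)     (b ∷ f) = moved b ∷ merge w f
  merge (moved zero ∷ w)    (b ∷ f) = moved b ∷ merge w f

  nonzeroLetters : List Token → List ℕ
  nonzeroLetters []      = []
  nonzeroLetters (τ ∷ w) with letter τ
  ... | zero  = nonzeroLetters w
  ... | suc b = b ∷ nonzeroLetters w

  length-nonzeroLetters : ∀ w → length (nonzeroLetters w) ≡ nonzeros w
  length-nonzeroLetters []      = ≡.refl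
  length-nonzeroLetters (τ ∷ w) with letter τ
  ... | zero  = length-nonzeroLetters w
  ... | suc b = ≡.cong suc (length-nonzeroLetters w)

  nonzeros+zeros : ∀ w → nonzeros w ℕ.+ zeros w ≡ length w
  nonzeros+zeros []      = ≡.refl
  nonzeros+zeros (τ ∷ w) with letter τ
  ... | zero  = ≡.trans (ℕ.+-suc _ _) (≡.cong suc (nonzeros+zeros w))
  ... | suc b = ≡.cong suc (nonzeros+zeros w)

  pures≤equals : ∀ b w → pures b w ≤ equals b w
  pures≤equals b []            = z≤n
  pures≤equals b (pure c ∷ w) with b ≡ᵇ c
  ... | true  = s≤s (pures≤equals b w)
  ... | false = pures≤equals b w
  pures≤equals b (moved c ∷ w) with b ≡ᵇ c
  ... | true  = ℕ.m≤n⇒m≤1+n (pures≤equals b w)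
  ... | false = pures≤equals b w

  pures≤zeros : ∀ w → pures 0 w ≤ zeros w
  pures≤zeros []                 = z≤n
  pures≤zeros (pure zero ∷ w)    = s≤s (pures≤zeros w)
  pures≤zeros (pure (suc c) ∷ w) = pures≤zeros w
  pures≤zeros (moved zero ∷ w)   = ℕ.m≤n⇒m≤1+n (pures≤zeros w)
  pures≤zeros (moved (suc c) ∷ w) = pures≤zeros w

  -- Each token raises exactly one of the two counts, since a moved `b` counts as different from
  -- `b`.
  seenAll-pures : ∀ w others b → seenAll w others b ℕ.+ pures b w ≡ others b ℕ.+ length w
  seenAll-pures []      others b = ≡.refl
  seenAll-pures (τ ∷ w) others b with isPure b τ in eq
  ... | true  = ≡.trans (ℕ.+-suc _ _) (≡.trans (≡.cong suc (≡.trans (seenAll-pures w (seen τ others) b)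
                  (≡.cong (λ p → (if p then others b else suc (others b)) ℕ.+ length w) eq))) (≡.sym (ℕ.+-suc _ _)))
  ... | false = ≡.trans (seenAll-pures w (seen τ others) b) (≡.trans
                  (≡.cong (λ p → (if p then others b else suc (others b)) ℕ.+ length w) eq) (≡.sym (ℕ.+-suc _ _)))

  greater+equals≤nonzeros : ∀ b w → greater (suc b) w ℕ.+ equals (suc b) w ≤ nonzeros w
  greater+equals≤nonzeros b []      = z≤n
  greater+equals≤nonzeros b (τ ∷ w) with letter τ
  ... | zero  = greater+equals≤nonzeros b w
  ... | suc c with b <ᵇ c in b<c | b ≡ᵇ c in b≡c
  ...   | true  | true  = ⊥-elim (ℕ.<⇒≢ (ℕ.<ᵇ⇒< b c (Equivalence.from T-≡ b<c)) (ℕ.≡ᵇ⇒≡ b c (Equivalence.from T-≡ b≡c)))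
  ...   | true  | false = s≤s (greater+equals≤nonzeros b w)
  ...   | false | true  = ≡.subst (_≤ suc (nonzeros w)) (≡.sym (ℕ.+-suc _ _)) (s≤s (greater+equals≤nonzeros b w))
  ...   | false | false = ℕ.m≤n⇒m≤1+n (greater+equals≤nonzeros b w)

  -- The zeros of the head are exactly the holes for the list, so no entry is lost, and every
  -- nonzero letter of the head drops by one.
  greater-merge : ∀ b h t → zeros h ≡ length t → greater b (merge h t) ≡
                  greater (suc b) h ℕ.+ count (b <ᵇ_) t
  greater-merge b []                []      eq = ≡.refl
  greater-merge b (pure (suc c) ∷ h)  t     eq with b <ᵇ c
  ... | true  = ≡.cong suc (greater-merge b h t eq)
  ... | false = greater-merge b h t eq
  greater-merge b (moved (suc c) ∷ h) t     eq with b <ᵇ c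
  ... | true  = ≡.cong suc (greater-merge b h t eq)
  ... | false = greater-merge b h t eq
  greater-merge b (pure zero ∷ h)  (c ∷ t) eq with b <ᵇ c
  ... | true  = ≡.trans (≡.cong suc (greater-merge b h t (ℕ.suc-injective eq))) (≡.sym (ℕ.+-suc _ _))
  ... | false = greater-merge b h t (ℕ.suc-injective eq)
  greater-merge b (moved zero ∷ h) (c ∷ t) eq with b <ᵇ c
  ... | true  = ≡.trans (≡.cong suc (greater-merge b h t (ℕ.suc-injective eq))) (≡.sym (ℕ.+-suc _ _))
  ... | false = greater-merge b h t (ℕ.suc-injective eq)

  greater-nonzeroLetters : ∀ b w → count (b <ᵇ_) (nonzeroLetters w) ≡ greater (suc b) w
  greater-nonzeroLetters b []      = ≡.refl
  greater-nonzeroLetters b (τ ∷ w) with letter τ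
  ... | zero  = greater-nonzeroLetters b w
  ... | suc c with b <ᵇ c
  ...   | true  = ≡.cong suc (greater-nonzeroLetters b w)
  ...   | false = greater-nonzeroLetters b w

  +-≡ᵇ-cancelˡ : ∀ a b c → (a ℕ.+ b ≡ᵇ a ℕ.+ c) ≡ (b ≡ᵇ c)
  +-≡ᵇ-cancelˡ zero    b c = ≡.refl
  +-≡ᵇ-cancelˡ (suc a) b c = +-≡ᵇ-cancelˡ a b c

  ≤⇒≤ᵇ≡true : ∀ {m n} → m ≤ n → (m ≤ᵇ n) ≡ true
  ≤⇒≤ᵇ≡true m≤n with Equivalence.to T-≡ (ℕ.≤⇒≤ᵇ m≤n)
  ... | eq = eq

  >⇒≤ᵇ≡false : ∀ {m n} → n < m → (m ≤ᵇ n) ≡ false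
  >⇒≤ᵇ≡false {m} {n} n<m with m ≤ᵇ n in eq
  ... | false = ≡.refl
  ... | true  = ⊥-elim (ℕ.<⇒≱ n<m (ℕ.≤ᵇ⇒≤ m n (Equivalence.from T-≡ eq)))

  -- The letters from `suc b` upwards number at most `length h`. Removing the pure copies of `suc b`
  -- in the head leaves, on the right, what `seenAll` counts, and on the left at least the greater
  -- letters plus the copies in the tail. So a pure nonzero letter of the tail always has weight
  -- `y`.
  greater-tail : ∀ b h t → nonzeros (h ++ t) ≡ length h →
                 greater (suc b) (h ++ t) ℕ.+ equals (suc b) t ≤ seenAll h (λ _ → 0) (suc b)
  greater-tail b h t nz = ℕ.+-cancelʳ-≤ (pures (suc b) h) _ _ (begin
    s ℕ.+ equals (suc b) t ℕ.+ pures (suc b) h          ≤⟨ ℕ.+-monoʳ-≤ (s ℕ.+ equals (suc b) t) (pures≤equals (suc b) h) ⟩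
    s ℕ.+ equals (suc b) t ℕ.+ equals (suc b) h         ≡⟨ ℕ.+-assoc s _ _ ⟩
    s ℕ.+ (equals (suc b) t ℕ.+ equals (suc b) h)       ≡⟨ ≡.cong (s ℕ.+_) (ℕ.+-comm (equals (suc b) t) _) ⟩
    s ℕ.+ (equals (suc b) h ℕ.+ equals (suc b) t)       ≡⟨ ≡.cong (s ℕ.+_) (count-++ _ h t) ⟨
    s ℕ.+ equals (suc b) (h ++ t)                       ≤⟨ greater+equals≤nonzeros b (h ++ t) ⟩
    nonzeros (h ++ t)                                   ≡⟨ nz ⟩
    length h                                            ≡⟨ seenAll-pures h (λ _ → 0) (suc b) ⟨
    seenAll h (λ _ → 0) (suc b) ℕ.+ pures (suc b) h     ∎)
    where
    open ℕ.≤-Reasoning hiding (equals)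
    s = greater (suc b) (h ++ t)

  module Weights {c ℓ} (S : CommutativeRing c ℓ) where
    open CommutativeRing S
    open RingSolver S
    open FiniteSums S
    open import Relation.Binary.Reasoning.Setoid setoid

    module _ (x y : ℕ → Carrier) where
      -- `x` belongs to non-excedances and `y` to excedances. A moved letter has its weight in
      -- `movedWeight`, yet it still counts among the others of later letters.
      factor : (ℕ → ℕ) → (ℕ → ℕ) → Token → Carrier
      factor s others (pure b)  = if others b ≤ᵇ s b then x b else y b
      factor s others (moved b) = 1#

      pureWeight : (ℕ → ℕ) → (ℕ → ℕ) → List Token → Carrier
      pureWeight s others []      = 1#
      pureWeight s others (τ ∷ w) = factor s others τ * pureWeight s (seen τ others) w

      movedWeight : Carrier → List Token → Carrier
      movedWeight δ []            = 1#
      movedWeight δ (pure b ∷ w)  = movedWeight δ w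
      movedWeight δ (moved b ∷ w) = δ * y b * movedWeight δ w

      Φ : List Token → Carrier
      Φ w = pureWeight (λ b → greater b w) (λ _ → 0) w

      weight : Carrier → List Token → Carrier
      weight δ w = Φ w * movedWeight δ w

      pureWeight-++ : ∀ s others v w → pureWeight s others (v ++ w) ≈
                      pureWeight s others v * pureWeight s (seenAll v others) w
      pureWeight-++ s others []      w = sym (*-identityˡ _)
      pureWeight-++ s others (τ ∷ v) w = trans (*-congˡ (pureWeight-++ s (seen τ others) v w)) (sym (*-assoc _ _ _))

      movedWeight-++ : ∀ δ v w → movedWeight δ (v ++ w) ≈ movedWeight δ v * movedWeight δ w
      movedWeight-++ δ []            w = sym (*-identityˡ _)
      movedWeight-++ δ (pure b ∷ v)  w = movedWeight-++ δ v w
      movedWeight-++ δ (moved b ∷ v) w = trans (*-congˡ (movedWeight-++ δ v w)) (sym (*-assoc _ _ _))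

      -- What the head contributes beyond the pure weight of the merged word: its pure zeros are
      -- never excedances, and its pure nonzero letters keep their factor in the merged word.
      headWeight : Carrier → List Token → Carrier
      headWeight δ []                  = 1#
      headWeight δ (pure zero ∷ w)     = x 0 * headWeight δ w
      headWeight δ (moved zero ∷ w)    = δ * y 0 * headWeight δ w
      headWeight δ (pure (suc b) ∷ w)  = headWeight δ w
      headWeight δ (moved (suc b) ∷ w) = δ * y (suc b) * headWeight δ w

      zeroWeight : ℕ → Carrier
      zeroWeight zero    = y 0
      zeroWeight (suc _) = x 0

      -- `κ` is the number of tokens other than a pure 0 that have to pass before a pure 0 becomes
      -- an excedance.
      tailWeight : Carrier → ℕ → List Token → Carrier
      tailWeight δ κ []                  = 1#
      tailWeight δ κ (pure zero ∷ w)     = zeroWeight κ * tailWeight δ κ w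
      tailWeight δ κ (moved zero ∷ w)    = δ * y 0 * tailWeight δ (pred κ) w
      tailWeight δ κ (pure (suc b) ∷ w)  = y (suc b) * tailWeight δ (pred κ) w
      tailWeight δ κ (moved (suc b) ∷ w) = δ * y (suc b) * tailWeight δ (pred κ) w

      zeroWeight-≤ : ∀ m n → (if m ≤ᵇ n then x 0 else y 0) ≡ zeroWeight (suc n ∸ m)
      zeroWeight-≤ m n with m ℕ.≤? n
      ... | yes m≤n rewrite ≤⇒≤ᵇ≡true m≤n | ℕ.+-∸-assoc 1 m≤n = ≡.refl
      ... | no m≰n rewrite >⇒≤ᵇ≡false (ℕ.≰⇒> m≰n) | ℕ.m≤n⇒m∸n≡0 (ℕ.≰⇒> m≰n) = ≡.refl

      -- The hypothesis is an invariant along the tail: a copy of `suc b` that passes leaves one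
      -- copy fewer to come. It settles all pure nonzero letters as excedances, so that only the
      -- comparison for pure zeros has to be tracked, by `κ`.
      tail-weight : ∀ δ s others t → (∀ b → s (suc b) ℕ.+ equals (suc b) t ≤ others (suc b)) →
                    pureWeight s others t * movedWeight δ t ≈ tailWeight δ (suc (s 0) ∸ others 0) t
      tail-weight δ s others []                 inv = *-identityˡ 1#
      tail-weight δ s others (pure zero ∷ t)    inv = begin
        (if others 0 ≤ᵇ s 0 then x 0 else y 0) * pureWeight s (seen (pure 0) others) t * movedWeight δ t ≈⟨ *-assoc _ _ _ ⟩
        (if others 0 ≤ᵇ s 0 then x 0 else y 0) * (pureWeight s (seen (pure 0) others) t * movedWeight δ t)
          ≈⟨ *-cong (reflexive (zeroWeight-≤ (others 0) (s 0)))
               (tail-weight δ s (seen (pure 0) others) t (λ b → ℕ.m≤n⇒m≤1+n (inv b))) ⟩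
        _ ∎
      tail-weight δ s others (moved zero ∷ t)   inv = begin
        1# * pureWeight s (seen (moved 0) others) t * (δ * y 0 * movedWeight δ t)
          ≈⟨ solve 3 (λ a b c → (con 1ℤ :* a) :* (b :* c) := b :* (a :* c)) refl _ _ _ ⟩
        δ * y 0 * (pureWeight s (seen (moved 0) others) t * movedWeight δ t)
          ≈⟨ *-congˡ (tail-weight δ s (seen (moved 0) others) t (λ b → ℕ.m≤n⇒m≤1+n (inv b))) ⟩
        δ * y 0 * tailWeight δ (s 0 ∸ others 0) t
          ≡⟨ ≡.cong (λ k → δ * y 0 * tailWeight δ k t) (≡.sym (ℕ.pred[m∸n]≡m∸[1+n] (suc (s 0)) (others 0))) ⟩
        _ ∎
      tail-weight δ s others (pure (suc c) ∷ t) inv = begin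
        (if others (suc c) ≤ᵇ s (suc c) then x (suc c) else y (suc c)) * pureWeight s (seen (pure (suc c)) others) t * movedWeight δ t
          ≡⟨ ≡.cong (λ p → (if p then x (suc c) else y (suc c)) * pureWeight s (seen (pure (suc c)) others) t * movedWeight δ t)
               (>⇒≤ᵇ≡false (below c (inv c))) ⟩
        y (suc c) * pureWeight s (seen (pure (suc c)) others) t * movedWeight δ t
          ≈⟨ *-assoc _ _ _ ⟩
        y (suc c) * (pureWeight s (seen (pure (suc c)) others) t * movedWeight δ t)
          ≈⟨ *-congˡ (tail-weight δ s (seen (pure (suc c)) others) t keep) ⟩
        y (suc c) * tailWeight δ (s 0 ∸ others 0) t
          ≡⟨ ≡.cong (λ k → y (suc c) * tailWeight δ k t) (≡.sym (ℕ.pred[m∸n]≡m∸[1+n] (suc (s 0)) (others 0))) ⟩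
        _ ∎
        where
        -- The letter at hand is itself one of the counted copies, which makes the inequality
        -- strict.
        below : ∀ c → s (suc c) ℕ.+ (if c ≡ᵇ c then suc (equals (suc c) t) else equals (suc c) t) ≤ others (suc c) →
                s (suc c) < others (suc c)
        below c le rewrite Equivalence.to T-≡ (ℕ.≡⇒≡ᵇ c c ≡.refl) = ℕ.≤-trans (ℕ.≤-trans (s≤s (ℕ.m≤m+n _ _)) (ℕ.≤-reflexive (≡.sym (ℕ.+-suc _ _)))) le
        keep : ∀ b → s (suc b) ℕ.+ equals (suc b) t ≤ seen (pure (suc c)) others (suc b)
        keep b with b ≡ᵇ c | inv b
        ... | true  | le = ℕ.≤-trans (ℕ.+-monoʳ-≤ (s (suc b)) (ℕ.n≤1+n _)) le
        ... | false | le = ℕ.m≤n⇒m≤1+n le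
      tail-weight δ s others (moved (suc c) ∷ t) inv = begin
        1# * pureWeight s (seen (moved (suc c)) others) t * (δ * y (suc c) * movedWeight δ t)
          ≈⟨ solve 3 (λ a b c → (con 1ℤ :* a) :* (b :* c) := b :* (a :* c)) refl _ _ _ ⟩
        δ * y (suc c) * (pureWeight s (seen (moved (suc c)) others) t * movedWeight δ t)
          ≈⟨ *-congˡ (tail-weight δ s (seen (moved (suc c)) others) t keep) ⟩
        δ * y (suc c) * tailWeight δ (s 0 ∸ others 0) t
          ≡⟨ ≡.cong (λ k → δ * y (suc c) * tailWeight δ k t) (≡.sym (ℕ.pred[m∸n]≡m∸[1+n] (suc (s 0)) (others 0))) ⟩
        _ ∎
        where
        keep : ∀ b → s (suc b) ℕ.+ equals (suc b) t ≤ suc (others (suc b))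
        keep b with b ≡ᵇ c | inv b
        ... | true  | le = ℕ.m≤n⇒m≤1+n (ℕ.≤-trans (ℕ.+-monoʳ-≤ (s (suc b)) (ℕ.n≤1+n _)) le)
        ... | false | le = ℕ.m≤n⇒m≤1+n le

    module _ (x y : ℕ → Carrier) where
      -- A filled hole is a moved token, which counts as another letter for every `b`, just as the
      -- zero did; so the counts of others agree along the head. The bound on `others 0` makes every
      -- pure zero a non-excedance.
      head-weight : ∀ δ s s′ others others′ h f → (∀ b → s (suc b) ≡ s′ b) → (∀ b → others (suc b) ≡ others′ b) →
                    others 0 ℕ.+ length h ≤ s 0 → zeros h ≡ length f →
                    pureWeight x y s others h * movedWeight x y δ h ≈
                    pureWeight (x ∘ suc) (y ∘ suc) s′ others′ (merge h f) * headWeight x y δ h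
      head-weight δ s s′ o o′ [] [] s≗ o≗ low len = refl
      head-weight δ s s′ o o′ (pure zero ∷ h) (c ∷ f) s≗ o≗ low len
        rewrite ≤⇒≤ᵇ≡true (ℕ.≤-trans (ℕ.m≤m+n (o 0) (suc (length h))) low) = begin
        x 0 * pureWeight x y s _ h * movedWeight x y δ h     ≈⟨ *-assoc _ _ _ ⟩
        x 0 * (pureWeight x y s _ h * movedWeight x y δ h)   ≈⟨ *-congˡ (head-weight δ s s′ _ (suc ∘ o′) h f s≗ (λ b → ≡.cong suc (o≗ b))
                                                                (ℕ.≤-trans (ℕ.+-monoʳ-≤ (o 0) (ℕ.n≤1+n _)) low) (ℕ.suc-injective len)) ⟩
        x 0 * (pureWeight _ _ s′ _ (merge h f) * headWeight x y δ h)
          ≈⟨ solve 3 (λ a b c → a :* (b :* c) := (con 1ℤ :* b) :* (a :* c)) refl _ _ _ ⟩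
        1# * pureWeight _ _ s′ _ (merge h f) * (x 0 * headWeight x y δ h) ∎
      head-weight δ s s′ o o′ (moved zero ∷ h) (c ∷ f) s≗ o≗ low len = begin
        1# * pureWeight x y s _ h * (δ * y 0 * movedWeight x y δ h)
          ≈⟨ solve 3 (λ a b c → (con 1ℤ :* a) :* (b :* c) := b :* (a :* c)) refl _ _ _ ⟩
        δ * y 0 * (pureWeight x y s _ h * movedWeight x y δ h)
          ≈⟨ *-congˡ (head-weight δ s s′ _ (suc ∘ o′) h f s≗ (λ b → ≡.cong suc (o≗ b))
                  (ℕ.≤-trans (ℕ.≤-reflexive (≡.sym (ℕ.+-suc (o 0) _))) low) (ℕ.suc-injective len)) ⟩
        δ * y 0 * (pureWeight _ _ s′ _ (merge h f) * headWeight x y δ h)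
          ≈⟨ solve 3 (λ a b c → a :* (b :* c) := (con 1ℤ :* b) :* (a :* c)) refl _ _ _ ⟩
        1# * pureWeight _ _ s′ _ (merge h f) * (δ * y 0 * headWeight x y δ h) ∎
      head-weight δ s s′ o o′ (pure (suc c) ∷ h) f s≗ o≗ low len rewrite s≗ c | o≗ c = begin
        w * pureWeight x y s _ h * movedWeight x y δ h       ≈⟨ *-assoc _ _ _ ⟩
        w * (pureWeight x y s _ h * movedWeight x y δ h)     ≈⟨ *-congˡ (head-weight δ s s′ _ (seen (pure c) o′) h f s≗
                                                                  (λ b → ≡.cong (λ m → if b ≡ᵇ c then m else suc m) (o≗ b))
                                                                  (ℕ.≤-trans (ℕ.≤-reflexive (≡.sym (ℕ.+-suc (o 0) _))) low) len) ⟩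
        w * (pureWeight _ _ s′ _ (merge h f) * headWeight x y δ h) ≈⟨ *-assoc _ _ _ ⟨
        w * pureWeight _ _ s′ _ (merge h f) * headWeight x y δ h   ∎
        where w = if o′ c ≤ᵇ s′ c then x (suc c) else y (suc c)
      head-weight δ s s′ o o′ (moved (suc c) ∷ h) f s≗ o≗ low len = begin
        1# * pureWeight x y s _ h * (δ * y (suc c) * movedWeight x y δ h)
          ≈⟨ solve 3 (λ a b c → (con 1ℤ :* a) :* (b :* c) := b :* (a :* c)) refl _ _ _ ⟩
        δ * y (suc c) * (pureWeight x y s _ h * movedWeight x y δ h)
          ≈⟨ *-congˡ (head-weight δ s s′ _ (suc ∘ o′) h f s≗ (λ b → ≡.cong suc (o≗ b))
                  (ℕ.≤-trans (ℕ.≤-reflexive (≡.sym (ℕ.+-suc (o 0) _))) low) len) ⟩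
        δ * y (suc c) * (pureWeight _ _ s′ _ (merge h f) * headWeight x y δ h)
          ≈⟨ solve 3 (λ a b c → a :* (b :* c) := (con 1ℤ :* b) :* (a :* c)) refl _ _ _ ⟩
        1# * pureWeight _ _ s′ _ (merge h f) * (δ * y (suc c) * headWeight x y δ h) ∎

      -- The tail enters the first factor only through the sequence of its nonzero letters, and the
      -- last factor sees the head only through its number of pure zeros. This allows all tails of a
      -- fixed head to be summed.
      weight-++ : ∀ δ h t → nonzeros t ≡ zeros h →
                  weight x y δ (h ++ t) ≈ Φ (x ∘ suc) (y ∘ suc) (merge h (nonzeroLetters t)) *
                                          headWeight x y δ h * tailWeight x y δ (suc (pures 0 h)) t
      weight-++ δ h t nz≡z = begin
        pureWeight x y s (λ _ → 0) (h ++ t) * movedWeight x y δ (h ++ t)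
          ≈⟨ *-cong (pureWeight-++ x y s (λ _ → 0) h t) (movedWeight-++ x y δ h t) ⟩
        (pureWeight x y s (λ _ → 0) h * pureWeight x y s o t) * (movedWeight x y δ h * movedWeight x y δ t)
          ≈⟨ solve 4 (λ a b c d → (a :* b) :* (c :* d) := (a :* c) :* (b :* d)) refl _ _ _ _ ⟩
        (pureWeight x y s (λ _ → 0) h * movedWeight x y δ h) * (pureWeight x y s o t * movedWeight x y δ t)
          ≈⟨ *-cong (head-weight δ s (λ b → greater b v) (λ _ → 0) (λ _ → 0) h f s≗ (λ _ → ≡.refl)
                      (ℕ.≤-reflexive (≡.sym s0)) len)
                    (tail-weight x y δ s o t inv) ⟩
        Φ (x ∘ suc) (y ∘ suc) v * headWeight x y δ h * tailWeight x y δ (suc (s 0) ∸ o 0) t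
          ≡⟨ ≡.cong (λ k → Φ (x ∘ suc) (y ∘ suc) v * headWeight x y δ h * tailWeight x y δ k t) κ≡ ⟩
        _ ∎
        where
        s = λ b → greater b (h ++ t)
        o = seenAll h (λ _ → 0)
        f = nonzeroLetters t
        v = merge h f
        len : zeros h ≡ length f
        len = ≡.sym (≡.trans (length-nonzeroLetters t) nz≡z)
        s≗ : ∀ b → s (suc b) ≡ greater b v
        s≗ b = ≡.trans (count-++ _ h t) (≡.sym (≡.trans (greater-merge b h f len)
                 (≡.cong (greater (suc b) h ℕ.+_) (greater-nonzeroLetters b t))))
        s0 : s 0 ≡ length h
        s0 = ≡.trans (count-++ _ h t) (≡.trans (≡.cong (nonzeros h ℕ.+_) nz≡z) (nonzeros+zeros h))
        -- `s 0` is `length h`, and the others of 0 in the head are all its tokens except the pure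
        -- zeros.
        κ≡ : suc (s 0) ∸ o 0 ≡ suc (pures 0 h)
        κ≡ = ≡.trans (≡.cong (λ m → suc m ∸ o 0) (≡.trans s0 (≡.sym (seenAll-pures h (λ _ → 0) 0))))
               (≡.trans (≡.cong (_∸ o 0) (≡.sym (ℕ.+-suc (o 0) (pures 0 h)))) (ℕ.m+n∸m≡n (o 0) (suc (pures 0 h))))
        inv : ∀ b → s (suc b) ℕ.+ equals (suc b) t ≤ o (suc b)
        inv b = greater-tail b h t s0

-- The flag excedance statistic of a word

module WordStatistic where
  open Tokens
  open import Data.Bool.Base using (if_then_else_)
  open import Data.List.Base as List using (List; []; _∷_)
  open import Data.Nat.Base as ℕ using (ℕ; suc; _≡ᵇ_; _≤ᵇ_; _%_)

  module Statistic (r′ : ℕ) where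
    private
      r : ℕ
      r = suc r′

    -- In the flag excedance number an excedance of colour 0 contributes `r`; every other letter
    -- contributes its colour.
    colour exceeding : ℕ → ℕ
    colour b    = b % r
    exceeding b = if colour b ≡ᵇ 0 then r else colour b

    -- The recursion is that of `pureWeight`, so that weights which are powers of `q` multiply to
    -- `q` to the power `stat`.
    statFrom : (s others : ℕ → ℕ) → List ℕ → ℕ
    statFrom s others []      = 0
    statFrom s others (b ∷ w) = (if others b ≤ᵇ s b then colour b else exceeding b) ℕ.+ statFrom s (seen (pure b) others) w

    stat : List ℕ → ℕ
    stat w = statFrom (λ b → greater b (List.map pure w)) (λ _ → 0) w

-- Sums over all words by elimination of letters

module LetterElimination where
  open IntegerSolver
  open Summation
  open Tokens
  open WordStatistic
  open import Algebra.Bundles using (CommutativeRing)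
  open import Data.Bool.Base using (true; false; if_then_else_)
  open import Data.Nat.ListAction using (sum)
  open import Data.Integer.Base using (1ℤ; 0ℤ)
  open import Data.List.Base using (List; []; _∷_; _++_; length)
  import Data.List.Base as List
  open import Data.Nat.Base as ℕ using (ℕ; zero; suc; _≤_; _<_; z≤n; s≤s; _≡ᵇ_; _≤ᵇ_; _∸_; pred; _/_; _%_)
  import Data.Nat.DivMod as ℕ
  import Data.Nat.Divisibility as ℕ using (∣-refl)
  import Data.Nat.Properties as ℕ
  import Level
  open import Function.Base using (_∘_)
  open import Function.Bundles using (Equivalence)
  open import Data.Bool.Properties using (T-≡)
  open import Relation.Binary.PropositionalEquality as ≡ using (_≡_)

  module Elimination {c ℓ} (S : CommutativeRing c ℓ) (u : CommutativeRing.Carrier S) (M : ℕ)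
    (u^M≈0 : CommutativeRing._≈_ S (FiniteSums._^_ S u M) (CommutativeRing.0# S)) where
    open CommutativeRing S
    open FiniteSums S
    open RingSolver S
    open Weights S
    open import Algebra.Properties.CommutativeSemiring.Exp commutativeSemiring using (^-distrib-*)
    open import Relation.Binary.Reasoning.Setoid setoid

    infixr 4 _,_
    -- Divisibility by `u ^ n` plays the role of a lower bound for the degree in an abstract ring
    -- with nilpotent `u`.
    record Small (n : ℕ) (a : Carrier) : Set (c Level.⊔ ℓ) where
      constructor _,_
      field
        quotient : Carrier
        equation : a ≈ u ^ n * quotient
    open Small

    small-zero : ∀ {n a} → a ≈ 0# → Small n a
    small-zero a≈0 = 0# , trans a≈0 (sym (zeroʳ _))

    small-resp : ∀ {n a b} → a ≈ b → Small n a → Small n b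
    small-resp a≈b (c , eq) = c , trans (sym a≈b) eq

    small-1 : ∀ a → Small 0 a
    small-1 a = a , sym (*-identityˡ a)

    small-u : ∀ a → Small 1 (u * a)
    small-u a = a , *-congʳ (sym (*-identityʳ u))

    small-+ : ∀ {n a b} → Small n a → Small n b → Small n (a + b)
    small-+ (c , a≈) (d , b≈) = c + d , trans (+-cong a≈ b≈) (sym (distribˡ _ c d))

    small-* : ∀ {m n a b} → Small m a → Small n b → Small (m ℕ.+ n) (a * b)
    small-* {m} {n} (c , a≈) (d , b≈) = c * d , trans (*-cong a≈ b≈) (trans
      (solve 4 (λ p c q d → (p :* c) :* (q :* d) := (p :* q) :* (c :* d)) refl _ _ _ _)
      (*-congʳ (sym (^-homo-* u m n))))

    small-vanish : ∀ {n a} → M ≤ n → Small n a → a ≈ 0#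
    small-vanish {n} {a} M≤n (c , a≈) = begin
      a                          ≈⟨ a≈ ⟩
      u ^ n * c                  ≡⟨ ≡.cong (λ m → u ^ m * c) (≡.sym (ℕ.m+[n∸m]≡n M≤n)) ⟩
      u ^ (M ℕ.+ (n ∸ M)) * c    ≈⟨ *-congʳ (^-homo-* u M (n ∸ M)) ⟩
      u ^ M * u ^ (n ∸ M) * c    ≈⟨ *-congʳ (*-congʳ u^M≈0) ⟩
      0# * u ^ (n ∸ M) * c       ≈⟨ trans (*-congʳ (zeroˡ _)) (zeroˡ c) ⟩
      0#                         ∎

    small-I : ∀ {A I} → Linear {A} I → ∀ {k f} → (∀ a → Small k (f a)) → Small k (I f)
    small-I {I = I} lin {k} {f} small = I (quotient ∘ small) ,
      trans (Linear.cong lin (equation ∘ small)) (Linear.scale lin (u ^ k) _)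

    -- The geometric series for the inverse of `1 - u * c` stops here because `u ^ M` is 0.
    inverse : Carrier → Carrier
    inverse c = ∑< M (λ i → (u * c) ^ i)

    geometric : ∀ n e → ∑< n (e ^_) * (1# - e) ≈ 1# - e ^ n
    geometric zero    e = solve 1 (λ e → con 0ℤ :* (con 1ℤ :- e) := con 1ℤ :- con 1ℤ) refl e
    geometric (suc n) e = begin
      (1# + ∑< n (λ i → e * e ^ i)) * (1# - e)       ≈⟨ *-congʳ (+-congˡ (Linear.scale (∑-linear n) e _)) ⟩
      (1# + e * ∑< n (e ^_)) * (1# - e)              ≈⟨ solve 2 (λ e s → (con 1ℤ :+ e :* s) :* (con 1ℤ :- e) :=
                                                          (con 1ℤ :- e) :+ e :* (s :* (con 1ℤ :- e))) refl e _ ⟩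
      (1# - e) + e * (∑< n (e ^_) * (1# - e))        ≈⟨ +-congˡ (*-congˡ (geometric n e)) ⟩
      (1# - e) + e * (1# - e ^ n)                    ≈⟨ solve 2 (λ e p → (con 1ℤ :- e) :+ e :* (con 1ℤ :- p) := con 1ℤ :- e :* p) refl e _ ⟩
      1# - e * e ^ n                                 ∎

    inverse-* : ∀ c → inverse c * (1# - u * c) ≈ 1#
    inverse-* c = begin
      inverse c * (1# - u * c)   ≈⟨ geometric M (u * c) ⟩
      1# - (u * c) ^ M           ≈⟨ +-congˡ (-‿cong (trans (^-distrib-* u c M) (trans (*-congʳ u^M≈0) (zeroˡ _)))) ⟩
      1# - 0#                    ≈⟨ solve 0 (con 1ℤ :- con 0ℤ := con 1ℤ) refl ⟩
      1#                         ∎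

    sumTokens : ℕ → (Token → Carrier) → Carrier
    sumTokens N F = ∑< N (λ b → F (pure b) + F (moved b))

    sumTokens-linear : ∀ N → Linear (sumTokens N)
    sumTokens-linear N = record
      { cong  = λ eq → Linear.cong L (λ b → +-cong (eq (pure b)) (eq (moved b)))
      ; add   = λ f g → trans (Linear.cong L λ b → solve 4 (λ a b c d → (a :+ b) :+ (c :+ d) := (a :+ c) :+ (b :+ d)) refl _ _ _ _)
                              (Linear.add L _ _)
      ; scale = λ k f → trans (Linear.cong L λ b → sym (distribˡ k _ _)) (Linear.scale L k _)
      }
      where L = ∑-linear N

    -- The weights to be summed carry a factor `u` for each letter, so words of length `M` or more
    -- would contribute 0.
    allWords : {A : Set} → ((A → Carrier) → Carrier) → (List A → Carrier) → Carrier
    allWords I F = ∑< M (λ n → ∑words I n F)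

    -- Every word has exactly one cut whose head is as long as the number of nonzero letters.
    -- Regrouping by total length is exact: a word of length at least `M` has weight 0, and a word
    -- shorter than `n` cannot have `n` nonzero letters.
    allWords-split : ∀ {I} → Linear I → ∀ F → (∀ w → Small (length w) (F w)) →
      allWords I F ≈ ∑< M (λ n → ∑words I n (λ h → allWords I (λ t → ind (nonzeros (h ++ t) ≡ᵇ n) * F (h ++ t))))
    allWords-split {I} lin F small = sym (begin
      ∑< M (λ n → ∑words I n (λ h → ∑< M (λ m → ∑words I m (λ t → ind (nonzeros (h ++ t) ≡ᵇ n) * F (h ++ t)))))
        ≈⟨ ∑-cong M (λ n → Linear.∑-swap (∑words-linear lin n) M _) ⟩
      ∑< M (λ n → ∑< M (λ m → ∑words I n (λ h → ∑words I m (λ t → ind (nonzeros (h ++ t) ≡ᵇ n) * F (h ++ t)))))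
        ≈⟨ ∑-cong M (λ n → ∑-cong M (λ m → sym (∑words-++ lin n m _))) ⟩
      ∑< M (λ n → ∑< M (λ m → G n (n ℕ.+ m)))
        ≈⟨ ∑-cong M (λ n → ∑-shift n M (G n) (low n) (high n)) ⟩
      ∑< M (λ n → ∑< M (λ l → G n l))
        ≈⟨ Linear.∑-swap (∑-linear M) M G ⟩
      ∑< M (λ l → ∑< M (λ n → G n l))
        ≈⟨ ∑-cong< M (λ l l<M → trans (sym (Linear.∑-swap (∑words-linear lin l) M _))
             (∑words-cong lin l λ w |w|≡l → ∑-ind M (nonzeros w) (ℕ.≤-<-trans (ℕ.≤-trans (nz≤ w) (ℕ.≤-reflexive |w|≡l)) l<M) (λ _ → F w))) ⟩
      ∑< M (λ l → ∑words I l F) ∎)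
      where
      G : ℕ → ℕ → Carrier
      G n l = ∑words I l (λ w → ind (nonzeros w ≡ᵇ n) * F w)
      nz≤ : ∀ w → nonzeros w ≤ length w
      nz≤ w = ≡.subst (nonzeros w ≤_) (nonzeros+zeros w) (ℕ.m≤m+n _ _)
      high : ∀ n l → M ≤ l → G n l ≈ 0#
      high n l M≤l = trans (∑words-cong lin l λ w |w|≡l → trans (*-congˡ (small-vanish (≡.subst (M ≤_) (≡.sym |w|≡l) M≤l) (small w))) (zeroʳ _))
                           (Linear.vanish (∑words-linear lin l) (λ _ → refl))
      differ : ∀ a b → a < b → (a ≡ᵇ b) ≡ false
      differ zero    (suc b) _         = ≡.refl
      differ (suc a) (suc b) (s≤s a<b) = differ a b a<b
      low : ∀ n l → l < n → G n l ≈ 0#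
      low n l l<n = trans (∑words-cong lin l λ w |w|≡l →
          trans (*-congʳ (reflexive (≡.cong ind (differ (nonzeros w) n (ℕ.≤-<-trans (ℕ.≤-trans (nz≤ w) (ℕ.≤-reflexive |w|≡l)) l<n))))) (zeroˡ _))
        (Linear.vanish (∑words-linear lin l) (λ _ → refl))

    module Step (N : ℕ) (x̂ ŷ : ℕ → Carrier) (h a g : Carrier)
      (a-inv : a * (1# - u * x̂ 0) ≈ 1#) (g-inv : g * (1# - u * (h * ŷ 0)) ≈ 1#) where

      x y : ℕ → Carrier
      x b = u * x̂ b
      y b = u * ŷ b

      -- With `a` and `g` inverse to `1 - x 0` and `1 - h * y 0`, `h′` is h (1 - y) / ((1 - x) (1 -
      -- h y)) at the letter 0. The shift by 1 in `δ` makes a pure and a moved letter weigh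
      -- `y + δ * y = h * y` together.
      δ d h′ δ′ : Carrier
      δ  = h - 1#
      d  = 1# - y 0
      h′ = h * (a * d * g)
      δ′ = h′ - 1#

      private
        tokens : (Token → Carrier) → Carrier
        tokens = sumTokens (suc N)

        tokens-linear : Linear tokens
        tokens-linear = sumTokens-linear (suc N)

      -- Weights of tail letters, pure and moved taken together; their factors `u` are counted in
      -- `nonzeroFirst`.
      fill : List ℕ → Carrier
      fill []      = 1#
      fill (b ∷ f) = h * ŷ (suc b) * fill f

      mutual
        -- The total `tailWeight` of length `m` with `j` nonzero letters, after the values of these
        -- letters have been split off into `fill`. The three summands are the kinds of first token:
        -- nonzero, moved zero, pure zero.
        tails : ℕ → ℕ → ℕ → Carrier
        tails zero    κ j = ind (0 ≡ᵇ j)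
        tails (suc m) κ j = nonzeroFirst m κ j + (δ * y 0 * tails m (pred κ) j + zeroWeight x y κ * tails m κ j)

        nonzeroFirst : ℕ → ℕ → ℕ → Carrier
        nonzeroFirst m κ zero    = 0#
        nonzeroFirst m κ (suc j) = u * tails m (pred κ) j

      private
        pull : ∀ m k (i p q : List Token → Carrier) →
               ∑words tokens m (λ t → i t * (p t * (k * q t))) ≈ k * ∑words tokens m (λ t → i t * (p t * q t))
        pull m k i p q = trans
          (Linear.cong L λ t → solve 4 (λ i p k q → i :* (p :* (k :* q)) := k :* (i :* (p :* q))) refl _ _ _ _)
          (Linear.scale L k _)
          where L = ∑words-linear tokens-linear m

      -- In the tail the value of a nonzero letter affects only its own factor, and being pure or
      -- moved matters only for the choice between `y` and `δ * y`. So the sum over values separates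
      -- from the sum over patterns of zeros.
      sum-tails : ∀ m κ j (Ψ : List ℕ → Carrier) →
        ∑words tokens m (λ t → ind (nonzeros t ≡ᵇ j) * (Ψ (nonzeroLetters t) * tailWeight x y δ κ t)) ≈
        ∑words (∑< N) j (λ f → Ψ f * fill f) * tails m κ j
      sum-tails zero κ zero    Ψ = *-comm _ _
      sum-tails zero κ (suc j) Ψ = trans (zeroˡ _) (sym (zeroʳ _))
      sum-tails (suc m) κ j Ψ = begin
        (∑words tokens m (λ t → ind (nonzeros t ≡ᵇ j) * (Ψ (nonzeroLetters t) * (zeroWeight x y κ * tailWeight x y δ κ t))) +
         ∑words tokens m (λ t → ind (nonzeros t ≡ᵇ j) * (Ψ (nonzeroLetters t) * (δ * y 0 * tailWeight x y δ (pred κ) t)))) + R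
          ≈⟨ +-congʳ (+-cong (trans (pull m _ _ _ _) (*-congˡ (sum-tails m κ j Ψ)))
                             (trans (pull m _ _ _ _) (*-congˡ (sum-tails m (pred κ) j Ψ)))) ⟩
        (zeroWeight x y κ * (L * tails m κ j) + δ * y 0 * (L * tails m (pred κ) j)) + R
          ≈⟨ +-congˡ (nonzero j Ψ) ⟩
        (zeroWeight x y κ * (L * tails m κ j) + δ * y 0 * (L * tails m (pred κ) j)) + L * nonzeroFirst m κ j
          ≈⟨ solve 6 (λ z L s dy t n → (z :* (L :* s) :+ dy :* (L :* t)) :+ L :* n := L :* (n :+ (dy :* t :+ z :* s))) refl _ _ _ _ _ _ ⟩
        L * (nonzeroFirst m κ j + (δ * y 0 * tails m (pred κ) j + zeroWeight x y κ * tails m κ j)) ∎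
        where
        L = ∑words (∑< N) j (λ f → Ψ f * fill f)
        rest : ℕ → (List ℕ → Carrier) → ℕ → Carrier
        rest j Ψ b =
          ∑words tokens m (λ t → ind (suc (nonzeros t) ≡ᵇ j) * (Ψ (b ∷ nonzeroLetters t) * (y (suc b) * tailWeight x y δ (pred κ) t))) +
          ∑words tokens m (λ t → ind (suc (nonzeros t) ≡ᵇ j) * (Ψ (b ∷ nonzeroLetters t) * (δ * y (suc b) * tailWeight x y δ (pred κ) t)))
        R = ∑< N (rest j Ψ)
        nonzero : ∀ j Ψ → ∑< N (rest j Ψ) ≈ ∑words (∑< N) j (λ f → Ψ f * fill f) * nonzeroFirst m κ j
        nonzero zero Ψ = trans (Linear.vanish (∑-linear N) λ b → trans
            (+-cong (Linear.vanish (∑words-linear tokens-linear m) λ _ → zeroˡ _)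
                    (Linear.vanish (∑words-linear tokens-linear m) λ _ → zeroˡ _)) (+-identityˡ 0#))
          (sym (zeroʳ _))
        nonzero (suc j) Ψ = trans (∑-cong N each) (Linear.scaleʳ (∑-linear N) _ _)
          where
          each : ∀ b → rest (suc j) Ψ b ≈
                 ∑words (∑< N) j (λ f → Ψ (b ∷ f) * (h * ŷ (suc b) * fill f)) * (u * tails m (pred κ) j)
          each b = begin
            rest (suc j) Ψ b
              ≈⟨ +-cong (trans (pull m _ _ _ _) (*-congˡ (sum-tails m (pred κ) j (Ψ ∘ (b ∷_)))))
                        (trans (pull m _ _ _ _) (*-congˡ (sum-tails m (pred κ) j (Ψ ∘ (b ∷_))))) ⟩
            y (suc b) * (Lb * tails m (pred κ) j) + δ * y (suc b) * (Lb * tails m (pred κ) j)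
              ≈⟨ solve 5 (λ u y h L t → u :* y :* (L :* t) :+ (h :- con 1ℤ) :* (u :* y) :* (L :* t) :=
                                        h :* y :* L :* (u :* t)) refl u (ŷ (suc b)) h _ _ ⟩
            h * ŷ (suc b) * Lb * (u * tails m (pred κ) j)
              ≈⟨ *-congʳ (sym (Linear.scale (∑words-linear (∑-linear N) j) _ _)) ⟩
            ∑words (∑< N) j (λ f → h * ŷ (suc b) * (Ψ (b ∷ f) * fill f)) * (u * tails m (pred κ) j)
              ≈⟨ *-congʳ (Linear.cong (∑words-linear (∑-linear N) j) λ f →
                   solve 3 (λ k p f → k :* (p :* f) := p :* (k :* f)) refl _ _ _) ⟩
            ∑words (∑< N) j (λ f → Ψ (b ∷ f) * (h * ŷ (suc b) * fill f)) * (u * tails m (pred κ) j) ∎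
            where Lb = ∑words (∑< N) j (λ f → Ψ (b ∷ f) * fill f)

      small-zeroWeight : ∀ κ → Small 1 (zeroWeight x y κ)
      small-zeroWeight zero    = small-u _
      small-zeroWeight (suc κ) = small-u _

      small-δy : ∀ b → Small 1 (δ * y b)
      small-δy b = small-resp (solve 3 (λ δ u y → u :* (δ :* y) := δ :* (u :* y)) refl δ u (ŷ b)) (small-u (δ * ŷ b))

      small-tails : ∀ m κ j → Small m (tails m κ j)
      small-tails zero    κ j = small-1 _
      small-tails (suc m) κ j = small-+ (nz j) (small-+ (small-* (small-δy 0) (small-tails m (pred κ) j))
                                                        (small-* (small-zeroWeight κ) (small-tails m κ j)))
        where
        nz : ∀ j → Small (suc m) (nonzeroFirst m κ j)
        nz zero    = small-zero refl
        nz (suc j) = small-* (small-resp (*-identityʳ u) (small-u 1#)) (small-tails m (pred κ) j)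

      allTails : ℕ → ℕ → Carrier
      allTails κ j = ∑< M (λ m → tails m κ j)

      firstNonzero : ℕ → ℕ → Carrier
      firstNonzero κ zero    = 0#
      firstNonzero κ (suc j) = u * allTails (pred κ) j

      -- Splitting off the first token needs one more length in the range; the term added for it is
      -- divisible by `u ^ M` and vanishes.
      allTails-first : ∀ κ j → allTails κ j ≈
        ind (0 ≡ᵇ j) + (firstNonzero κ j + (δ * y 0 * allTails (pred κ) j + zeroWeight x y κ * allTails κ j))
      allTails-first κ j = begin
        ∑< M (λ m → tails m κ j)                             ≈⟨ sym (+-identityʳ _) ⟩
        ∑< M (λ m → tails m κ j) + 0#                        ≈⟨ +-congˡ (sym (small-vanish ℕ.≤-refl (small-tails M κ j))) ⟩
        ∑< M (λ m → tails m κ j) + tails M κ j               ≈⟨ sym (∑-last M _) ⟩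
        ind (0 ≡ᵇ j) + ∑< M (λ m → tails (suc m) κ j)
          ≈⟨ +-congˡ (trans (L.add _ _) (+-cong (nz j) (trans (L.add _ _) (+-cong (L.scale _ _) (L.scale _ _))))) ⟩
        _ ∎
        where
        module L = Linear (∑-linear M)
        nz : ∀ j → ∑< M (λ m → nonzeroFirst m κ j) ≈ firstNonzero κ j
        nz zero    = L.vanish (λ _ → refl)
        nz (suc j) = L.scale _ _

      private
        -- Expand the first `q` as `q * g * (1 - h * y 0)`; the terms containing `h` cancel.
        δyg : ∀ q → q + δ * y 0 * (q * g) ≈ q * (d * g)
        δyg q = begin
          q + δ * y 0 * (q * g)                     ≈⟨ +-congʳ (sym (trans (*-congˡ g-inv) (*-identityʳ q))) ⟩
          q * (g * (1# - u * (h * ŷ 0))) + δ * y 0 * (q * g)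
            ≈⟨ solve 5 (λ q g u h y → q :* (g :* (con 1ℤ :- u :* (h :* y))) :+ (h :- con 1ℤ) :* (u :* y) :* (q :* g)
                          := q :* ((con 1ℤ :- u :* y) :* g)) refl q g u h (ŷ 0) ⟩
          q * (d * g) ∎

      -- At `κ = 0` a zero, pure or moved, weighs `h * y 0`, and each of the `j + 1` gaps between
      -- nonzero letters is a geometric series `g`. Each unit of `κ` adds `a` for a run of pure
      -- zeros and `d` by `δyg`. The bound on `κ` secures the start: a tail without nonzero letters
      -- has `κ` at most 1.
      allTails-closed : ∀ κ j → κ ≤ suc j → allTails κ j ≈ u ^ j * (a * d) ^ κ * g ^ suc j
      allTails-closed zero j _ = begin
        V                                                ≈⟨ sym (trans (*-congʳ g-inv) (*-identityˡ V)) ⟩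
        g * (1# - u * (h * ŷ 0)) * V
          ≈⟨ solve 5 (λ g u h y V → g :* (con 1ℤ :- u :* (h :* y)) :* V :=
                       g :* (V :- ((h :- con 1ℤ) :* (u :* y) :* V :+ u :* y :* V))) refl g u h (ŷ 0) V ⟩
        g * (V - W)                                      ≈⟨ *-congˡ (+-congʳ (allTails-first 0 j)) ⟩
        g * ((ind (0 ≡ᵇ j) + (firstNonzero 0 j + W)) - W) ≈⟨ *-congˡ (solve 3 (λ i f W → (i :+ (f :+ W)) :- W := i :+ f) refl _ _ W) ⟩
        g * (ind (0 ≡ᵇ j) + firstNonzero 0 j)            ≈⟨ rest j ⟩
        u ^ j * 1# * g ^ suc j                           ∎
        where
        V = allTails 0 j
        W = δ * y 0 * V + y 0 * V
        rest : ∀ j → g * (ind (0 ≡ᵇ j) + firstNonzero 0 j) ≈ u ^ j * 1# * g ^ suc j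
        rest zero    = solve 1 (λ g → g :* (con 1ℤ :+ con 0ℤ) := con 1ℤ :* con 1ℤ :* (g :* con 1ℤ)) refl g
        rest (suc j) = begin
          g * (0# + u * allTails 0 j)                    ≈⟨ *-congˡ (+-congˡ (*-congˡ (allTails-closed 0 j z≤n))) ⟩
          g * (0# + u * (u ^ j * 1# * g ^ suc j))
            ≈⟨ solve 4 (λ g u p q → g :* (con 0ℤ :+ u :* (p :* con 1ℤ :* q)) := u :* p :* con 1ℤ :* (g :* q)) refl g u (u ^ j) (g ^ suc j) ⟩
          u * u ^ j * 1# * (g * g ^ suc j) ∎
      allTails-closed (suc κ) j (s≤s κ≤j) = begin
        V                                                ≈⟨ sym (trans (*-congʳ a-inv) (*-identityˡ V)) ⟩
        a * (1# - x 0) * V                               ≈⟨ solve 3 (λ a x V → a :* (con 1ℤ :- x) :* V := a :* (V :- x :* V)) refl a (x 0) V ⟩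
        a * (V - x 0 * V)                                ≈⟨ *-congˡ (+-congʳ (allTails-first (suc κ) j)) ⟩
        a * ((ind (0 ≡ᵇ j) + (firstNonzero (suc κ) j + (δ * y 0 * allTails κ j + x 0 * V))) - x 0 * V)
          ≈⟨ *-congˡ (solve 4 (λ i f t xV → (i :+ (f :+ (t :+ xV))) :- xV := (i :+ f) :+ t) refl _ _ _ (x 0 * V)) ⟩
        a * ((ind (0 ≡ᵇ j) + firstNonzero (suc κ) j) + δ * y 0 * allTails κ j)
          ≈⟨ *-congˡ (+-congˡ (*-congˡ (allTails-closed κ j (ℕ.m≤n⇒m≤1+n κ≤j)))) ⟩
        a * ((ind (0 ≡ᵇ j) + firstNonzero (suc κ) j) + δ * y 0 * (u ^ j * (a * d) ^ κ * (g * g ^ j)))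
          ≈⟨ *-congˡ (+-congʳ (first j κ≤j)) ⟩
        a * (Q + δ * y 0 * (u ^ j * (a * d) ^ κ * (g * g ^ j)))
          ≈⟨ *-congˡ (+-congˡ (*-congˡ (solve 4 (λ p q g r → p :* q :* (g :* r) := p :* q :* r :* g) refl _ _ g _))) ⟩
        a * (Q + δ * y 0 * (Q * g))                      ≈⟨ *-congˡ (δyg Q) ⟩
        a * (u ^ j * (a * d) ^ κ * g ^ j * (d * g))
          ≈⟨ solve 6 (λ a p q r d g → a :* (p :* q :* r :* (d :* g)) := p :* (a :* d :* q) :* (g :* r)) refl a _ _ _ d g ⟩
        u ^ j * (a * d * (a * d) ^ κ) * (g * g ^ j)      ∎
        where
        V = allTails (suc κ) j
        Q = u ^ j * (a * d) ^ κ * g ^ j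
        first : ∀ j → κ ≤ j → ind (0 ≡ᵇ j) + firstNonzero (suc κ) j ≈ u ^ j * (a * d) ^ κ * g ^ j
        first zero    z≤n = solve 0 (con 1ℤ :+ con 0ℤ := con 1ℤ :* con 1ℤ :* con 1ℤ) refl
        first (suc j) κ≤1+j = begin
          0# + u * allTails κ j                          ≈⟨ +-congˡ (*-congˡ (allTails-closed κ j κ≤1+j)) ⟩
          0# + u * (u ^ j * (a * d) ^ κ * g ^ suc j)     ≈⟨ solve 4 (λ u p q r → con 0ℤ :+ u :* (p :* q :* r) := u :* p :* q :* r) refl u _ _ _ ⟩
          u * u ^ j * (a * d) ^ κ * g ^ suc j            ∎

      -- The weight of a head with all its tails summed, apart from the common factor `a * d * g`
      -- and the letters that fill the holes.
      holeWeight : List Token → Carrier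
      holeWeight w = headWeight x y δ w * (u ^ zeros w * (a * d) ^ pures 0 w * g ^ zeros w)

      Refolded : ℕ → (List Token → Carrier) → Carrier
      Refolded n Ψ = ∑words (sumTokens N) n (λ v → Ψ v * movedWeight (x ∘ suc) (y ∘ suc) δ′ v)

      -- A pure letter of the merged word has one origin. A moved letter `b` has three: a filled
      -- pure zero, a filled moved zero, or `moved (suc b)`; their weights add up to `δ′` times that
      -- of an excedance. So the merged words carry weights of the original form.
      refold : ∀ n (Ψ : List Token → Carrier) →
        ∑words tokens n (λ w → ∑words (∑< N) (zeros w) (λ f → Ψ (merge w f) * fill f) * holeWeight w) ≈ Refolded n Ψ
      refold zero    Ψ = solve 1 (λ p → (p :* con 1ℤ) :* (con 1ℤ :* (con 1ℤ :* con 1ℤ :* con 1ℤ)) := p :* con 1ℤ) refl _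
      refold (suc n) Ψ = begin
        (∑words tokens n (λ w → holes w * holeWeight (pure 0 ∷ w)) + ∑words tokens n (λ w → holes w * holeWeight (moved 0 ∷ w))) +
        ∑< N (λ b → ∑words tokens n (λ w → F (Ψ ∘ (pure b ∷_)) w * holeWeight (pure (suc b) ∷ w)) +
                    ∑words tokens n (λ w → F (Ψ ∘ (moved b ∷_)) w * holeWeight (moved (suc b) ∷ w)))
          ≈⟨ +-cong (+-cong (hole (x 0 * (u * (a * d) * g)) {λ w → holeWeight (pure 0 ∷ w)} λ w →
                              solve 8 (λ x h u z ad p g q → x :* h :* (u :* z :* (ad :* p) :* (g :* q)) :=
                                                            (x :* (u :* ad :* g)) :* (h :* (z :* p :* q))) refl (x 0) _ u _ (a * d) _ g _)
                            (hole (δ * y 0 * (u * g)) {λ w → holeWeight (moved 0 ∷ w)} λ w →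
                              solve 7 (λ x h u z p g q → x :* h :* (u :* z :* p :* (g :* q)) :=
                                                            (x :* (u :* g)) :* (h :* (z :* p :* q))) refl (δ * y 0) _ u _ _ g _))
                    (∑-cong N λ b → +-cong (refold n (Ψ ∘ (pure b ∷_)))
                      (trans (Linear.cong L λ w → solve 4 (λ f k h r → f :* (k :* h :* r) := k :* (f :* (h :* r))) refl _ _ _ _)
                        (trans (Linear.scale L _ _) (*-congˡ (refold n (Ψ ∘ (moved b ∷_))))))) ⟩
        (∑< N (λ b → h * ŷ (suc b) * (x 0 * (u * (a * d) * g)) * R b) + ∑< N (λ b → h * ŷ (suc b) * (δ * y 0 * (u * g)) * R b)) +
        ∑< N (λ b → Refolded n (Ψ ∘ (pure b ∷_)) + δ * y (suc b) * R b)
          ≈⟨ trans (+-congʳ (sym (L∑.add _ _))) (sym (L∑.add _ _)) ⟩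
        ∑< N (λ b → (h * ŷ (suc b) * (x 0 * (u * (a * d) * g)) * R b + h * ŷ (suc b) * (δ * y 0 * (u * g)) * R b) +
                    (Refolded n (Ψ ∘ (pure b ∷_)) + δ * y (suc b) * R b))
          ≈⟨ ∑-cong N (λ b → trans
               (solve 11 (λ h yb x u a d g δ y r p →
                    (h :* yb :* (x :* (u :* (a :* d) :* g)) :* r :+ h :* yb :* (δ :* y :* (u :* g)) :* r) :+ (p :+ δ :* (u :* yb) :* r)
                    := p :+ (u :* yb :* r) :* (h :* g :* (x :* a :* d :+ δ :* y) :+ δ))
                  refl h (ŷ (suc b)) (x 0) u a d g δ (y 0) (R b) _)
               (+-congˡ (trans (*-congˡ δ′-step) (trans (*-comm _ _) (trans (sym (*-assoc _ _ _)) (trans (sym (Linear.scale L′ _ _))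
                 (Linear.cong L′ λ w → solve 3 (λ k p m → k :* (p :* m) := p :* (k :* m)) refl _ _ _))))))) ⟩
        Refolded (suc n) Ψ ∎
        where
        module L∑ = Linear (∑-linear N)
        L = ∑words-linear tokens-linear n
        L′ = ∑words-linear (sumTokens-linear N) n
        F : (List Token → Carrier) → List Token → Carrier
        F Ψ w = ∑words (∑< N) (zeros w) (λ f → Ψ (merge w f) * fill f)
        holes : List Token → Carrier
        holes w = ∑< N (λ b → ∑words (∑< N) (zeros w) (λ f → Ψ (moved b ∷ merge w f) * (h * ŷ (suc b) * fill f)))
        R : ℕ → Carrier
        R b = Refolded n (Ψ ∘ (moved b ∷_))
        hole : ∀ k {W} → (∀ w → W w ≈ k * holeWeight w) →
               ∑words tokens n (λ w → holes w * W w) ≈ ∑< N (λ b → h * ŷ (suc b) * k * R b)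
        hole k {W} eq = begin
          ∑words tokens n (λ w → holes w * W w)
            ≈⟨ Linear.cong L (λ w → trans (*-congˡ (eq w)) (sym (L∑.scaleʳ _ _))) ⟩
          ∑words tokens n (λ w → ∑< N (λ b → ∑words (∑< N) (zeros w) (λ f → Ψ (moved b ∷ merge w f) * (h * ŷ (suc b) * fill f)) * (k * holeWeight w)))
            ≈⟨ Linear.∑-swap L N _ ⟩
          ∑< N (λ b → ∑words tokens n (λ w → ∑words (∑< N) (zeros w) (λ f → Ψ (moved b ∷ merge w f) * (h * ŷ (suc b) * fill f)) * (k * holeWeight w)))
            ≈⟨ ∑-cong N (λ b → trans (Linear.cong L λ w → trans
                  (*-congʳ (trans (Linear.cong (∑words-linear (∑-linear N) (zeros w)) λ f →
                      solve 3 (λ p k f → p :* (k :* f) := k :* (p :* f)) refl _ _ _)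
                    (Linear.scale (∑words-linear (∑-linear N) (zeros w)) _ _)))
                  (solve 4 (λ y f k w → (y :* f) :* (k :* w) := (y :* k) :* (f :* w)) refl _ _ k _))
                (trans (Linear.scale L _ _) (*-congˡ (refold n (Ψ ∘ (moved b ∷_)))))) ⟩
          ∑< N (λ b → h * ŷ (suc b) * k * R b) ∎
        -- Writing the `h` of the last `δ` as `h * g * (1 - h * y 0)` makes `h * g` a common factor;
        -- the cofactor is `d * (1 + x 0 * a)`, and `1 + x 0 * a` is `a`.
        δ′-step : h * g * (x 0 * a * d + δ * y 0) + δ ≈ δ′
        δ′-step = begin
          h * g * (x 0 * a * d + δ * y 0) + δ
            ≈⟨ +-congˡ (+-congʳ (sym (trans (*-congˡ g-inv) (*-identityʳ h)))) ⟩
          h * g * (x 0 * a * d + δ * y 0) + (h * (g * (1# - u * (h * ŷ 0))) - 1#)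
            ≈⟨ solve 6 (λ h g xx a u yy →
                 h :* g :* (xx :* a :* (con 1ℤ :- u :* yy) :+ (h :- con 1ℤ) :* (u :* yy)) :+ (h :* (g :* (con 1ℤ :- u :* (h :* yy))) :- con 1ℤ)
                 := h :* g :* (con 1ℤ :- u :* yy) :* (con 1ℤ :+ xx :* a) :- con 1ℤ) refl h g (x 0) a u (ŷ 0) ⟩
          h * g * d * (1# + x 0 * a) - 1#
            ≈⟨ +-congʳ (*-congˡ (+-congʳ (sym a-inv))) ⟩
          h * g * d * (a * (1# - x 0) + x 0 * a) - 1#
            ≈⟨ solve 5 (λ h g d a x → h :* g :* d :* (a :* (con 1ℤ :- x) :+ x :* a) :- con 1ℤ := h :* (a :* d :* g) :- con 1ℤ) refl h g d a (x 0) ⟩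
          h′ - 1# ∎

      small-weight : ∀ w → Small (length w) (weight x y δ w)
      small-weight w = go _ _ w
        where
        go : ∀ s o w → Small (length w) (pureWeight x y s o w * movedWeight x y δ w)
        go s o [] = small-1 _
        go s o (pure b ∷ w) = small-resp (sym (*-assoc _ _ _)) (small-* (f (o b ≤ᵇ s b)) (go s _ w))
          where
          f : ∀ p → Small 1 (if p then x b else y b)
          f true  = small-u _
          f false = small-u _
        go s o (moved b ∷ w) = small-resp (solve 3 (λ k p m → k :* (p :* m) := con 1ℤ :* p :* (k :* m)) refl _ _ _)
          (small-* (small-δy b) (go s _ w))

      -- The prefactor is the one that turns `h` into `h′`; hence `h` times the total is invariant.
      eliminate : allWords tokens (weight x y δ) ≈ a * d * g * allWords (sumTokens N) (weight (x ∘ suc) (y ∘ suc) δ′)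
      eliminate = begin
        allWords tokens (weight x y δ)
          ≈⟨ allWords-split tokens-linear _ small-weight ⟩
        ∑< M (λ n → ∑words tokens n (λ w → allWords tokens (λ t → ind (nonzeros (w ++ t) ≡ᵇ n) * weight x y δ (w ++ t))))
          ≈⟨ ∑-cong M (λ n → trans (∑words-cong tokens-linear n (perHead n)) (trans (Linear.scale (∑words-linear tokens-linear n) _ _) (*-congˡ (refold n Ψ)))) ⟩
        ∑< M (λ n → a * d * g * Refolded n Ψ)
          ≈⟨ Linear.scale (∑-linear M) _ _ ⟩
        a * d * g * allWords (sumTokens N) (weight (x ∘ suc) (y ∘ suc) δ′) ∎
        where
        Ψ = Φ (x ∘ suc) (y ∘ suc)
        perHead : ∀ n w → length w ≡ n →
          allWords tokens (λ t → ind (nonzeros (w ++ t) ≡ᵇ n) * weight x y δ (w ++ t)) ≈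
          a * d * g * (∑words (∑< N) (zeros w) (λ f → Ψ (merge w f) * fill f) * holeWeight w)
        perHead n w |w|≡n = begin
          ∑< M (λ m → ∑words tokens m (λ t → ind (nonzeros (w ++ t) ≡ᵇ n) * weight x y δ (w ++ t)))
            ≈⟨ ∑-cong M (λ m → trans (Linear.cong (∑words-linear tokens-linear m) each)
                 (trans (Linear.scale (∑words-linear tokens-linear m) _ _) (*-congˡ (sum-tails m (suc p) j (Ψ ∘ merge w))))) ⟩
          ∑< M (λ m → hw * (L * tails m (suc p) j))
            ≈⟨ trans (Linear.scale (∑-linear M) _ _) (*-congˡ (Linear.scale (∑-linear M) _ _)) ⟩
          hw * (L * allTails (suc p) j)
            ≈⟨ *-congˡ (*-congˡ (allTails-closed (suc p) j (s≤s (pures≤zeros w)))) ⟩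
          hw * (L * (u ^ j * ((a * d) * (a * d) ^ p) * (g * g ^ j)))
            ≈⟨ solve 8 (λ hw L v a d q g r → hw :* (L :* (v :* ((a :* d) :* q) :* (g :* r))) :=
                          a :* d :* g :* (L :* (hw :* (v :* q :* r)))) refl hw L _ a d _ g _ ⟩
          a * d * g * (L * holeWeight w) ∎
          where
          p = pures 0 w
          j = zeros w
          hw = headWeight x y δ w
          L = ∑words (∑< N) j (λ f → Ψ (merge w f) * fill f)
          same : ∀ t → (nonzeros (w ++ t) ≡ᵇ n) ≡ (nonzeros t ≡ᵇ j)
          same t = ≡.trans (≡.cong₂ _≡ᵇ_ (count-++ _ w t) (≡.trans (≡.sym |w|≡n) (≡.sym (nonzeros+zeros w))))
                     (+-≡ᵇ-cancelˡ (nonzeros w) (nonzeros t) j)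
          each : ∀ t → ind (nonzeros (w ++ t) ≡ᵇ n) * weight x y δ (w ++ t) ≈
                 hw * (ind (nonzeros t ≡ᵇ j) * (Ψ (merge w (nonzeroLetters t)) * tailWeight x y δ (suc p) t))
          each t rewrite same t with nonzeros t ≡ᵇ j in eq
          ... | false = trans (zeroˡ _) (sym (trans (*-congˡ (zeroˡ _)) (zeroʳ _)))
          ... | true  = trans (*-congˡ (weight-++ x y δ w t (ℕ.≡ᵇ⇒≡ _ _ (Equivalence.from T-≡ eq))))
                          (solve 3 (λ p h t → con 1ℤ :* (p :* h :* t) := h :* (con 1ℤ :* (p :* t))) refl _ _ _)

    final : ℕ → (x̂ ŷ : ℕ → Carrier) → Carrier → Carrier
    final zero    x̂ ŷ h = h
    final (suc N) x̂ ŷ h = final N (x̂ ∘ suc) (ŷ ∘ suc) (h * (inverse (x̂ 0) * (1# - u * ŷ 0) * inverse (h * ŷ 0)))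

    -- The recursion for final is affine in 1/h, so it is solved for the reciprocal.
    kappa : ℕ → (x̂ ŷ : ℕ → Carrier) → Carrier → Carrier
    kappa zero    x̂ ŷ k = k
    kappa (suc N) x̂ ŷ k = kappa N (x̂ ∘ suc) (ŷ ∘ suc) ((1# - u * x̂ 0) * inverse (ŷ 0) * (k - u * ŷ 0))

    -- For reciprocals a step reads 1/h′ = (1 - x) (1/h - y) / (1 - y): the denominator `1 - h y`
    -- has been absorbed into the difference.
    kappa-final : ∀ N x̂ ŷ k h → k * h ≈ 1# → kappa N x̂ ŷ k * final N x̂ ŷ h ≈ 1#
    kappa-final zero    x̂ ŷ k h kh = kh
    kappa-final (suc N) x̂ ŷ k h kh = kappa-final N (x̂ ∘ suc) (ŷ ∘ suc) _ _ (begin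
      (1# - X) * i * (k - Y) * (h * (a * (1# - Y) * g))
        ≈⟨ solve 7 (λ X i k Y h a g → (con 1ℤ :- X) :* i :* (k :- Y) :* (h :* (a :* (con 1ℤ :- Y) :* g)) :=
                     (a :* (con 1ℤ :- X)) :* (i :* (con 1ℤ :- Y)) :* (g :* (k :* h :- Y :* h))) refl X i k Y h a g ⟩
      (a * (1# - X)) * (i * (1# - Y)) * (g * (k * h - Y * h))
        ≈⟨ *-cong (*-cong (inverse-* (x̂ 0)) (inverse-* (ŷ 0))) (*-congˡ (+-congʳ kh)) ⟩
      1# * 1# * (g * (1# - Y * h))
        ≈⟨ solve 4 (λ g u h y → con 1ℤ :* con 1ℤ :* (g :* (con 1ℤ :- u :* y :* h)) := g :* (con 1ℤ :- u :* (h :* y))) refl g u h (ŷ 0) ⟩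
      g * (1# - u * (h * ŷ 0))
        ≈⟨ inverse-* (h * ŷ 0) ⟩
      1# ∎)
      where
      X = u * x̂ 0
      Y = u * ŷ 0
      a = inverse (x̂ 0)
      i = inverse (ŷ 0)
      g = inverse (h * ŷ 0)

    module _ (0<M : 0 < M) where
      allWords-final : ∀ N x̂ ŷ h →
        h * allWords (sumTokens N) (weight (λ b → u * x̂ b) (λ b → u * ŷ b) (h - 1#)) ≈ final N x̂ ŷ h
      allWords-final zero x̂ ŷ h = trans (*-congˡ (base M 0<M)) (*-identityʳ h)
        where
        base : ∀ m → 0 < m → ∑< m (λ n → ∑words (sumTokens 0) n (weight (λ b → u * x̂ b) (λ b → u * ŷ b) (h - 1#))) ≈ 1#
        base (suc m) _ = trans (+-cong (*-identityˡ 1#) (∑-zero< m (λ _ _ → refl))) (+-identityʳ 1#)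
      allWords-final (suc N) x̂ ŷ h = trans (*-congˡ (Step.eliminate N x̂ ŷ h (inverse (x̂ 0)) (inverse (h * ŷ 0)) (inverse-* (x̂ 0)) (inverse-* (h * ŷ 0))))
        (trans (sym (*-assoc _ _ _)) (allWords-final N (x̂ ∘ suc) (ŷ ∘ suc) _))

      ∑words-pure : ∀ N n (x y : ℕ → Carrier) δ → δ ≈ 0# → (Ψ : List Token → Carrier) →
        ∑words (sumTokens N) n (λ w → Ψ w * movedWeight x y δ w) ≈ ∑words (∑< N) n (Ψ ∘ List.map pure)
      ∑words-pure N zero    x y δ δ≈0 Ψ = *-identityʳ _
      ∑words-pure N (suc n) x y δ δ≈0 Ψ = ∑-cong N λ b → trans
        (+-cong (∑words-pure N n x y δ δ≈0 (Ψ ∘ (pure b ∷_)))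
          (Linear.vanish (∑words-linear (sumTokens-linear N) n) λ w →
            trans (*-congˡ (trans (*-congʳ (trans (*-congʳ δ≈0) (zeroˡ _))) (zeroˡ _))) (zeroʳ _)))
        (+-identityʳ _)

      -- Starting from `h = 1` gives moved letters the weight 0, so that only plain words remain.
      kappa-allWords : ∀ N x̂ ŷ →
        kappa N x̂ ŷ 1# * allWords (∑< N) (Φ (λ b → u * x̂ b) (λ b → u * ŷ b) ∘ List.map pure) ≈ 1#
      kappa-allWords N x̂ ŷ = begin
        kappa N x̂ ŷ 1# * allWords (∑< N) (Φ x y ∘ List.map pure)
          ≈⟨ *-congˡ (∑-cong M (λ n → sym (∑words-pure N n x y (1# - 1#) (-‿inverseʳ 1#) (Φ x y)))) ⟩
        kappa N x̂ ŷ 1# * allWords (sumTokens N) (weight x y (1# - 1#))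
          ≈⟨ *-congˡ (trans (sym (*-identityˡ _)) (allWords-final N x̂ ŷ 1#)) ⟩
        kappa N x̂ ŷ 1# * final N x̂ ŷ 1#
          ≈⟨ kappa-final N x̂ ŷ 1# 1# (*-identityˡ 1#) ⟩
        1# ∎
        where
        x = λ b → u * x̂ b
        y = λ b → u * ŷ b

    module Windings (0<M : 0 < M) (q : Carrier) (r′ t′ : ℕ) where
      open Statistic r′
      private
        r t : ℕ
        r = suc r′
        t = suc t′

      -- The multiplier (1 - x) / (1 - y) of a letter of colour 0, for which x is `u` and y is
      -- `u * q ^ r`.
      θ : Carrier
      θ = (1# - u * 1#) * inverse (q ^ r)

      [r] : Carrier
      [r] = ∑< r (q ^_)

      -- The reciprocal reached after the letter 0 and `m` further blocks of `r` letters; `[r]` is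
      -- the q-analogue of `r`.
      κ : ℕ → Carrier
      κ m = 1# - u - u * [r] * ∑< m (λ i → θ ^ suc i)

      θ-inverse : θ * (1# - u * q ^ r) ≈ 1# - u
      θ-inverse = begin
        (1# - u * 1#) * inverse (q ^ r) * (1# - u * q ^ r)     ≈⟨ *-assoc _ _ _ ⟩
        (1# - u * 1#) * (inverse (q ^ r) * (1# - u * q ^ r))   ≈⟨ *-congˡ (inverse-* (q ^ r)) ⟩
        (1# - u * 1#) * 1#                                     ≈⟨ solve 1 (λ u → (con 1ℤ :- u :* con 1ℤ) :* con 1ℤ := con 1ℤ :- u) refl u ⟩
        1# - u                                                 ∎

      inverse-cong : ∀ {a b} → a ≈ b → inverse a ≈ inverse b
      inverse-cong a≈b = ∑-cong M λ i → ^-congˡ i (*-congˡ a≈b)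

      kappa-cong : ∀ N {x y x′ y′ k k′} → (∀ i → x i ≈ x′ i) → (∀ i → y i ≈ y′ i) → k ≈ k′ →
                   kappa N x y k ≈ kappa N x′ y′ k′
      kappa-cong zero    x≈ y≈ k≈ = k≈
      kappa-cong (suc N) x≈ y≈ k≈ = kappa-cong N (x≈ ∘ suc) (y≈ ∘ suc)
        (*-cong (*-cong (+-congˡ (-‿cong (*-congˡ (x≈ 0)))) (inverse-cong (y≈ 0))) (+-cong k≈ (-‿cong (*-congˡ (y≈ 0)))))

      kappa-+ : ∀ m n x y k → kappa (m ℕ.+ n) x y k ≡ kappa n (x ∘ (m ℕ.+_)) (y ∘ (m ℕ.+_)) (kappa m x y k)
      kappa-+ zero    n x y k = ≡.refl
      kappa-+ (suc m) n x y k = kappa-+ m n (x ∘ suc) (y ∘ suc) _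

      -- Equal weights cancel in (1 - x) / (1 - y), which leaves a subtraction. This is the case of
      -- the nonzero colours, where an excedance weighs the same as a non-excedance.
      kappa-equal : ∀ N x y k → (∀ i → i < N → x i ≈ y i) → kappa N x y k ≈ k - u * ∑< N y
      kappa-equal zero    x y k eq = solve 2 (λ k u → k := k :- u :* con 0ℤ) refl k u
      kappa-equal (suc N) x y k eq = begin
        kappa N (x ∘ suc) (y ∘ suc) ((1# - u * x 0) * inverse (y 0) * (k - u * y 0))
          ≈⟨ kappa-equal N _ _ _ (λ i i<N → eq (suc i) (s≤s i<N)) ⟩
        (1# - u * x 0) * inverse (y 0) * (k - u * y 0) - u * ∑< N (y ∘ suc)
          ≈⟨ +-congʳ (*-congʳ (trans (*-congʳ (+-congˡ (-‿cong (*-congˡ (eq 0 (s≤s z≤n)))))) (trans (*-comm _ _) (inverse-* (y 0))))) ⟩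
        1# * (k - u * y 0) - u * ∑< N (y ∘ suc)
          ≈⟨ solve 4 (λ k u y s → con 1ℤ :* (k :- u :* y) :- u :* s := k :- u :* (y :+ s)) refl k u (y 0) _ ⟩
        k - u * (y 0 + ∑< N (y ∘ suc)) ∎

      module _ (x̂ ŷ : ℕ → Carrier) (x̂-periodic : ∀ i → x̂ (r ℕ.+ i) ≡ x̂ i) (ŷ-periodic : ∀ i → ŷ (r ℕ.+ i) ≡ ŷ i)
        (x̂-colour : ∀ i → i < r → x̂ i ≡ q ^ i) (ŷ-zero : ŷ 0 ≡ q ^ r) (ŷ-colour : ∀ i → suc i < r → ŷ (suc i) ≡ q ^ suc i) where

        -- A block has the colours 1, ..., r - 1, 0 in this order, so the multiplier `θ` acts last.
        -- The constant terms combine by `[r] * (1 - q) = 1 - q ^ r` and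
        -- `θ * (1 - u * q ^ r) = 1 - u`.
        kappa-block : ∀ m → kappa r (x̂ ∘ suc) (ŷ ∘ suc) (κ m) ≈ κ (suc m)
        kappa-block m = begin
          kappa r (x̂ ∘ suc) (ŷ ∘ suc) (κ m)
            ≡⟨ ≡.cong (λ n → kappa n (x̂ ∘ suc) (ŷ ∘ suc) (κ m)) (ℕ.+-comm 1 r′) ⟩
          kappa (r′ ℕ.+ 1) (x̂ ∘ suc) (ŷ ∘ suc) (κ m)
            ≡⟨ kappa-+ r′ 1 (x̂ ∘ suc) (ŷ ∘ suc) (κ m) ⟩
          (1# - u * x̂ (r ℕ.+ 0)) * inverse (ŷ (r ℕ.+ 0)) * (kappa r′ (x̂ ∘ suc) (ŷ ∘ suc) (κ m) - u * ŷ (r ℕ.+ 0))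
            ≡⟨ ≡.cong₂ (λ a b → (1# - u * a) * inverse b * (kappa r′ (x̂ ∘ suc) (ŷ ∘ suc) (κ m) - u * b))
                 (≡.trans (x̂-periodic 0) (x̂-colour 0 (s≤s z≤n))) (≡.trans (ŷ-periodic 0) ŷ-zero) ⟩
          θ * (kappa r′ (x̂ ∘ suc) (ŷ ∘ suc) (κ m) - u * q ^ r)
            ≈⟨ *-congˡ (+-congʳ (trans (kappa-equal r′ _ _ _ λ i i<r′ →
                 reflexive (≡.trans (x̂-colour (suc i) (s≤s i<r′)) (≡.sym (ŷ-colour i (s≤s i<r′)))))
                 (+-congˡ (-‿cong (*-congˡ (∑-cong< r′ λ i i<r′ → reflexive (ŷ-colour i (s≤s i<r′)))))))) ⟩
          θ * ((κ m - u * ∑< r′ (λ i → q ^ suc i)) - u * q ^ r)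
            ≈⟨ *-congˡ (trans (solve 4 (λ k u s p → (k :- u :* s) :- u :* p := k :- u :* (s :+ p)) refl (κ m) u _ _)
                 (+-congˡ (-‿cong (*-congˡ (trans (sym (∑-last r′ (λ i → q ^ suc i))) (Linear.scale (∑-linear r) q (q ^_))))))) ⟩
          θ * (κ m - u * (q * [r]))
            ≈⟨ solve 5 (λ θ u R s q → θ :* ((con 1ℤ :- u :- u :* R :* s) :- u :* (q :* R)) :=
                          θ :* (con 1ℤ :- u :* (con 1ℤ :- R :* (con 1ℤ :- q))) :- u :* R :* (θ :* con 1ℤ :+ θ :* s)) refl θ u [r] (∑< m (λ i → θ ^ suc i)) q ⟩
          θ * (1# - u * (1# - [r] * (1# - q))) - u * [r] * (θ * 1# + θ * ∑< m (λ i → θ ^ suc i))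
            ≈⟨ +-cong (*-congˡ (+-congˡ (-‿cong (*-congˡ (+-congˡ (-‿cong (geometric r q)))))))
                      (-‿cong (*-congˡ (+-congˡ (sym (Linear.scale (∑-linear m) θ (λ i → θ ^ suc i)))))) ⟩
          θ * (1# - u * (1# - (1# - q ^ r))) - u * [r] * ∑< (suc m) (λ i → θ ^ suc i)
            ≈⟨ +-congʳ (trans (solve 3 (λ θ u p → θ :* (con 1ℤ :- u :* (con 1ℤ :- (con 1ℤ :- p))) := θ :* (con 1ℤ :- u :* p)) refl θ u (q ^ r)) θ-inverse) ⟩
          κ (suc m) ∎

        kappa-blocks : ∀ n m → kappa (n ℕ.* r) (x̂ ∘ suc) (ŷ ∘ suc) (κ m) ≈ κ (n ℕ.+ m)
        kappa-blocks zero    m = refl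
        kappa-blocks (suc n) m = begin
          kappa (r ℕ.+ n ℕ.* r) (x̂ ∘ suc) (ŷ ∘ suc) (κ m)
            ≡⟨ kappa-+ r (n ℕ.* r) (x̂ ∘ suc) (ŷ ∘ suc) (κ m) ⟩
          kappa (n ℕ.* r) (x̂ ∘ suc ∘ (r ℕ.+_)) (ŷ ∘ suc ∘ (r ℕ.+_)) (kappa r (x̂ ∘ suc) (ŷ ∘ suc) (κ m))
            ≈⟨ kappa-cong (n ℕ.* r)
                 (λ i → reflexive (≡.trans (≡.cong x̂ (≡.sym (ℕ.+-suc r i))) (x̂-periodic (suc i))))
                 (λ i → reflexive (≡.trans (≡.cong ŷ (≡.sym (ℕ.+-suc r i))) (ŷ-periodic (suc i))))
                 (kappa-block m) ⟩
          kappa (n ℕ.* r) (x̂ ∘ suc) (ŷ ∘ suc) (κ (suc m))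
            ≈⟨ kappa-blocks n (suc m) ⟩
          κ (n ℕ.+ suc m)
            ≡⟨ ≡.cong κ (ℕ.+-suc n m) ⟩
          κ (suc n ℕ.+ m) ∎

        kappa-closed : kappa (suc (r ℕ.* t)) x̂ ŷ 1# ≈ κ t
        kappa-closed = begin
          kappa (r ℕ.* t) (x̂ ∘ suc) (ŷ ∘ suc) ((1# - u * x̂ 0) * inverse (ŷ 0) * (1# - u * ŷ 0))
            ≈⟨ kappa-cong (r ℕ.* t) {x̂ ∘ suc} {ŷ ∘ suc} (λ _ → refl) (λ _ → refl) (begin
                 (1# - u * x̂ 0) * inverse (ŷ 0) * (1# - u * ŷ 0)     ≈⟨ *-assoc _ _ _ ⟩
                 (1# - u * x̂ 0) * (inverse (ŷ 0) * (1# - u * ŷ 0))   ≈⟨ *-cong (+-congˡ (-‿cong (*-congˡ (reflexive (x̂-colour 0 (s≤s z≤n)))))) (inverse-* (ŷ 0)) ⟩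
                 (1# - u * 1#) * 1#   ≈⟨ solve 2 (λ u R → (con 1ℤ :- u :* con 1ℤ) :* con 1ℤ := con 1ℤ :- u :- u :* R :* con 0ℤ) refl u [r] ⟩
                 κ 0                  ∎) ⟩
          kappa (r ℕ.* t) (x̂ ∘ suc) (ŷ ∘ suc) (κ 0)
            ≡⟨ ≡.cong (λ n → kappa n (x̂ ∘ suc) (ŷ ∘ suc) (κ 0)) (ℕ.*-comm r t) ⟩
          kappa (t ℕ.* r) (x̂ ∘ suc) (ŷ ∘ suc) (κ 0)
            ≈⟨ kappa-blocks t 0 ⟩
          κ (t ℕ.+ 0)
            ≡⟨ ≡.cong κ (ℕ.+-identityʳ t) ⟩
          κ t ∎

      module _ (e : ℕ → Carrier) (e-start : ∀ i → i ≤ t → e i ≈ 1#) (e-shift : ∀ i → e (t ℕ.+ suc i) ≈ q * e (suc i)) where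

        -- Words read as walks starting at `i`, with the letters as steps of weight `u` and the end
        -- point weighted by `e`.
        walks : ℕ → ℕ → Carrier
        walks zero    i = e i
        walks (suc n) i = u * ∑< (suc (r ℕ.* t)) (λ b → walks n (i ℕ.+ b))

        walks-small : ∀ n i → Small n (walks n i)
        walks-small zero    i = small-1 _
        walks-small (suc n) i = small-* (small-resp (*-identityʳ u) (small-u 1#)) (small-I (∑-linear (suc (r ℕ.* t))) (λ b → walks-small n (i ℕ.+ b)))

        walks-shift : ∀ n i → walks n (t ℕ.+ suc i) ≈ q * walks n (suc i)
        walks-shift zero    i = e-shift i
        walks-shift (suc n) i = begin
          u * ∑< K (λ b → walks n (t ℕ.+ suc i ℕ.+ b))     ≈⟨ *-congˡ (∑-cong K λ b → trans (reflexive (≡.cong (walks n) (ℕ.+-assoc t (suc i) b))) (walks-shift n (i ℕ.+ b))) ⟩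
          u * ∑< K (λ b → q * walks n (suc (i ℕ.+ b)))     ≈⟨ *-congˡ (Linear.scale (∑-linear K) q (λ b → walks n (suc (i ℕ.+ b)))) ⟩
          u * (q * ∑< K (λ b → walks n (suc (i ℕ.+ b))))   ≈⟨ solve 3 (λ u q s → u :* (q :* s) := q :* (u :* s)) refl u q _ ⟩
          q * (u * ∑< K (λ b → walks n (suc (i ℕ.+ b))))   ∎
          where K = suc (r ℕ.* t)

        allWalks : ℕ → Carrier
        allWalks i = ∑< M (λ n → walks n i)

        allWalks-first : ∀ i → allWalks i ≈ e i + u * ∑< (suc (r ℕ.* t)) (λ b → allWalks (i ℕ.+ b))
        allWalks-first i = begin
          allWalks i                                        ≈⟨ sym (trans (+-congˡ (small-vanish ℕ.≤-refl (walks-small M i))) (+-identityʳ _)) ⟩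
          allWalks i + walks M i                            ≈⟨ sym (∑-last M (λ n → walks n i)) ⟩
          e i + ∑< M (λ n → u * ∑< K (λ b → walks n (i ℕ.+ b)))
            ≈⟨ +-congˡ (trans (Linear.scale (∑-linear M) u _) (*-congˡ (Linear.∑-swap (∑-linear M) K (λ n b → walks n (i ℕ.+ b))))) ⟩
          e i + u * ∑< K (λ b → allWalks (i ℕ.+ b))         ∎
          where K = suc (r ℕ.* t)

        allWalks-shift : ∀ i → allWalks (t ℕ.+ suc i) ≈ q * allWalks (suc i)
        allWalks-shift i = trans (∑-cong M (λ n → walks-shift n i)) (Linear.scale (∑-linear M) q _)

        allWalks-shifts : ∀ m i → allWalks (m ℕ.* t ℕ.+ suc i) ≈ q ^ m * allWalks (suc i)
        allWalks-shifts zero    i = sym (*-identityˡ _)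
        allWalks-shifts (suc m) i = begin
          allWalks (t ℕ.+ m ℕ.* t ℕ.+ suc i)
            ≡⟨ ≡.cong allWalks (≡.trans (ℕ.+-assoc t (m ℕ.* t) (suc i)) (≡.cong (t ℕ.+_) (ℕ.+-suc (m ℕ.* t) i))) ⟩
          allWalks (t ℕ.+ suc (m ℕ.* t ℕ.+ i))    ≈⟨ allWalks-shift (m ℕ.* t ℕ.+ i) ⟩
          q * allWalks (suc (m ℕ.* t ℕ.+ i))      ≡⟨ ≡.cong (λ n → q * allWalks n) (≡.sym (ℕ.+-suc (m ℕ.* t) i)) ⟩
          q * allWalks (m ℕ.* t ℕ.+ suc i)        ≈⟨ *-congˡ (allWalks-shifts m i) ⟩
          q * (q ^ m * allWalks (suc i))          ≈⟨ sym (*-assoc _ _ _) ⟩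
          q * q ^ m * allWalks (suc i)            ∎

        -- The difference of the first-step equations at i and suc i telescopes.
        allWalks-suc : ∀ i → i < t → allWalks (suc i) ≈ θ * allWalks i
        allWalks-suc i i<t = begin
          B                                             ≈⟨ sym (*-identityˡ B) ⟩
          1# * B                                        ≈⟨ *-congʳ (sym (inverse-* (q ^ r))) ⟩
          v * (1# - u * q ^ r) * B                      ≈⟨ solve 4 (λ v u p B → v :* (con 1ℤ :- u :* p) :* B := v :* (B :- u :* (p :* B))) refl v u (q ^ r) B ⟩
          v * (B - u * (q ^ r * B))                     ≈⟨ *-congˡ (+-cong (allWalks-first (suc i)) (-‿cong (*-congˡ (sym last≈)))) ⟩
          v * ((e (suc i) + u * ∑< (suc K) (λ b → allWalks (suc i ℕ.+ b))) - u * allWalks (suc i ℕ.+ K))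
            ≈⟨ *-congˡ (+-congʳ (+-cong (trans (e-start (suc i) i<t) (sym (e-start i (ℕ.<⇒≤ i<t)))) (*-congˡ (∑-last K (λ b → allWalks (suc i ℕ.+ b)))))) ⟩
          v * ((e i + u * (s + allWalks (suc i ℕ.+ K))) - u * allWalks (suc i ℕ.+ K))
            ≈⟨ *-congˡ (solve 5 (λ e u s l A → (e :+ u :* (s :+ l)) :- u :* l := (e :+ u :* (A :+ s)) :- u :* A) refl _ u s _ A) ⟩
          v * ((e i + u * (A + s)) - u * A)
            ≈⟨ *-congˡ (+-congʳ (sym (trans (allWalks-first i) (+-congˡ (*-congˡ (+-cong
                  (reflexive (≡.cong allWalks (ℕ.+-identityʳ i))) (∑-cong K λ b → reflexive (≡.cong allWalks (ℕ.+-suc i b))))))))) ⟩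
          v * (A - u * A)                               ≈⟨ solve 3 (λ v A u → v :* (A :- u :* A) := (con 1ℤ :- u :* con 1ℤ) :* v :* A) refl v A u ⟩
          θ * A                                         ∎
          where
          K = r ℕ.* t
          A = allWalks i
          B = allWalks (suc i)
          v = inverse (q ^ r)
          s = ∑< K (λ b → allWalks (suc i ℕ.+ b))
          last≈ : allWalks (suc i ℕ.+ K) ≈ q ^ r * B
          last≈ = trans (reflexive (≡.cong allWalks (ℕ.+-comm (suc i) K))) (allWalks-shifts r i)

        allWalks-power : ∀ i → i ≤ t → allWalks i ≈ θ ^ i * allWalks 0
        allWalks-power zero    _   = sym (*-identityˡ _)
        allWalks-power (suc i) i<t = trans (allWalks-suc i i<t) (trans (*-congˡ (allWalks-power i (ℕ.<⇒≤ i<t))) (sym (*-assoc _ _ _)))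

        -- This is the first-step equation at 0. The other starting points reduce to 0: within a
        -- stretch of length `t` by powers of `θ`, from one stretch to the next by `q`. Together
        -- they produce `[r]` times the sum of the powers of `θ`.
        κ-allWalks : κ t * allWalks 0 ≈ 1#
        κ-allWalks = begin
          (1# - u - u * [r] * s) * A
            ≈⟨ solve 4 (λ u R s A → (con 1ℤ :- u :- u :* R :* s) :* A := A :- u :* (A :+ R :* (s :* A))) refl u [r] s A ⟩
          A - u * (A + [r] * (s * A))
            ≈⟨ +-congˡ (-‿cong (*-congˡ (+-congˡ rest))) ⟩
          A - u * (A + ∑< (r ℕ.* t) (λ b → allWalks (suc b)))
            ≈⟨ +-congʳ (allWalks-first 0) ⟩
          (e 0 + u * (A + ∑< (r ℕ.* t) (λ b → allWalks (suc b)))) - u * (A + ∑< (r ℕ.* t) (λ b → allWalks (suc b)))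
            ≈⟨ solve 2 (λ e z → (e :+ z) :- z := e) refl _ _ ⟩
          e 0 ≈⟨ e-start 0 z≤n ⟩
          1# ∎
          where
          A = allWalks 0
          s = ∑< t (λ i → θ ^ suc i)
          rest : [r] * (s * A) ≈ ∑< (r ℕ.* t) (λ b → allWalks (suc b))
          rest = begin
            [r] * (s * A)
              ≈⟨ *-congˡ (trans (sym (Linear.scaleʳ (∑-linear t) A (λ i → θ ^ suc i))) (∑-cong< t λ i i<t → sym (allWalks-power (suc i) i<t))) ⟩
            [r] * ∑< t (λ i → allWalks (suc i))
              ≈⟨ sym (Linear.scaleʳ (∑-linear r) _ (q ^_)) ⟩
            ∑< r (λ m → q ^ m * ∑< t (λ i → allWalks (suc i)))
              ≈⟨ ∑-cong r (λ m → trans (sym (Linear.scale (∑-linear t) (q ^ m) (λ i → allWalks (suc i)))) (∑-cong t λ i → trans (sym (allWalks-shifts m i)) (reflexive (≡.cong allWalks (ℕ.+-suc (m ℕ.* t) i))))) ⟩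
            ∑< r (λ m → ∑< t (λ i → allWalks (suc (m ℕ.* t ℕ.+ i))))
              ≈⟨ sym (∑-blocks r t (allWalks ∘ suc)) ⟩
            ∑< (r ℕ.* t) (λ b → allWalks (suc b)) ∎

        ∑words-walks : ∀ n i → ∑words (∑< (suc (r ℕ.* t))) n (λ w → u ^ n * e (i ℕ.+ sum w)) ≈ walks n i
        ∑words-walks zero    i = trans (*-identityˡ _) (reflexive (≡.cong e (ℕ.+-identityʳ i)))
        ∑words-walks (suc n) i = trans (∑-cong K λ b → trans (Linear.cong (L n) λ w → trans (*-assoc _ _ _)
            (*-congˡ (*-congˡ (reflexive (≡.cong e (≡.sym (ℕ.+-assoc i b (sum w))))))))
            (trans (Linear.scale (L n) u _) (*-congˡ (∑words-walks n (i ℕ.+ b)))))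
          (Linear.scale (∑-linear K) u (λ b → walks n (i ℕ.+ b)))
          where
          K = suc (r ℕ.* t)
          L = ∑words-linear (∑-linear K)

      xᶜ yᶜ : ℕ → Carrier
      xᶜ b = q ^ colour b
      yᶜ b = q ^ exceeding b

      colour-periodic : ∀ i → colour (r ℕ.+ i) ≡ colour i
      colour-periodic i = ≡.trans (≡.cong (_% r) (ℕ.+-comm r i)) (ℕ.[m+n]%n≡m%n i r)

      exceeding-colour : ∀ i → suc i < r → exceeding (suc i) ≡ suc i
      exceeding-colour i i<r rewrite ℕ.m<n⇒m%n≡m i<r = ≡.refl

      -- Truncated subtraction assigns 1 to the end point 0. Hence the value is 1 on 0, ..., t, and
      -- translation by `t` multiplies by `q` only from 1 on.
      winding : ℕ → Carrier
      winding i = q ^ ((i ∸ 1) / t)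

      winding-start : ∀ i → i ≤ t → winding i ≈ 1#
      winding-start i i≤t = reflexive (≡.cong (q ^_) (ℕ.m<n⇒m/n≡0 {i ∸ 1} {t} (s≤s (ℕ.∸-monoˡ-≤ 1 i≤t))))

      winding-shift : ∀ i → winding (t ℕ.+ suc i) ≈ q * winding (suc i)
      winding-shift i = reflexive (≡.cong (q ^_) (≡.trans (≡.cong (_/ t) (ℕ.+-suc t′ i))
        (≡.trans (ℕ.+-distrib-/-∣ˡ {t} i ℕ.∣-refl) (≡.cong (ℕ._+ i / t) (ℕ.n/n≡1 t)))))

      pure-weight : ∀ s o w → pureWeight (λ b → u * xᶜ b) (λ b → u * yᶜ b) s o (List.map pure w) ≈
                    u ^ length w * q ^ statFrom s o w
      pure-weight s o []      = sym (*-identityˡ 1#)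
      pure-weight s o (b ∷ w) = begin
        (if o b ≤ᵇ s b then u * xᶜ b else u * yᶜ b) * _
          ≈⟨ *-cong (reflexive (choose (o b ≤ᵇ s b))) (pure-weight s (seen (pure b) o) w) ⟩
        (u * q ^ m) * (u ^ length w * q ^ statFrom s _ w)
          ≈⟨ solve 4 (λ u p v z → (u :* p) :* (v :* z) := (u :* v) :* (p :* z)) refl u _ _ _ ⟩
        (u * u ^ length w) * (q ^ m * q ^ statFrom s _ w)
          ≈⟨ *-congˡ (sym (^-homo-* q m _)) ⟩
        _ ∎
        where
        m = if o b ≤ᵇ s b then colour b else exceeding b
        choose : ∀ p → (if p then u * xᶜ b else u * yᶜ b) ≡ u * q ^ (if p then colour b else exceeding b)
        choose true  = ≡.refl
        choose false = ≡.refl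

      K = suc (r ℕ.* t)

      -- Both sides are inverse to `κ t`, the left one by elimination and the right one by the
      -- walks; an inverse is unique.
      total : allWords (∑< K) (λ w → u ^ length w * q ^ stat w) ≈
              allWords (∑< K) (λ w → u ^ length w * winding (sum w))
      total = begin
        G                        ≈⟨ sym (*-identityˡ G) ⟩
        1# * G                   ≈⟨ *-congʳ (sym (trans (*-comm _ _) (κ-allWalks winding winding-start winding-shift))) ⟩
        W * κ t * G              ≈⟨ *-assoc _ _ _ ⟩
        W * (κ t * G)            ≈⟨ *-congˡ (*-cong (sym (kappa-closed xᶜ yᶜ
                                      (λ i → ≡.cong (q ^_) (colour-periodic i))
                                      (λ i → ≡.cong (λ m → q ^ (if m ≡ᵇ 0 then r else m)) (colour-periodic i))
                                      (λ i i<r → ≡.cong (q ^_) (ℕ.m<n⇒m%n≡m i<r)) ≡.refl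
                                      (λ i i<r → ≡.cong (q ^_) (exceeding-colour i i<r))))
                                      (∑-cong M λ n → Linear.cong (∑words-linear (∑-linear K) n) λ w → sym (pure-weight _ _ w))) ⟩
        W * (kappa K xᶜ yᶜ 1# * _) ≈⟨ *-congˡ (kappa-allWords 0<M K xᶜ yᶜ) ⟩
        W * 1#                   ≈⟨ *-identityʳ W ⟩
        W                        ≈⟨ ∑-cong M (λ n → trans (sym (∑words-walks winding winding-start winding-shift n 0))
                                      (∑words-cong (∑-linear K) n λ w |w|≡n → *-congʳ (reflexive (≡.cong (u ^_) (≡.sym |w|≡n))))) ⟩
        allWords (∑< K) (λ w → u ^ length w * winding (sum w)) ∎
        where
        G = allWords (∑< K) (λ w → u ^ length w * q ^ stat w)
        W = allWalks winding winding-start winding-shift 0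

-- Rings of formal power series, full and truncated

module SeriesRings where
  open import Defs using (powerSeries; constant; indeterminate)
  open IntegerSolver
  open Summation
  open import Algebra.Bundles using (CommutativeRing; RawRing)
  open import Algebra.Structures using (IsCommutativeRing)
  open import Data.Integer.Base using (0ℤ)
  open import Data.List.Base as List using (List)
  open import Data.Nat.Base as ℕ using (ℕ; zero; suc; _≤_; _<_; z≤n; s≤s; _≡ᵇ_)
  import Data.Nat.Properties as ℕ
  open import Data.Product.Base using (_,_)
  open import Function.Base using (_∘_)
  open import Relation.Binary.PropositionalEquality as ≡ using (_≡_)

  module Convolution {c ℓ} (R : CommutativeRing c ℓ) where
    open CommutativeRing R
    open RingSolver R
    open import Relation.Binary.Reasoning.Setoid setoid

    Series : Set c
    Series = ℕ → Carrier

    infixl 7 _⊛_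
    _⊛_ : Series → Series → Series
    _⊛_ = RawRing._*_ (powerSeries rawRing)

    ⊛-cong≤ : ∀ n {f f′ g g′} → (∀ i → i ≤ n → f i ≈ f′ i) → (∀ i → i ≤ n → g i ≈ g′ i) → (f ⊛ g) n ≈ (f′ ⊛ g′) n
    ⊛-cong≤ zero    f≈ g≈ = +-congʳ (*-cong (f≈ 0 z≤n) (g≈ 0 z≤n))
    ⊛-cong≤ (suc n) f≈ g≈ = +-cong (*-cong (f≈ 0 z≤n) (g≈ (suc n) ℕ.≤-refl))
      (⊛-cong≤ n (λ i i≤n → f≈ (suc i) (s≤s i≤n)) (λ i i≤n → g≈ i (ℕ.m≤n⇒m≤1+n i≤n)))

    ⊛-cong : ∀ {f f′ g g′} → (∀ i → f i ≈ f′ i) → (∀ i → g i ≈ g′ i) → ∀ n → (f ⊛ g) n ≈ (f′ ⊛ g′) n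
    ⊛-cong f≈ g≈ n = ⊛-cong≤ n (λ i _ → f≈ i) (λ i _ → g≈ i)

    -- The recursion of the product peels off the lowest coefficient of the left factor;
    -- commutativity compares it with peeling off the highest one.
    ⊛-last : ∀ f g n → (f ⊛ g) (suc n) ≈ (f ⊛ (g ∘ suc)) n + f (suc n) * g 0
    ⊛-last f g zero    = solve 2 (λ a b → a :+ (b :+ con 0ℤ) := (a :+ con 0ℤ) :+ b) refl _ _
    ⊛-last f g (suc n) = trans (+-congˡ (⊛-last (f ∘ suc) g n)) (sym (+-assoc _ _ _))

    ⊛-comm : ∀ f g n → (f ⊛ g) n ≈ (g ⊛ f) n
    ⊛-comm f g zero    = +-congʳ (*-comm _ _)
    ⊛-comm f g (suc n) = begin
      f 0 * g (suc n) + ((f ∘ suc) ⊛ g) n   ≈⟨ +-comm _ _ ⟩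
      ((f ∘ suc) ⊛ g) n + f 0 * g (suc n)   ≈⟨ +-cong (⊛-comm (f ∘ suc) g n) (*-comm _ _) ⟩
      (g ⊛ (f ∘ suc)) n + g (suc n) * f 0   ≈⟨ sym (⊛-last g f n) ⟩
      (g ⊛ f) (suc n)                       ∎

    ⊛-distribʳ : ∀ h f g n → ((λ i → f i + g i) ⊛ h) n ≈ (f ⊛ h) n + (g ⊛ h) n
    ⊛-distribʳ h f g zero    = solve 3 (λ a b c → (a :+ b) :* c :+ con 0ℤ := (a :* c :+ con 0ℤ) :+ (b :* c :+ con 0ℤ)) refl _ _ _
    ⊛-distribʳ h f g (suc n) = trans (+-congˡ (⊛-distribʳ h (f ∘ suc) (g ∘ suc) n))
      (solve 5 (λ a b c x y → (a :+ b) :* c :+ (x :+ y) := (a :* c :+ x) :+ (b :* c :+ y)) refl _ _ _ _ _)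

    ⊛-scale : ∀ k f g n → ((λ i → k * f i) ⊛ g) n ≈ k * (f ⊛ g) n
    ⊛-scale k f g zero    = solve 3 (λ k a b → k :* a :* b :+ con 0ℤ := k :* (a :* b :+ con 0ℤ)) refl _ _ _
    ⊛-scale k f g (suc n) = trans (+-congˡ (⊛-scale k (f ∘ suc) g n))
      (solve 4 (λ k a b s → k :* a :* b :+ k :* s := k :* (a :* b :+ s)) refl _ _ _ _)

    ⊛-assoc : ∀ f g h n → ((f ⊛ g) ⊛ h) n ≈ (f ⊛ (g ⊛ h)) n
    ⊛-assoc f g h zero    = solve 3 (λ a b c → (a :* b :+ con 0ℤ) :* c :+ con 0ℤ := a :* (b :* c :+ con 0ℤ) :+ con 0ℤ) refl _ _ _
    ⊛-assoc f g h (suc n) = begin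
      (f 0 * g 0 + 0#) * h (suc n) + ((λ i → f 0 * g (suc i) + ((f ∘ suc) ⊛ g) i) ⊛ h) n
        ≈⟨ +-congˡ (trans (⊛-distribʳ h (λ i → f 0 * g (suc i)) ((f ∘ suc) ⊛ g) n)
             (+-cong (⊛-scale (f 0) (g ∘ suc) h n) (⊛-assoc (f ∘ suc) g h n))) ⟩
      (f 0 * g 0 + 0#) * h (suc n) + (f 0 * ((g ∘ suc) ⊛ h) n + ((f ∘ suc) ⊛ (g ⊛ h)) n)
        ≈⟨ solve 5 (λ a b c s t → (a :* b :+ con 0ℤ) :* c :+ (a :* s :+ t) := a :* (b :* c :+ s) :+ t) refl _ _ _ _ _ ⟩
      f 0 * (g 0 * h (suc n) + ((g ∘ suc) ⊛ h) n) + ((f ∘ suc) ⊛ (g ⊛ h)) n ∎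

    ⊛-zeroˡ : ∀ g n → ((λ _ → 0#) ⊛ g) n ≈ 0#
    ⊛-zeroˡ g zero    = trans (+-congʳ (zeroˡ _)) (+-identityˡ 0#)
    ⊛-zeroˡ g (suc n) = trans (+-cong (zeroˡ _) (⊛-zeroˡ g n)) (+-identityˡ 0#)

  module PowerSeries {c ℓ} (R : CommutativeRing c ℓ) where
    open CommutativeRing R
    private
      Series = Convolution.Series R
      infixl 7 _⊛_
      _⊛_ : Series → Series → Series
      _⊛_ = Convolution._⊛_ R

    constant-⊛ : ∀ k g n → (constant rawRing k ⊛ g) n ≈ k * g n
    constant-⊛ k g zero    = +-identityʳ _
    constant-⊛ k g (suc n) = trans (+-congˡ (Convolution.⊛-zeroˡ R g n)) (+-identityʳ _)

    indeterminate-⊛-zero : ∀ g → (indeterminate rawRing ⊛ g) 0 ≈ 0#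
    indeterminate-⊛-zero g = trans (+-identityʳ _) (zeroˡ _)

    indeterminate-⊛-suc : ∀ g n → (indeterminate rawRing ⊛ g) (suc n) ≈ g n
    indeterminate-⊛-suc g n = trans (+-cong (zeroˡ _) (trans (constant-⊛ 1# g n) (*-identityˡ _))) (+-identityˡ _)

    private
      ⊛-identityˡ : ∀ g n → (constant rawRing 1# ⊛ g) n ≈ g n
      ⊛-identityˡ g n = trans (constant-⊛ 1# g n) (*-identityˡ _)

      -- _∼_ is either full agreement or agreement below a fixed degree.
      module Quotient (_∼_ : Series → Series → Set ℓ)
        (weaken : ∀ {f g} → (∀ n → f n ≈ g n) → f ∼ g)
        (∼-sym : ∀ {f g} → f ∼ g → g ∼ f) (∼-trans : ∀ {f g h} → f ∼ g → g ∼ h → f ∼ h)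
        (+-cong∼ : ∀ {f f′ g g′} → f ∼ f′ → g ∼ g′ → (λ i → f i + g i) ∼ (λ i → f′ i + g′ i))
        (⊛-cong∼ : ∀ {f f′ g g′} → f ∼ f′ → g ∼ g′ → (f ⊛ g) ∼ (f′ ⊛ g′))
        (-‿cong∼ : ∀ {f g} → f ∼ g → (λ i → - f i) ∼ (λ i → - g i)) where

        quotient : IsCommutativeRing _∼_ (λ f g i → f i + g i) _⊛_ (λ f i → - f i) (λ _ → 0#) (constant rawRing 1#)
        quotient = record
          { isRing = record
            { +-isAbelianGroup = record
              { isGroup = record
                { isMonoid = record
                  { isSemigroup = record
                    { isMagma = record
                      { isEquivalence = record { refl = weaken (λ _ → refl) ; sym = ∼-sym ; trans = ∼-trans }
                      ; ∙-cong = +-cong∼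
                      }
                    ; assoc = λ f g h → weaken λ n → +-assoc _ _ _
                    }
                  ; identity = (λ f → weaken λ n → +-identityˡ _) , (λ f → weaken λ n → +-identityʳ _)
                  }
                ; inverse = (λ f → weaken λ n → -‿inverseˡ _) , (λ f → weaken λ n → -‿inverseʳ _)
                ; ⁻¹-cong = -‿cong∼
                }
              ; comm = λ f g → weaken λ n → +-comm _ _
              }
            ; *-cong = ⊛-cong∼
            ; *-assoc = λ f g h → weaken (Convolution.⊛-assoc R f g h)
            ; *-identity = (λ f → weaken (⊛-identityˡ f)) , (λ f → weaken λ n → trans (Convolution.⊛-comm R f (constant rawRing 1#) n) (⊛-identityˡ f n))
            ; distrib = (λ f g h → weaken λ n → trans (Convolution.⊛-comm R f (λ i → g i + h i) n) (trans (Convolution.⊛-distribʳ R f g h n) (+-cong (Convolution.⊛-comm R g f n) (Convolution.⊛-comm R h f n))))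
                      , (λ f g h → weaken (Convolution.⊛-distribʳ R f g h))
            }
          ; *-comm = λ f g → weaken (Convolution.⊛-comm R f g)
          }

    series : CommutativeRing c ℓ
    series = record
      { isCommutativeRing = Quotient.quotient (λ f g → ∀ n → f n ≈ g n) (λ eq → eq)
          (λ f≈g n → sym (f≈g n)) (λ f≈g g≈h n → trans (f≈g n) (g≈h n))
          (λ f≈ g≈ n → +-cong (f≈ n) (g≈ n)) (Convolution.⊛-cong R) (λ f≈ n → -‿cong (f≈ n)) }

    -- Carrier and operations are those of `series`, only equality ignores the degrees from `M` on.
    -- The indeterminate becomes nilpotent while coefficients below `M` can still be read off.
    truncated : ℕ → CommutativeRing c ℓ
    truncated M = record
      { isCommutativeRing = Quotient.quotient (λ f g → ∀ n → n < M → f n ≈ g n) (λ eq n _ → eq n)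
          (λ f≈g n n<M → sym (f≈g n n<M)) (λ f≈g g≈h n n<M → trans (f≈g n n<M) (g≈h n n<M))
          (λ f≈ g≈ n n<M → +-cong (f≈ n n<M) (g≈ n n<M))
          (λ f≈ g≈ n n<M → Convolution.⊛-cong≤ R n (λ i i≤n → f≈ i (ℕ.≤-<-trans i≤n n<M)) (λ i i≤n → g≈ i (ℕ.≤-<-trans i≤n n<M)))
          (λ f≈ n n<M → -‿cong (f≈ n n<M)) }

    private
      module R∑ = FiniteSums R
      u = indeterminate rawRing

    -- Stated for full and for truncated equality at once: equal series agree in every Good degree.
    module Coefficients {_∼_ : Series → Series → Set ℓ}
      (isC : IsCommutativeRing _∼_ (λ f g i → f i + g i) _⊛_ (λ f i → - f i) (λ _ → 0#) (constant rawRing 1#))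
      (Good : ℕ → Set) (good-pred : ∀ {i} → Good (suc i) → Good i)
      (coefficient : ∀ {f g} → f ∼ g → ∀ i → Good i → f i ≈ g i) where
      private
        Q : CommutativeRing c ℓ
        Q = record { isCommutativeRing = isC }
        module Q = CommutativeRing Q
        module Q∑ = FiniteSums Q

      ∑-coefficient : ∀ n (f : ℕ → Series) i → Q∑.∑< n f i ≡ R∑.∑< n (λ k → f k i)
      ∑-coefficient zero    f i = ≡.refl
      ∑-coefficient (suc n) f i = ≡.cong (λ s → f 0 i + s) (∑-coefficient n (f ∘ suc) i)

      ∑words-coefficient : ∀ N n (F : List ℕ → Series) i →
        Q∑.∑words (Q∑.∑< N) n F i ≈ R∑.∑words (R∑.∑< N) n (λ w → F w i)
      ∑words-coefficient N zero    F i = refl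
      ∑words-coefficient N (suc n) F i = trans (reflexive (∑-coefficient N _ i)) (R∑.∑-cong N λ b → ∑words-coefficient N n _ i)

      power-shift : ∀ k f i → Good (k ℕ.+ i) → (u Q∑.^ k Q.* f) (k ℕ.+ i) ≈ f i
      power-shift zero    f i good = coefficient (Q.*-identityˡ f) i good
      power-shift (suc k) f i good = trans (coefficient (Q.*-assoc u (u Q∑.^ k) f) (suc (k ℕ.+ i)) good)
        (trans (indeterminate-⊛-suc (u Q∑.^ k Q.* f) (k ℕ.+ i)) (power-shift k f i (good-pred good)))

      power-low : ∀ k f i → Good i → i < k → (u Q∑.^ k Q.* f) i ≈ 0#
      power-low (suc k) f zero    good _         = trans (coefficient (Q.*-assoc u (u Q∑.^ k) f) 0 good) (indeterminate-⊛-zero (u Q∑.^ k Q.* f))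
      power-low (suc k) f (suc i) good (s≤s i<k) = trans (coefficient (Q.*-assoc u (u Q∑.^ k) f) (suc i) good)
        (trans (indeterminate-⊛-suc (u Q∑.^ k Q.* f) i) (power-low k f i (good-pred good) i<k))

      power-coefficient : ∀ k i → (u Q∑.^ k) i ≈ R∑.ind (k ≡ᵇ i)
      power-coefficient zero    zero    = refl
      power-coefficient zero    (suc i) = refl
      power-coefficient (suc k) zero    = indeterminate-⊛-zero (u Q∑.^ k)
      power-coefficient (suc k) (suc i) = trans (indeterminate-⊛-suc (u Q∑.^ k) i) (power-coefficient k i)

      constant-power : ∀ a k i → (constant rawRing a Q∑.^ k) i ≈ constant rawRing (a R∑.^ k) i
      constant-power a zero    i       = refl
      constant-power a (suc k) i = trans (constant-⊛ a (constant rawRing a Q∑.^ k) i) (trans (*-congˡ (constant-power a k i)) (scaled i))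
        where
        scaled : ∀ i → a * constant rawRing (a R∑.^ k) i ≈ constant rawRing (a * a R∑.^ k) i
        scaled zero    = refl
        scaled (suc i) = zeroʳ a

-- Equidistribution of the two statistics on words of a fixed length

module EquidistributedStatistics where
  open import Defs using (constant; indeterminate)
  open IntegerSolver
  open Summation
  open Tokens
  open LetterElimination
  open WordStatistic
  open SeriesRings
  open import Algebra.Bundles using (CommutativeRing)
  open import Data.List.Base as List using (List; length)
  open import Data.Nat.Base as ℕ using (ℕ; zero; suc; _<_; z≤n; s≤s; _∸_; _≡ᵇ_; _/_)
  import Data.Nat.Properties as ℕ
  import Data.Nat.DivMod as ℕ
  import Data.Nat.Divisibility as ℕ using ()
  open import Data.Empty using (⊥-elim)
  open import Data.Nat.ListAction using (sum)
  open import Data.Unit.Base using (⊤; tt)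
  open import Relation.Binary.PropositionalEquality as ≡ using (_≡_)

  module Equidistribution {c ℓ} (R : CommutativeRing c ℓ) (r′ t′ n f : ℕ) where
    open Statistic r′ using (stat)
    private
      r t : ℕ
      r = suc r′
      t = suc t′
      module R∑ = FiniteSums R

    private
      M = suc n
      P = PowerSeries.series R
      module P = CommutativeRing P
      module PC = PowerSeries.Coefficients R P.isCommutativeRing (λ _ → ⊤) (λ _ → tt) (λ eq i _ → eq i)
      module P∑ = FiniteSums P
      -- `u` marks the length of a word and `q` its statistic; the degrees in `u` up to `n` are
      -- kept.
      S = PowerSeries.truncated P M
      module SC = PowerSeries.Coefficients P (CommutativeRing.isCommutativeRing S) (_< M) ℕ.<⇒≤ (λ eq i → eq i)
      u = indeterminate P.rawRing
      q₀ = indeterminate (CommutativeRing.rawRing R)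
      q = constant P.rawRing q₀
      module S∑ = FiniteSums S
    open CommutativeRing S

    private
      u^M≈0 : u S∑.^ M ≈ 0#
      u^M≈0 i i<M = P.trans (sym (*-identityʳ (u S∑.^ M)) i i<M) (SC.power-low M 1# i i<M i<M)

      K = suc (r ℕ.* t)

      -- The summand of a word is a power of `u` given by its length, times a series constant in
      -- `u`; only length `n` reaches the coefficient of degree `n`.
      extract : ∀ (g : List ℕ → ℕ) → S∑.∑< M (λ m → S∑.∑words (S∑.∑< K) m (λ w → u S∑.^ length w * q S∑.^ g w)) n P.≈
                P∑.∑words (P∑.∑< K) n (λ w → q₀ P∑.^ g w)
      extract g = P.trans (P.reflexive (SC.∑-coefficient M (λ m → S∑.∑words (S∑.∑< K) m F) n))
          (P.trans (P∑.∑-last n (λ m → S∑.∑words (S∑.∑< K) m F n))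
          (P.trans (P.+-cong (P∑.∑-zero< n λ m m<n → P.trans (SC.∑words-coefficient K m F n) (P.trans
              (P∑.∑words-cong (P∑.∑-linear K) m {λ w → F w n} {λ _ → P.0#} λ w |w|≡m → high w m m<n |w|≡m)
              (P∑.Linear.vanish (P∑.∑words-linear (P∑.∑-linear K) m) {λ _ → P.0#} λ _ → P.refl {P.0#})))
            (P.trans (SC.∑words-coefficient K n F n) (P∑.∑words-cong (P∑.∑-linear K) n {λ w → F w n} {λ w → q₀ P∑.^ g w} exact)))
          (P.+-identityˡ (P∑.∑words (P∑.∑< K) n (λ w → q₀ P∑.^ g w)))))
        where
        F : List ℕ → Carrier
        F w = u S∑.^ length w * q S∑.^ g w
        shifted : ∀ w k → length w ℕ.+ k ≡ n → (u S∑.^ length w * q S∑.^ g w) n P.≈ (q S∑.^ g w) k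
        shifted w k eq = ≡.subst (λ m → (u S∑.^ length w * q S∑.^ g w) m P.≈ (q S∑.^ g w) k) eq
          (SC.power-shift (length w) (q S∑.^ g w) k (≡.subst (_< M) (≡.sym eq) ℕ.≤-refl))
        exact : ∀ w → length w ≡ n → (u S∑.^ length w * q S∑.^ g w) n P.≈ q₀ P∑.^ g w
        exact w |w|≡n = P.trans (shifted w 0 (≡.trans (ℕ.+-identityʳ _) |w|≡n)) (SC.constant-power q₀ (g w) 0)
        high : ∀ w m → m < n → length w ≡ m → (u S∑.^ length w * q S∑.^ g w) n P.≈ P.0#
        high w m m<n |w|≡m with n ∸ length w in eq
        ... | zero  = ⊥-elim (ℕ.<⇒≱ (≡.subst (_< n) (≡.sym |w|≡m) m<n) (ℕ.m∸n≡0⇒m≤n eq))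
        ... | suc k = P.trans (shifted w (suc k) (≡.trans (≡.cong (length w ℕ.+_) (≡.sym eq)) (ℕ.m+[n∸m]≡n (ℕ.<⇒≤ (≡.subst (_< n) (≡.sym |w|≡m) m<n)))))
                        (SC.constant-power q₀ (g w) (suc k))

    equidistributed : CommutativeRing._≈_ R
      (R∑.∑words (R∑.∑< K) n (λ w → R∑.ind (stat w ≡ᵇ f)))
      (R∑.∑words (R∑.∑< K) n (λ w → R∑.ind ((sum w ∸ 1) / t ≡ᵇ f)))
    equidistributed = R.trans (R.sym (coefficient stat)) (R.trans
        (P.trans (P.sym (extract stat)) (P.trans (Elimination.Windings.total S u M u^M≈0 (s≤s z≤n) q r′ t′ n ℕ.≤-refl) (extract (λ w → (sum w ∸ 1) / t))) f)
        (coefficient (λ w → (sum w ∸ 1) / t)))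
      where
      module R = CommutativeRing R
      coefficient : ∀ g → P∑.∑words (P∑.∑< K) n (λ w → q₀ P∑.^ g w) f R.≈ R∑.∑words (R∑.∑< K) n (λ w → R∑.ind (g w ≡ᵇ f))
      coefficient g = R.trans (PC.∑words-coefficient K n (λ w → q₀ P∑.^ g w) f) (R∑.∑words-cong (R∑.∑-linear K) n λ w _ → PC.power-coefficient (g w) f)

-- Chains compatible with the descents of a colored permutation

module ChainEnumeration where
  open import Defs using (words)
  open IntegerSolver
  open Summation
  open Tokens using (+-≡ᵇ-cancelˡ)
  open import Algebra.Bundles using (CommutativeRing)
  open import Data.Bool.Base using (Bool; true; false; if_then_else_; _∨_; _∧_; not)
  open import Data.Fin.Base as Fin using (Fin; zero; suc; toℕ)
  import Data.Fin.Properties as Fin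
  open import Data.List.Base as List using (List; []; _∷_; _++_; allFin; filter; cartesianProductWith)
  open import Data.List.Relation.Binary.Permutation.Propositional as ↭ using (_↭_)
  open import Data.Nat.Base as ℕ using (ℕ; zero; suc; _≤_; _<_; s≤s; _≡ᵇ_; _<ᵇ_; _∸_; _%_; NonZero)
  import Data.Nat.Properties as ℕ
  import Data.Nat.DivMod as ℕ
  open import Data.Nat.DivMod using (_mod_)
  open import Data.Vec.Base as Vec using (Vec; []; _∷_)
  open import Function.Base using (_∘_; id)
  open import Relation.Binary.Definitions using (tri<; tri≈; tri>)
  open import Relation.Binary.PropositionalEquality as ≡ using (_≡_)
  open import Relation.Nullary using (does; yes; no)
  open import Relation.Nullary.Decidable using (dec-true; dec-false)
  open import Relation.Unary using (Decidable)

  module ListSums {c ℓ} (S : CommutativeRing c ℓ) where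
    open CommutativeRing S hiding (zero)
    open FiniteSums S
    open import Relation.Binary.Reasoning.Setoid setoid

    ∑ₗ : {A : Set} → List A → (A → Carrier) → Carrier
    ∑ₗ []       f = 0#
    ∑ₗ (a ∷ as) f = f a + ∑ₗ as f

    ∑ₗ-linear : {A : Set} (as : List A) → Linear (∑ₗ as)
    ∑ₗ-linear as = record { cong = cong as ; add = add as ; scale = scale as }
      where
      cong : ∀ as {f g} → (∀ a → f a ≈ g a) → ∑ₗ as f ≈ ∑ₗ as g
      cong []       eq = refl
      cong (a ∷ as) eq = +-cong (eq a) (cong as eq)
      add : ∀ as f g → ∑ₗ as (λ a → f a + g a) ≈ ∑ₗ as f + ∑ₗ as g
      add []       f g = sym (+-identityˡ 0#)
      add (a ∷ as) f g = trans (+-congˡ (add as f g))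
        (Identities.+-interchange S _ _ _ _)
      scale : ∀ as k f → ∑ₗ as (λ a → k * f a) ≈ k * ∑ₗ as f
      scale []       k f = sym (zeroʳ k)
      scale (a ∷ as) k f = trans (+-congˡ (scale as k f)) (sym (distribˡ k _ _))

    ∑ₗ-++ : {A : Set} (as bs : List A) (f : A → Carrier) → ∑ₗ (as ++ bs) f ≈ ∑ₗ as f + ∑ₗ bs f
    ∑ₗ-++ []       bs f = sym (+-identityˡ _)
    ∑ₗ-++ (a ∷ as) bs f = trans (+-congˡ (∑ₗ-++ as bs f)) (sym (+-assoc _ _ _))

    ∑ₗ-map : {A B : Set} (g : A → B) (as : List A) (f : B → Carrier) → ∑ₗ (List.map g as) f ≡ ∑ₗ as (f ∘ g)
    ∑ₗ-map g []       f = ≡.refl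
    ∑ₗ-map g (a ∷ as) f = ≡.cong (λ s → f (g a) + s) (∑ₗ-map g as f)

    ∑ₗ-product : {A B C : Set} (g : A → B → C) (as : List A) (bs : List B) (f : C → Carrier) →
      ∑ₗ (cartesianProductWith g as bs) f ≈ ∑ₗ as (λ a → ∑ₗ bs (λ b → f (g a b)))
    ∑ₗ-product g []       bs f = refl
    ∑ₗ-product g (a ∷ as) bs f = trans (∑ₗ-++ (List.map (g a) bs) _ f)
      (+-cong (reflexive (∑ₗ-map (g a) bs f)) (∑ₗ-product g as bs f))

    ∑ₗ-filter : {A : Set} {P : A → Set} (P? : Decidable P) (as : List A) (f : A → Carrier) →
      ∑ₗ (filter P? as) f ≈ ∑ₗ as (λ a → ind (does (P? a)) * f a)
    ∑ₗ-filter P? []       f = refl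
    ∑ₗ-filter P? (a ∷ as) f with does (P? a)
    ... | true  = +-cong (sym (*-identityˡ _)) (∑ₗ-filter P? as f)
    ... | false = trans (∑ₗ-filter P? as f) (trans (sym (+-identityˡ _)) (+-congʳ (sym (zeroˡ _))))

    ∑ₗ-↭ : {A : Set} {as bs : List A} → as ↭ bs → (f : A → Carrier) → ∑ₗ as f ≈ ∑ₗ bs f
    ∑ₗ-↭ ↭.refl          f = refl
    ∑ₗ-↭ (↭.prep a p)    f = +-congˡ (∑ₗ-↭ p f)
    ∑ₗ-↭ (↭.swap a b p)  f = trans (+-congˡ (+-congˡ (∑ₗ-↭ p f)))
      (Identities.+-swap S _ _ _)
    ∑ₗ-↭ (↭.trans p q)   f = trans (∑ₗ-↭ p f) (∑ₗ-↭ q f)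

    ∑ₗ-allFin : ∀ n (f : ℕ → Carrier) → ∑ₗ (allFin n) (f ∘ toℕ) ≈ ∑< n f
    ∑ₗ-allFin n f = go n id f (λ _ → ≡.refl)
      where
      go : ∀ n {m} (g : Fin n → Fin m) (f : ℕ → Carrier) {h : Fin m → Carrier} →
           (∀ i → h (g i) ≡ f (toℕ i)) → ∑ₗ (List.tabulate g) h ≈ ∑< n f
      go zero    g f eq = refl
      go (suc n) g f eq = +-cong (reflexive (eq zero)) (go n (g ∘ suc) (f ∘ suc) (λ i → eq (suc i)))

    ∑-truncate : ∀ m n {f g} → m ≤ n → (∀ i → i < m → f i ≈ g i) → (∀ i → m ≤ i → f i ≈ 0#) → ∑< n f ≈ ∑< m g
    ∑-truncate m n {f} {g} m≤n eq high = begin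
      ∑< n f                                          ≡⟨ ≡.cong (λ k → ∑< k f) (≡.sym (ℕ.m+[n∸m]≡n m≤n)) ⟩
      ∑< (m ℕ.+ (n ∸ m)) f                            ≈⟨ ∑-split m (n ∸ m) f ⟩
      ∑< m f + ∑< (n ∸ m) (λ i → f (m ℕ.+ i))         ≈⟨ +-cong (∑-cong< m eq) (∑-zero< (n ∸ m) λ i _ → high _ (ℕ.m≤m+n m i)) ⟩
      ∑< m g + 0#                                     ≈⟨ +-identityʳ _ ⟩
      ∑< m g                                          ∎

  -- `descent` is the condition counted by `des*`. `allowed` is the condition for letter `e` from
  -- place `s` to follow letter `e₀` from place `s₀` in a stable sort into decreasing order.
  descent allowed : ℕ → ℕ → ℕ → ℕ → Bool
  descent c₀ s₀ c s = (c₀ <ᵇ c) ∨ ((c₀ ≡ᵇ c) ∧ (s <ᵇ s₀))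
  allowed e₀ s₀ e s = (e <ᵇ e₀) ∨ ((e₀ ≡ᵇ e) ∧ not (s <ᵇ s₀))

  descents : ∀ {n} → ℕ → ℕ → Vec ℕ n → Vec ℕ n → List Bool
  descents c₀ s₀ []       []       = []
  descents c₀ s₀ (c ∷ cs) (s ∷ ss) = descent c₀ s₀ c s ∷ descents c s cs ss

  chain : ∀ {n} → ℕ → ℕ → Vec ℕ n → Vec ℕ n → Bool
  chain e₀ s₀ []       []       = true
  chain e₀ s₀ (e ∷ es) (s ∷ ss) = allowed e₀ s₀ e s ∧ chain e s es ss

  -- Letters `g * r + c` are compared first by `g` and then by colour. For equal `g`, `allowed` is
  -- the negation of `descent`; so a descent is exactly what forces `g` to drop strictly.
  allowed-descent : ∀ r g₀ c₀ s₀ g c s → c₀ < r → c < r →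
    allowed (g₀ ℕ.* r ℕ.+ c₀) s₀ (g ℕ.* r ℕ.+ c) s ≡ (g <ᵇ (if descent c₀ s₀ c s then g₀ else suc g₀))
  allowed-descent r g₀ c₀ s₀ g c s c₀<r c<r with ℕ.<-cmp g g₀
  ... | tri< g<g₀ _ _ = ≡.trans (≡.cong (_∨ ((g₀ ℕ.* r ℕ.+ c₀ ≡ᵇ g ℕ.* r ℕ.+ c) ∧ not (s <ᵇ s₀))) (dec-true (_ ℕ.<? _) (block g g₀ c c₀ g<g₀ c<r))) (≡.sym (below (descent c₀ s₀ c s)))
    where
    block : ∀ g g₀ c c₀ → g < g₀ → c < r → g ℕ.* r ℕ.+ c < g₀ ℕ.* r ℕ.+ c₀
    block g g₀ c c₀ g<g₀ c<r = ℕ.<-≤-trans (ℕ.+-monoʳ-< (g ℕ.* r) c<r) (ℕ.≤-trans (ℕ.≤-reflexive (ℕ.+-comm (g ℕ.* r) r))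
      (ℕ.≤-trans (ℕ.*-monoˡ-≤ r g<g₀) (ℕ.m≤m+n _ _)))
    below : ∀ d → (g <ᵇ (if d then g₀ else suc g₀)) ≡ true
    below true  = dec-true (g ℕ.<? g₀) g<g₀
    below false = dec-true (g ℕ.<? suc g₀) (ℕ.m<n⇒m<1+n g<g₀)
  ... | tri> _ _ g>g₀ = ≡.trans (≡.cong₂ (λ a b → a ∨ (b ∧ not (s <ᵇ s₀)))
          (dec-false (_ ℕ.<? _) (ℕ.<⇒≯ block)) (dec-false (_ ℕ.≟ _) (ℕ.<⇒≢ block))) (≡.sym (above (descent c₀ s₀ c s)))
    where
    block : g₀ ℕ.* r ℕ.+ c₀ < g ℕ.* r ℕ.+ c
    block = ℕ.<-≤-trans (ℕ.+-monoʳ-< (g₀ ℕ.* r) c₀<r) (ℕ.≤-trans (ℕ.≤-reflexive (ℕ.+-comm (g₀ ℕ.* r) r))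
      (ℕ.≤-trans (ℕ.*-monoˡ-≤ r g>g₀) (ℕ.m≤m+n _ _)))
    above : ∀ d → (g <ᵇ (if d then g₀ else suc g₀)) ≡ false
    above true  = dec-false (g ℕ.<? g₀) (ℕ.<⇒≯ g>g₀)
    above false = dec-false (g ℕ.<? suc g₀) (ℕ.≤⇒≯ g>g₀)
  ... | tri≈ _ ≡.refl _ = ≡.trans same (≡.sym (equal (descent c₀ s₀ c s)))
    where
    equal : ∀ d → (g <ᵇ (if d then g else suc g)) ≡ not d
    equal true  = dec-false (g ℕ.<? g) (ℕ.<-irrefl ≡.refl)
    equal false = dec-true (g ℕ.<? suc g) ℕ.≤-refl
    <ᵇ-cancel : ∀ a m n → (a ℕ.+ m <ᵇ a ℕ.+ n) ≡ (m <ᵇ n)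
    <ᵇ-cancel zero    m n = ≡.refl
    <ᵇ-cancel (suc a) m n = <ᵇ-cancel a m n
    same : allowed (g ℕ.* r ℕ.+ c₀) s₀ (g ℕ.* r ℕ.+ c) s ≡ not (descent c₀ s₀ c s)
    same rewrite <ᵇ-cancel (g ℕ.* r) c c₀ | +-≡ᵇ-cancelˡ (g ℕ.* r) c₀ c with ℕ.<-cmp c c₀
    ... | tri< c<c₀ c≢c₀ _ rewrite dec-true (c ℕ.<? c₀) c<c₀ | dec-false (c₀ ℕ.<? c) (ℕ.<⇒≯ c<c₀) | dec-false (c₀ ℕ.≟ c) (c≢c₀ ∘ ≡.sym) = ≡.refl
    ... | tri≈ _ ≡.refl _ rewrite dec-false (c ℕ.<? c) (ℕ.<-irrefl ≡.refl) | dec-true (c ℕ.≟ c) ≡.refl = ≡.refl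
    ... | tri> _ c≢c₀ c>c₀ rewrite dec-false (c ℕ.<? c₀) (ℕ.<⇒≯ c>c₀) | dec-true (c₀ ℕ.<? c) c>c₀ | dec-false (c₀ ℕ.≟ c) (c≢c₀ ∘ ≡.sym) = ≡.refl

  allowed⇒≤ : ∀ e₀ s₀ e s → e₀ < e → allowed e₀ s₀ e s ≡ false
  allowed⇒≤ e₀ s₀ e s e₀<e rewrite dec-false (e ℕ.<? e₀) (ℕ.<⇒≯ e₀<e) | dec-false (e₀ ℕ.≟ e) (ℕ.<⇒≢ e₀<e) = ≡.refl

  module Chains {c ℓ} (S : CommutativeRing c ℓ) where
    open CommutativeRing S hiding (zero)
    open FiniteSums S
    open ListSums S
    open import Relation.Binary.Reasoning.Setoid setoid

    -- The number of chains t ≥ g₁ ≥ g₂ ≥ … ≥ 0 that are strict at the descents; with g * r + c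
    -- for a letter of colour c, they become the chains of words above.
    chainCount : ℕ → List Bool → Carrier
    chainCount t []       = 1#
    chainCount t (d ∷ ds) = ∑< (if d then t else suc t) (λ g → chainCount g ds)

    module ColourSums (r t : ℕ) .{{_ : NonZero r}} where
      colours : ∀ {m n} → Vec (Fin m) n → Vec (Fin r) n
      colours = Vec.map (λ e → toℕ e mod r)

      -- A colour and a chain entry are packed into one letter `g * r + c`. By `allowed-descent` the
      -- compatible pairs become the sorted sequences, and the double sum over colours and entries
      -- becomes a sum over blocks of letters.
      sum-chainCount : ∀ {n} (ss : Vec ℕ n) g₀ c₀ s₀ → g₀ ≤ t → c₀ < r → g₀ ℕ.* r ℕ.+ c₀ < suc (r ℕ.* t) → (Ψ : Vec (Fin r) n → Carrier) →
        ∑ₗ (words r n) (λ cs → Ψ cs * chainCount g₀ (descents c₀ s₀ (Vec.map toℕ cs) ss)) ≈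
        ∑ₗ (words (suc (r ℕ.* t)) n) (λ es → ind (chain (g₀ ℕ.* r ℕ.+ c₀) s₀ (Vec.map toℕ es) ss) * Ψ (colours es))
      sum-chainCount []             g₀ c₀ s₀ g₀≤t c₀<r e₀<K Ψ = +-congʳ (*-comm _ _)
      sum-chainCount {suc n} (s ∷ ss) g₀ c₀ s₀ g₀≤t c₀<r e₀<K Ψ = begin
        ∑ₗ (words r (suc n)) (λ cs → Ψ cs * chainCount g₀ (descents c₀ s₀ (Vec.map toℕ cs) (s ∷ ss)))
          ≈⟨ ∑ₗ-product _∷_ (allFin r) (words r n) _ ⟩
        ∑ₗ (allFin r) (λ c → ∑ₗ (words r n) (λ cs → Ψ (c ∷ cs) * ∑< (bound (toℕ c)) (λ g → chainCount g (descents (toℕ c) s (Vec.map toℕ cs) ss))))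
          ≈⟨ Linear.cong (∑ₗ-linear (allFin r)) (λ c → trans (Linear.cong (∑ₗ-linear (words r n)) λ cs → sym (Linear.scale (∑-linear (bound (toℕ c))) (Ψ (c ∷ cs)) _))
               (trans (Linear.∑-swap (∑ₗ-linear (words r n)) (bound (toℕ c)) _)
                 (reflexive (≡.cong (λ c′ → ∑< (bound (toℕ c)) (λ g → ∑ₗ (words r n) (λ cs → Ψ (c′ ∷ cs) * chainCount g (descents (toℕ c) s (Vec.map toℕ cs) ss)))) (≡.sym (toℕ-mod c)))))) ⟩
        ∑ₗ (allFin r) (λ c → ∑< (bound (toℕ c)) (Y (toℕ c)))
          ≈⟨ ∑ₗ-allFin r (λ c → ∑< (bound c) (Y c)) ⟩
        ∑< r (λ c → ∑< (bound c) (Y c))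
          ≈⟨ ∑-cong< r (λ c c<r → sym (∑-truncate (bound c) (suc t) (bound≤ (descent c₀ s₀ c s)) (inside c c<r) (outside c c<r))) ⟩
        ∑< r (λ c → ∑< (suc t) (λ g → V (g ℕ.* r ℕ.+ c)))
          ≈⟨ Linear.∑-swap (∑-linear r) (suc t) (λ c g → V (g ℕ.* r ℕ.+ c)) ⟩
        ∑< (suc t) (λ g → ∑< r (λ c → V (g ℕ.* r ℕ.+ c)))
          ≈⟨ sym (∑-blocks (suc t) r V) ⟩
        ∑< (suc t ℕ.* r) V
          -- The `t + 1` full blocks reach beyond `r * t`; the surplus letters exceed the previous
          -- letter `e₀` and are not allowed.
          ≈⟨ ∑-truncate (suc (r ℕ.* t)) (suc t ℕ.* r) (ℕ.+-mono-≤ (ℕ.>-nonZero⁻¹ r) (ℕ.≤-reflexive (ℕ.*-comm r t))) (λ _ _ → refl)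
               (λ e K≤e → trans (*-congʳ (reflexive (≡.cong ind (allowed⇒≤ e₀ s₀ e s (ℕ.<-≤-trans e₀<K K≤e))))) (zeroˡ (X e))) ⟩
        ∑< (suc (r ℕ.* t)) V
          ≈⟨ sym (∑ₗ-allFin (suc (r ℕ.* t)) V) ⟩
        ∑ₗ (allFin (suc (r ℕ.* t))) (λ e → V (toℕ e))
          ≈⟨ Linear.cong (∑ₗ-linear (allFin (suc (r ℕ.* t)))) (λ e → trans (sym (Linear.scale (∑ₗ-linear (words (suc (r ℕ.* t)) n)) _ _))
               (Linear.cong (∑ₗ-linear (words (suc (r ℕ.* t)) n)) λ es → trans (sym (*-assoc _ _ _)) (*-congʳ (sym (ind-∧ (allowed e₀ s₀ (toℕ e) s) _))))) ⟩
        ∑ₗ (allFin (suc (r ℕ.* t))) (λ e → ∑ₗ (words (suc (r ℕ.* t)) n) (λ es → ind (chain e₀ s₀ (Vec.map toℕ (e ∷ es)) (s ∷ ss)) * Ψ (colours (e ∷ es))))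
          ≈⟨ sym (∑ₗ-product _∷_ (allFin (suc (r ℕ.* t))) (words (suc (r ℕ.* t)) n) _) ⟩
        ∑ₗ (words (suc (r ℕ.* t)) (suc n)) (λ es → ind (chain e₀ s₀ (Vec.map toℕ es) (s ∷ ss)) * Ψ (colours es)) ∎
        where
        e₀ = g₀ ℕ.* r ℕ.+ c₀
        bound : ℕ → ℕ
        bound c = if descent c₀ s₀ c s then g₀ else suc g₀
        bound≤ : ∀ d → (if d then g₀ else suc g₀) ≤ suc t
        bound≤ true  = ℕ.m≤n⇒m≤1+n g₀≤t
        bound≤ false = s≤s g₀≤t
        toℕ-mod : ∀ (c : Fin r) → toℕ c mod r ≡ c
        toℕ-mod c = Fin.toℕ-injective (≡.trans (Fin.toℕ-fromℕ< _) (ℕ.m<n⇒m%n≡m (Fin.toℕ<n c)))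
        ind-∧ : ∀ a b → ind (a ∧ b) ≈ ind a * ind b
        ind-∧ true  b = sym (*-identityˡ _)
        ind-∧ false b = sym (zeroˡ _)
        Y : ℕ → ℕ → Carrier
        Y c g = ∑ₗ (words r n) (λ cs → Ψ (c mod r ∷ cs) * chainCount g (descents c s (Vec.map toℕ cs) ss))
        X V : ℕ → Carrier
        X e = ∑ₗ (words (suc (r ℕ.* t)) n) (λ es → ind (chain e s (Vec.map toℕ es) ss) * Ψ (e mod r ∷ colours es))
        V e = ind (allowed e₀ s₀ e s) * X e
        outside : ∀ c → c < r → ∀ g → bound c ≤ g → V (g ℕ.* r ℕ.+ c) ≈ 0#
        outside c c<r g b≤g = trans (*-congʳ (reflexive (≡.cong ind (≡.trans (allowed-descent r g₀ c₀ s₀ g c s c₀<r c<r)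
          (dec-false (g ℕ.<? bound c) (ℕ.≤⇒≯ b≤g)))))) (zeroˡ _)
        inside : ∀ c → c < r → ∀ g → g < bound c → V (g ℕ.* r ℕ.+ c) ≈ Y c g
        inside c c<r g g<b = trans (*-congʳ (reflexive (≡.cong ind ok))) (trans (*-identityˡ _)
            (trans (Linear.cong (∑ₗ-linear (words (suc (r ℕ.* t)) n)) λ es → *-congˡ (reflexive (≡.cong (λ c′ → Ψ (c′ ∷ colours es)) mod≡)))
              (sym (sum-chainCount ss g c s g≤t c<r e<K (λ cs → Ψ (c mod r ∷ cs))))))
          where
          ok : allowed e₀ s₀ (g ℕ.* r ℕ.+ c) s ≡ true
          ok = ≡.trans (allowed-descent r g₀ c₀ s₀ g c s c₀<r c<r) (dec-true (g ℕ.<? bound c) g<b)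
          g≤t : g ≤ t
          g≤t = ℕ.≤-pred (ℕ.≤-trans g<b (bound≤ (descent c₀ s₀ c s)))
          e<K : g ℕ.* r ℕ.+ c < (suc (r ℕ.* t))
          e<K with (g ℕ.* r ℕ.+ c) ℕ.≤? e₀
          ... | yes e≤e₀ = ℕ.≤-<-trans e≤e₀ e₀<K
          ... | no  e≰e₀ with () ← ≡.trans (≡.sym ok) (allowed⇒≤ e₀ s₀ _ s (ℕ.≰⇒> e≰e₀))
          mod≡ : (g ℕ.* r ℕ.+ c) mod r ≡ c mod r
          mod≡ = Fin.toℕ-injective (≡.trans (Fin.toℕ-fromℕ< _) (≡.trans (≡.cong (_% r) (ℕ.+-comm (g ℕ.* r) c))
            (≡.trans (ℕ.[m+kn]%n≡m%n c g r) (≡.sym (Fin.toℕ-fromℕ< _)))))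

-- Generating series of chains and the flag descent number

module DescentSeries where
  open import Defs using (#_; des*; fdes*; ⌈_/_⌉; indeterminate)
  open IntegerSolver
  open Summation
  open Tokens using (count)
  open SeriesRings
  open ChainEnumeration
  open import Algebra.Bundles using (CommutativeRing)
  open import Data.Bool.Base using (Bool; true; false; if_then_else_; _∨_; _∧_)
  open import Data.Fin.Base as Fin using (Fin; zero; suc; toℕ; inject₁)
  import Data.Fin.Properties as Fin
  open import Data.List.Base as List using (List; []; _∷_; length; filter)
  open import Data.Nat.Base as ℕ using (ℕ; zero; suc; _<_; z≤n; s≤s; _≡ᵇ_; _<ᵇ_; _/_)
  import Data.Nat.Properties as ℕ
  import Data.Nat.DivMod as ℕ
  import Data.Nat.Divisibility as ℕ using (∣-refl; m∣m*n)
  open import Data.Product.Base using (_,_)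
  open import Data.Unit.Base using (⊤; tt)
  open import Data.Vec.Base as Vec using (Vec; []; _∷_; lookup)
  open import Function.Base using (_∘_; id)
  open import Relation.Binary.PropositionalEquality as ≡ using (_≡_)
  open import Relation.Nullary using (does)
  open import Relation.Unary using (Decidable; Pred)
  open import Level using (0ℓ)

  boolSum : ∀ {n} → (Fin n → Bool) → ℕ
  boolSum {zero}  p = 0
  boolSum {suc n} p = (if p zero then 1 else 0) ℕ.+ boolSum (p ∘ suc)

  boolSum-cong : ∀ {n} {p q : Fin n → Bool} → (∀ i → p i ≡ q i) → boolSum p ≡ boolSum q
  boolSum-cong {zero}  eq = ≡.refl
  boolSum-cong {suc n} eq = ≡.cong₂ (λ b k → (if b then 1 else 0) ℕ.+ k) (eq zero) (boolSum-cong (eq ∘ suc))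

  #≡boolSum : ∀ {n} {P : Pred (Fin n) 0ℓ} (P? : Decidable P) → # P? ≡ boolSum (does ∘ P?)
  #≡boolSum P? = go P? id
    where
    go : ∀ {n m} {P : Pred (Fin m) 0ℓ} (P? : Decidable P) (f : Fin n → Fin m) →
         length (filter P? (List.tabulate f)) ≡ boolSum (does ∘ P? ∘ f)
    go {zero}  P? f = ≡.refl
    go {suc n} P? f with does (P? (f zero))
    ... | true  = ≡.cong suc (go P? (f ∘ suc))
    ... | false = go P? (f ∘ suc)

  does-≟ : ∀ {n} (i j : Fin n) → does (i Fin.≟ j) ≡ (toℕ i ≡ᵇ toℕ j)
  does-≟ zero    zero    = ≡.refl
  does-≟ zero    (suc j) = ≡.refl
  does-≟ (suc i) zero    = ≡.refl
  does-≟ (suc i) (suc j) = does-≟ i j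

  count-true : List Bool → ℕ
  count-true = count id

  count-descents : ∀ {r N n} (c : Vec (Fin r) (suc n)) (σ : Vec (Fin N) (suc n)) →
    boolSum (λ i → descent (toℕ (lookup c (inject₁ i))) (toℕ (lookup σ (inject₁ i))) (toℕ (lookup c (suc i))) (toℕ (lookup σ (suc i)))) ≡
    count-true (descents (toℕ (Vec.head c)) (toℕ (Vec.head σ)) (Vec.map toℕ (Vec.tail c)) (Vec.map toℕ (Vec.tail σ)))
  count-descents (c ∷ [])       (s ∷ [])       = ≡.refl
  count-descents (c ∷ c₁ ∷ cs) (s ∷ s₁ ∷ ss) with descent (toℕ c) (toℕ s) (toℕ c₁) (toℕ s₁)
  ... | true  = ≡.cong suc (count-descents (c₁ ∷ cs) (s₁ ∷ ss))
  ... | false = count-descents (c₁ ∷ cs) (s₁ ∷ ss)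

  des*-count : ∀ {r n} (σ : Vec (Fin (suc n)) (suc n)) (c : Vec (Fin r) (suc n)) →
    des* (σ , c) ≡ count-true (descents (toℕ (Vec.head c)) (toℕ (Vec.head σ)) (Vec.map toℕ (Vec.tail c)) (Vec.map toℕ (Vec.tail σ)))
  des*-count {n = n} σ c = ≡.trans (#≡boolSum {n} _) (≡.trans (boolSum-cong {n} λ i →
      ≡.cong (λ b → (toℕ (lookup c (inject₁ i)) <ᵇ toℕ (lookup c (suc i))) ∨ (b ∧ (toℕ (lookup σ (suc i)) <ᵇ toℕ (lookup σ (inject₁ i)))))
        (does-≟ (lookup c (inject₁ i)) (lookup c (suc i))))
    (count-descents c σ))

  -- Since the first colour is less than `r`, rounding up adds 1 to `des*` exactly if that colour is
  -- positive, that is, for a descent after an artificial first letter of colour 0 and value 0.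
  ceiling-fdes* : ∀ r′ {n} (let r = suc r′) (σ : Vec (Fin (suc n)) (suc n)) (c : Vec (Fin r) (suc n)) →
    ⌈ fdes* (σ , c) / r ⌉ ≡ count-true (descents 0 0 (Vec.map toℕ c) (Vec.map toℕ σ))
  ceiling-fdes* r′ σ@(s ∷ ss) c@(c₁ ∷ cs) = begin
    (r ℕ.* des* (σ , c) ℕ.+ toℕ c₁ ℕ.+ r′) / r        ≡⟨ ≡.cong (_/ r) (ℕ.+-assoc (r ℕ.* des* (σ , c)) (toℕ c₁) r′) ⟩
    (r ℕ.* des* (σ , c) ℕ.+ (toℕ c₁ ℕ.+ r′)) / r      ≡⟨ ℕ.+-distrib-/-∣ˡ {r ℕ.* des* (σ , c)} (toℕ c₁ ℕ.+ r′) (ℕ.m∣m*n (des* (σ , c))) ⟩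
    r ℕ.* des* (σ , c) / r ℕ.+ (toℕ c₁ ℕ.+ r′) / r    ≡⟨ ≡.cong₂ ℕ._+_ (≡.trans (≡.cong (_/ r) (ℕ.*-comm r (des* (σ , c)))) (ℕ.m*n/n≡m (des* (σ , c)) r)) (first (toℕ c₁) (Fin.toℕ<n c₁)) ⟩
    des* (σ , c) ℕ.+ (if descent 0 0 (toℕ c₁) (toℕ s) then 1 else 0)  ≡⟨ ≡.cong (ℕ._+ (if descent 0 0 (toℕ c₁) (toℕ s) then 1 else 0)) (des*-count σ c) ⟩
    count-true ds ℕ.+ (if descent 0 0 (toℕ c₁) (toℕ s) then 1 else 0) ≡⟨ cons (descent 0 0 (toℕ c₁) (toℕ s)) ⟩
    count-true (descent 0 0 (toℕ c₁) (toℕ s) ∷ ds)    ∎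
    where
    open ≡.≡-Reasoning
    r = suc r′
    ds = descents (toℕ c₁) (toℕ s) (Vec.map toℕ cs) (Vec.map toℕ ss)
    first : ∀ m → m < r → (m ℕ.+ r′) / r ≡ (if descent 0 0 m (toℕ s) then 1 else 0)
    first zero    _   = ℕ.m<n⇒m/n≡0 {r′} {r} ℕ.≤-refl
    first (suc m) m<r = begin
      (suc m ℕ.+ r′) / r         ≡⟨ ≡.cong (_/ r) (≡.sym (ℕ.+-suc m r′)) ⟩
      (m ℕ.+ r) / r              ≡⟨ ≡.cong (_/ r) (ℕ.+-comm m r) ⟩
      (r ℕ.+ m) / r              ≡⟨ ℕ.+-distrib-/-∣ˡ {r} m ℕ.∣-refl ⟩
      r / r ℕ.+ m / r            ≡⟨ ≡.cong₂ ℕ._+_ (ℕ.n/n≡1 r) (ℕ.m<n⇒m/n≡0 (ℕ.<⇒≤ m<r)) ⟩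
      1                          ∎
    cons : ∀ d → count-true ds ℕ.+ (if d then 1 else 0) ≡ count-true (d ∷ ds)
    cons true  = ℕ.+-comm _ 1
    cons false = ℕ.+-identityʳ _

  module ChainSeries {c ℓ} (R : CommutativeRing c ℓ) where
    private
      Z = PowerSeries.series R
      module R = CommutativeRing R
      module R∑ = FiniteSums R
    open CommutativeRing Z hiding (zero)
    open FiniteSums Z
    open Chains R
    private
      module L = ListSums Z
      module RL = ListSums R
    open import Relation.Binary.Reasoning.Setoid setoid

    z₀ : Carrier
    z₀ = indeterminate R.rawRing

    difference : ∀ (F : Carrier) → (∀ G → (∀ i → G (suc i) R.≈ F (suc i) R.- F i) → G 0 R.≈ F 0 → (1# - z₀) * F ≈ G)
    difference F G step start i = R.trans (Identities.1-*-expand Z z₀ F i) (go i)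
      where
      go : ∀ i → (F - z₀ * F) i R.≈ G i
      go zero    = R.trans (R.+-congˡ (R.-‿cong (PowerSeries.indeterminate-⊛-zero R F))) (R.trans (Identities.-0# R (F 0)) (R.sym start))
      go (suc i) = R.trans (R.+-congˡ (R.-‿cong (PowerSeries.indeterminate-⊛-suc R F i))) (R.sym (step i))

    chainSeries : List Bool → Carrier
    chainSeries ds t = chainCount t ds

    -- Multiplication by `1 - z₀` takes differences in `t`, and successive sums differ by their last
    -- term. That term has index `t` for a weak step and `t - 1` for a strict one, hence the factor
    -- `z₀`.
    chainSeries-cons : ∀ d ds → (1# - z₀) * chainSeries (d ∷ ds) ≈ z₀ ^ (if d then 1 else 0) * chainSeries ds
    chainSeries-cons true ds = difference (chainSeries (true ∷ ds)) _
      (λ i → R.trans (SC.power-shift 1 (chainSeries ds) i tt) (R.sym (R.trans (R.+-congʳ (R∑.∑-last i (λ g → chainCount g ds)))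
        (Identities.+-cancelˡ R _ _))))
      (SC.power-low 1 (chainSeries ds) 0 tt (s≤s z≤n))
      where module SC = PowerSeries.Coefficients R isCommutativeRing (λ _ → ⊤) (λ _ → tt) (λ eq i _ → eq i)
    chainSeries-cons false ds = difference (chainSeries (false ∷ ds)) _
      (λ i → R.trans (*-identityˡ (chainSeries ds) (suc i)) (R.sym (R.trans (R.+-congʳ (R∑.∑-last (suc i) (λ g → chainCount g ds)))
        (Identities.+-cancelˡ R _ _))))
      (R.trans (*-identityˡ (chainSeries ds) 0) (R.sym (R.+-identityʳ _)))

    chainSeries-closed : ∀ ds → (1# - z₀) ^ suc (length ds) * chainSeries ds ≈ z₀ ^ count-true ds
    chainSeries-closed []       = trans (*-congʳ {chainSeries []} {(1# - z₀) * 1#} {1# - z₀} (*-identityʳ (1# - z₀))) (difference (chainSeries []) 1#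
      (λ i → R.sym (R.-‿inverseʳ R.1#)) R.refl)
    chainSeries-closed (d ∷ ds) = begin
      (1# - z₀) ^ suc (suc n) * chainSeries (d ∷ ds)
        ≈⟨ Identities.*-rotate Z (1# - z₀) ((1# - z₀) ^ suc n) (chainSeries (d ∷ ds)) ⟩
      (1# - z₀) ^ suc n * ((1# - z₀) * chainSeries (d ∷ ds))
        ≈⟨ *-congˡ {(1# - z₀) ^ suc n} (chainSeries-cons d ds) ⟩
      (1# - z₀) ^ suc n * (z₀ ^ (if d then 1 else 0) * chainSeries ds)
        ≈⟨ Identities.*-swap Z ((1# - z₀) ^ suc n) (z₀ ^ (if d then 1 else 0)) (chainSeries ds) ⟩
      z₀ ^ (if d then 1 else 0) * ((1# - z₀) ^ suc n * chainSeries ds)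
        ≈⟨ *-congˡ {z₀ ^ (if d then 1 else 0)} (chainSeries-closed ds) ⟩
      z₀ ^ (if d then 1 else 0) * z₀ ^ count-true ds
        ≈⟨ last d ⟩
      z₀ ^ count-true (d ∷ ds) ∎
      where
      n = length ds
      last : ∀ d → z₀ ^ (if d then 1 else 0) * z₀ ^ count-true ds ≈ z₀ ^ count-true (d ∷ ds)
      last true  = *-congʳ {z₀ ^ count-true ds} {z₀ * 1#} {z₀} (*-identityʳ z₀)
      last false = *-identityˡ (z₀ ^ count-true ds)

-- Polynomial sequences by finite differences; words sorted by their zeros

module PolynomialSequences where
  open Summation
  open IntegerSolver
  open ChainEnumeration
  open import Algebra.Bundles using (CommutativeRing)
  open import Data.Bool.Base using (true; false)
  open import Data.Integer.Base using (1ℤ; 0ℤ)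
  open import Data.List.Base as List using (List; []; _∷_)
  open import Data.Nat.Base as ℕ using (ℕ; zero; suc; _<_; z≤n; s≤s; _∸_)
  open import Data.Nat.Combinatorics as ℕ using (nCk+nC[k+1]≡[n+1]C[k+1]; k>n⇒nCk≡0)
  open import Data.Nat.ListAction using (sum)
  import Data.Nat.Properties as ℕ
  open import Data.Product.Base using (_,_; ∃)
  open import Function.Base using (_∘_)
  open import Relation.Binary.PropositionalEquality as ≡ using (_≡_)

  module Differences {c ℓ} (R : CommutativeRing c ℓ) where
    open CommutativeRing R hiding (zero)
    open RingSolver R
    open FiniteSums R
    open ListSums R
    open Chains R
    open import Relation.Binary.Reasoning.Setoid setoid

    Δ : (ℕ → Carrier) → ℕ → Carrier
    Δ f t = f (suc t) - f t

    Δ^ : ℕ → (ℕ → Carrier) → ℕ → Carrier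
    Δ^ zero    f = f
    Δ^ (suc K) f = Δ^ K (Δ f)

    -- This form needs no coefficients: it suits iterated sums such as `chainCount` and gives
    -- extrapolation to 0 directly.
    IsPolynomial : (ℕ → Carrier) → Set ℓ
    IsPolynomial f = ∃ λ K → ∀ t → Δ^ K f t ≈ 0#

    Δ-cong : ∀ {f g} → (∀ t → f t ≈ g t) → ∀ t → Δ f t ≈ Δ g t
    Δ-cong eq t = +-cong (eq (suc t)) (-‿cong (eq t))

    Δ^-cong : ∀ K {f g} → (∀ t → f t ≈ g t) → ∀ t → Δ^ K f t ≈ Δ^ K g t
    Δ^-cong zero    eq = eq
    Δ^-cong (suc K) eq = Δ^-cong K (Δ-cong eq)

    Δ^-+ : ∀ K f g t → Δ^ K (λ t → f t + g t) t ≈ Δ^ K f t + Δ^ K g t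
    Δ^-+ zero    f g t = refl
    Δ^-+ (suc K) f g t = trans (Δ^-cong K (λ t → solve 4 (λ a b c d → (a :+ b) :- (c :+ d) := (a :- c) :+ (b :- d)) refl (f (suc t)) (g (suc t)) (f t) (g t)) t)
      (Δ^-+ K (Δ f) (Δ g) t)

    Δ^-scale : ∀ K k f t → Δ^ K (λ t → k * f t) t ≈ k * Δ^ K f t
    Δ^-scale zero    k f t = refl
    Δ^-scale (suc K) k f t = trans (Δ^-cong K (λ t → solve 3 (λ k a b → k :* a :- k :* b := k :* (a :- b)) refl k (f (suc t)) (f t)) t)
      (Δ^-scale K k (Δ f) t)

    Δ^-shift : ∀ K f t → Δ^ K (f ∘ suc) t ≈ Δ^ K f (suc t)
    Δ^-shift zero    f t = refl
    Δ^-shift (suc K) f t = Δ^-shift K (Δ f) t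

    Δ^-raise : ∀ m K f → (∀ t → Δ^ K f t ≈ 0#) → ∀ t → Δ^ (m ℕ.+ K) f t ≈ 0#
    Δ^-raise zero    K f vanish = vanish
    Δ^-raise (suc m) K f vanish = Δ^-raise m K (Δ f) (λ t → trans (step K f t) (trans (+-cong (vanish (suc t)) (-‿cong (vanish t))) (-‿inverseʳ 0#)))
      where
      step : ∀ K f t → Δ^ K (Δ f) t ≈ Δ^ K f (suc t) - Δ^ K f t
      step zero    f t = refl
      step (suc K) f t = step K (Δ f) t

    polynomial-cong : ∀ {f g} → (∀ t → f t ≈ g t) → IsPolynomial f → IsPolynomial g
    polynomial-cong eq (K , vanish) = K , λ t → trans (sym (Δ^-cong K eq t)) (vanish t)

    polynomial-+ : ∀ {f g} → IsPolynomial f → IsPolynomial g → IsPolynomial (λ t → f t + g t)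
    polynomial-+ {f} {g} (K , f-vanish) (L , g-vanish) = K ℕ.+ L , λ t → trans (Δ^-+ (K ℕ.+ L) f g t) (trans
      (+-cong (trans (reflexive (≡.cong (λ m → Δ^ m f t) (ℕ.+-comm K L))) (Δ^-raise L K f f-vanish t)) (Δ^-raise K L g g-vanish t)) (+-identityˡ 0#))

    polynomial-scale : ∀ {f} k → IsPolynomial f → IsPolynomial (λ t → k * f t)
    polynomial-scale {f} k (K , vanish) = K , λ t → trans (Δ^-scale K k f t) (trans (*-congˡ (vanish t)) (zeroʳ k))

    polynomial-0 : IsPolynomial (λ _ → 0#)
    polynomial-0 = 0 , λ _ → refl

    polynomial-constant : ∀ k → IsPolynomial (λ _ → k)
    polynomial-constant k = 1 , λ _ → -‿inverseʳ k

    polynomial-∑ : ∀ n {f : ℕ → ℕ → Carrier} → (∀ i → i < n → IsPolynomial (f i)) → IsPolynomial (λ t → ∑< n (λ i → f i t))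
    polynomial-∑ zero    poly = polynomial-0
    polynomial-∑ (suc n) poly = polynomial-+ (poly 0 (s≤s z≤n)) (polynomial-∑ n (λ i i<n → poly (suc i) (s≤s i<n)))

    polynomial-∑ₗ : {A : Set} (as : List A) {f : A → ℕ → Carrier} → (∀ a → IsPolynomial (f a)) → IsPolynomial (λ t → ∑ₗ as (λ a → f a t))
    polynomial-∑ₗ []       poly = polynomial-0
    polynomial-∑ₗ (a ∷ as) poly = polynomial-+ (poly a) (polynomial-∑ₗ as poly)

    -- As `τ` grows by 1, the Leibniz rule reads Δ(τ f)(t) = τ(t) Δf(t) + f(t + 1), and one
    -- additional difference suffices.
    polynomial-* : ∀ (τ : ℕ → Carrier) → (∀ t → τ (suc t) ≈ 1# + τ t) → ∀ {f} → IsPolynomial f → IsPolynomial (λ t → τ t * f t)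
    polynomial-* τ τ-suc {f} (K , vanish) = suc K , go K f vanish
      where
      go : ∀ K f → (∀ t → Δ^ K f t ≈ 0#) → ∀ t → Δ^ (suc K) (λ t → τ t * f t) t ≈ 0#
      go K f vanish t = trans (Δ^-cong K leibniz t) (trans (Δ^-+ K (λ t → τ t * Δ f t) (f ∘ suc) t)
        (trans (+-cong (first K f vanish t) (trans (Δ^-shift K f t) (vanish (suc t)))) (+-identityˡ 0#)))
        where
        leibniz : ∀ t → Δ (λ t → τ t * f t) t ≈ τ t * Δ f t + f (suc t)
        leibniz t = trans (+-congʳ (*-congʳ (τ-suc t)))
          (solve 3 (λ τ a b → (con 1ℤ :+ τ) :* a :- τ :* b := τ :* (a :- b) :+ a) refl (τ t) (f (suc t)) (f t))
        first : ∀ K f → (∀ t → Δ^ K f t ≈ 0#) → ∀ t → Δ^ K (λ t → τ t * Δ f t) t ≈ 0#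
        first zero    f vanish t = trans (*-congˡ (trans (+-cong (vanish (suc t)) (-‿cong (vanish t))) (-‿inverseʳ 0#))) (zeroʳ _)
        first (suc K) f vanish = go K (Δ f) vanish

    -- The difference sequence satisfies the same hypotheses with one difference fewer, so f(1) -
    -- f(0) is 0.
    vanishes-at-0 : ∀ {f} → IsPolynomial f → (∀ t → f (suc t) ≈ 0#) → f 0 ≈ 0#
    vanishes-at-0 (K , vanish) = go K vanish
      where
      go : ∀ K {f} → (∀ t → Δ^ K f t ≈ 0#) → (∀ t → f (suc t) ≈ 0#) → f 0 ≈ 0#
      go zero    vanish zero′ = vanish 0
      go (suc K) {f} vanish zero′ = begin
        f 0                      ≈⟨ solve 2 (λ a b → a := b :- (b :- a)) refl (f 0) (f 1) ⟩
        f 1 - Δ f 0              ≈⟨ +-cong (zero′ 0) (-‿cong (go K vanish (λ t → trans (+-cong (zero′ (suc t)) (-‿cong (zero′ t))) (-‿inverseʳ 0#)))) ⟩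
        0# - 0#                  ≈⟨ -‿inverseʳ 0# ⟩
        0#                       ∎

    agree-at-0 : ∀ {f g} → IsPolynomial f → IsPolynomial g → (∀ t → f (suc t) ≈ g (suc t)) → f 0 ≈ g 0
    agree-at-0 {f} {g} pf pg eq = begin
      f 0                        ≈⟨ solve 2 (λ a b → a := (a :+ :- con 1ℤ :* b) :+ b) refl (f 0) (g 0) ⟩
      (f 0 + - 1# * g 0) + g 0   ≈⟨ +-congʳ (vanishes-at-0 (polynomial-+ pf (polynomial-scale (- 1#) pg))
                                     (λ t → trans (+-congʳ (eq t)) (solve 1 (λ a → a :+ :- con 1ℤ :* a := con 0ℤ) refl (g (suc t))))) ⟩
      0# + g 0                   ≈⟨ +-identityˡ _ ⟩
      g 0                        ∎

    -- Each difference undoes one of the nested summations.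
    polynomial-chainCount : ∀ ds → IsPolynomial (λ t → chainCount t ds)
    polynomial-chainCount []       = polynomial-constant 1#
    polynomial-chainCount (d ∷ ds) with polynomial-chainCount ds
    ... | K , vanish = suc K , go d
      where
      difference : ∀ n → ∑< (suc n) (λ g → chainCount g ds) - ∑< n (λ g → chainCount g ds) ≈ chainCount n ds
      difference n = trans (+-congʳ (∑-last n (λ g → chainCount g ds))) (solve 2 (λ a b → (a :+ b) :- a := b) refl _ _)
      go : ∀ d t → Δ^ K (Δ (λ t → chainCount t (d ∷ ds))) t ≈ 0#
      go true  t = trans (Δ^-cong K difference t) (vanish t)
      go false t = trans (Δ^-cong K (λ t → difference (suc t)) t) (trans (Δ^-shift K (λ t → chainCount t ds) t) (vanish (suc t)))

  module ZeroLetters {c ℓ} (R : CommutativeRing c ℓ) (ι : ℕ → CommutativeRing.Carrier R)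
    (ι-0 : CommutativeRing._≈_ R (ι 0) (CommutativeRing.0# R)) (ι-1 : CommutativeRing._≈_ R (ι 1) (CommutativeRing.1# R))
    (ι-+ : ∀ m n → CommutativeRing._≈_ R (ι (m ℕ.+ n)) (CommutativeRing._+_ R (ι m) (ι n))) where
    open CommutativeRing R
    open RingSolver R
    open FiniteSums R
    open import Relation.Binary.Reasoning.Setoid setoid

    ∑-reverse : ∀ n f → ∑< n f ≈ ∑< n (λ a → f (n ∸ suc a))
    ∑-reverse ℕ.zero  f = refl
    ∑-reverse (suc n) f = trans (∑-last n f) (trans (+-comm _ _) (+-congˡ (∑-reverse n f)))

    -- This is the complementation of nonzero letters; the numbers `a` become the coordinates of
    -- lattice points.
    ∑-complement : ∀ n f → ∑< n (f ∘ suc) ≈ ∑< n (λ a → f (n ∸ a))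
    ∑-complement n f = trans (∑-reverse n (f ∘ suc)) (∑-cong< n λ a a<n → reflexive (≡.cong f (≡.sym (ℕ.+-∸-assoc 1 a<n))))

    complementSum : ℕ → List ℕ → ℕ
    complementSum L []      = 0
    complementSum L (a ∷ w) = (L ∸ a) ℕ.+ complementSum L w

    binomial : ℕ → ℕ → Carrier
    binomial n m = ι (n ℕ.C m)

    binomial-pascal : ∀ n m → binomial (suc n) (suc m) ≈ binomial n m + binomial n (suc m)
    binomial-pascal n m = trans (reflexive (≡.cong ι (≡.sym (nCk+nC[k+1]≡[n+1]C[k+1] n m)))) (ι-+ _ _)

    module _ (L : ℕ) where
      nonzeroWords : ℕ → (ℕ → Carrier) → Carrier
      nonzeroWords j F = ∑words (∑< L) j (F ∘ complementSum L)

      -- Distinguishing whether the first letter is 0 gives Pascal's rule; `m` is the number of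
      -- zeros.
      split-zeros : ∀ n F → ∑words (∑< (suc L)) n (F ∘ sum) ≈ ∑< (suc n) (λ m → binomial n m * nonzeroWords (n ∸ m) F)
      split-zeros ℕ.zero  F = sym (trans (+-identityʳ _) (trans (*-congʳ ι-1) (*-identityˡ _)))
      split-zeros (suc n) F = begin
        ∑words (∑< (suc L)) n (F ∘ sum) + ∑< L (λ a → ∑words (∑< (suc L)) n (λ w → F (suc a ℕ.+ sum w)))
          ≈⟨ +-congˡ (∑-complement L (λ a → ∑words (∑< (suc L)) n (λ w → F (a ℕ.+ sum w)))) ⟩
        ∑words (∑< (suc L)) n (F ∘ sum) + ∑< L (λ a → ∑words (∑< (suc L)) n (λ w → F ((L ∸ a) ℕ.+ sum w)))
          ≈⟨ +-cong (split-zeros n F) (∑-cong L λ a → split-zeros n (λ s → F ((L ∸ a) ℕ.+ s))) ⟩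
        ∑< (suc n) (λ m → b m * q (n ∸ m)) + ∑< L (λ a → ∑< (suc n) (λ m → b m * nonzeroWords (n ∸ m) (λ s → F ((L ∸ a) ℕ.+ s))))
          ≈⟨ +-congˡ (trans (Linear.∑-swap (∑-linear L) (suc n) (λ a m → b m * nonzeroWords (n ∸ m) (λ s → F ((L ∸ a) ℕ.+ s))))
               (∑-cong (suc n) λ m → Linear.scale (∑-linear L) (b m) (λ a → nonzeroWords (n ∸ m) (λ s → F ((L ∸ a) ℕ.+ s))))) ⟩
        ∑< (suc n) (λ m → b m * q (n ∸ m)) + ∑< (suc n) (λ m → b m * q (suc (n ∸ m)))
          ≈⟨ +-congˡ (trans (∑-cong< (suc n) λ { m (s≤s m≤n) → *-congˡ {b m} (reflexive (≡.cong q (≡.sym (ℕ.+-∸-assoc 1 m≤n)))) }) extend) ⟩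
        ∑< (suc n) (λ m → b m * q (n ∸ m)) + (b 0 * q (suc n) + ∑< (suc n) (λ m → b (suc m) * q (n ∸ m)))
          ≈⟨ solve 3 (λ x y z → x :+ (y :+ z) := y :+ (x :+ z)) refl _ _ _ ⟩
        b 0 * q (suc n) + (∑< (suc n) (λ m → b m * q (n ∸ m)) + ∑< (suc n) (λ m → b (suc m) * q (n ∸ m)))
          ≈⟨ +-cong (*-congʳ (reflexive ≡.refl)) (trans (sym (Linear.add (∑-linear (suc n)) (λ m → b m * q (n ∸ m)) (λ m → b (suc m) * q (n ∸ m)))) (∑-cong (suc n) λ m →
               trans (sym (distribʳ (q (n ∸ m)) (b m) (b (suc m)))) (*-congʳ (sym (binomial-pascal n m))))) ⟩
        ∑< (suc (suc n)) (λ m → binomial (suc n) m * q (suc n ∸ m)) ∎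
        where
        b = binomial n
        q : ℕ → Carrier
        q j = nonzeroWords j F
        -- The term appended at the end has the binomial coefficient of `n` over `n + 1`, which is
        -- 0.
        extend : ∑< (suc n) (λ m → b m * q (suc n ∸ m)) ≈ b 0 * q (suc n) + ∑< (suc n) (λ m → b (suc m) * q (n ∸ m))
        extend = sym (trans (∑-last (suc n) (λ m → b m * q (suc n ∸ m))) (trans (+-congˡ (trans (*-congʳ (trans
          (reflexive (≡.cong ι (k>n⇒nCk≡0 {n} {suc n} ℕ.≤-refl))) ι-0)) (zeroˡ _))) (+-identityʳ _)))

-- Stable sorting as a bijection from words to permutations with chains

module StableSort where
  open import Defs using (words; permutations)
  open ChainEnumeration
  open DescentSeries
  open import Data.Bool.Base using (Bool; true; false; if_then_else_; _∧_; not; T)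
  open import Data.Bool.Properties using (T-≡; ∧-zeroʳ; T?)
  open import Data.Empty using (⊥-elim)
  open import Data.Fin.Base as Fin using (Fin; zero; suc; toℕ; fromℕ<; punchOut)
  import Data.Fin.Properties as Fin
  open import Data.List.Base as List using (List; []; _∷_; filter; cartesianProduct)
  open import Data.List.Membership.Propositional using (_∈_)
  open import Data.List.Membership.Propositional.Properties
    using (∈-allFin; ∈-filter⁺; ∈-filter⁻; ∈-cartesianProductWith⁺; ∈-cartesianProduct⁺; ∈-cartesianProduct⁻; ∈-map⁺; ∈-map⁻)
  open import Data.List.Membership.Propositional.Properties.WithK using (unique∧set⇒bag)
  open import Data.List.Relation.Binary.BagAndSetEquality using (∼bag⇒↭)
  open import Data.List.Relation.Binary.Permutation.Propositional using (_↭_)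
  open import Data.List.Relation.Unary.All using ([]; _∷_)
  open import Data.List.Relation.Unary.Any using (here)
  open import Data.List.Relation.Unary.AllPairs using ([]; _∷_)
  open import Data.List.Relation.Unary.Unique.Propositional using (Unique)
  import Data.List.Relation.Unary.Unique.Propositional.Properties as Unique
  open import Data.Nat.Base as ℕ using (ℕ; zero; suc; _≤_; _<_; z≤n; s≤s; _≡ᵇ_)
  import Data.Nat.Properties as ℕ
  open import Data.Product.Base using (_×_; _,_; proj₁; proj₂; ∃)
  open import Data.Product.Properties using (,-injectiveˡ; ,-injectiveʳ)
  open import Data.Sum.Base using (_⊎_; inj₁; inj₂)
  open import Data.Vec.Base as Vec using (Vec; []; _∷_; lookup; tabulate)
  import Data.Vec.Properties as Vec
  import Data.Vec.Relation.Unary.AllPairs as AllPairs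
  open import Data.Vec.Relation.Unary.Unique.Propositional using () renaming (Unique to UniqueVec)
  import Data.Vec.Relation.Unary.Unique.Propositional.Properties as UniqueVec
  open import Function.Base using (_∘_)
  open import Function.Bundles using (Equivalence; mk⇔)
  open import Relation.Binary.Definitions using (tri<; tri≈; tri>)
  open import Relation.Binary.PropositionalEquality as ≡ using (_≡_; _≢_)
  open import Relation.Nullary using (yes; no)
  open import Relation.Nullary.Decidable using (dec-true; dec-false; ¬?)
  open import Relation.Unary using (Decidable)

  vec-ext : ∀ {A : Set} {m} {u v : Vec A m} → (∀ i → lookup u i ≡ lookup v i) → u ≡ v
  vec-ext {u = u} {v} eq = ≡.trans (≡.sym (Vec.tabulate∘lookup u)) (≡.trans (Vec.tabulate-cong eq) (Vec.tabulate∘lookup v))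

  tabulate-injective : ∀ {A : Set} {n} {f g : Fin n → A} → tabulate f ≡ tabulate g → ∀ i → f i ≡ g i
  tabulate-injective {f = f} {g} eq i = ≡.trans (≡.sym (Vec.lookup∘tabulate f i))
    (≡.trans (≡.cong (λ v → lookup v i) eq) (Vec.lookup∘tabulate g i))

  words-unique : ∀ m n → Unique (words m n)
  words-unique m zero    = [] ∷ []
  words-unique m (suc n) = Unique.cartesianProductWith⁺ _∷_ Vec.∷-injective (Unique.allFin⁺ m) (words-unique m n)

  words-complete : ∀ {m n} (v : Vec (Fin m) n) → v ∈ words m n
  words-complete []      = here ≡.refl
  words-complete (i ∷ v) = ∈-cartesianProductWith⁺ _∷_ (∈-allFin i) (words-complete v)

  uniqueVec? : ∀ {n} → Decidable (UniqueVec {A = Fin n} {n = n})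
  uniqueVec? = AllPairs.allPairs? (λ i j → ¬? (i Fin.≟ j))

  permutations-unique : ∀ n → Unique (permutations n)
  permutations-unique n = Unique.filter⁺ uniqueVec? (words-unique n n)

  ∈-permutations⁺ : ∀ {n} {σ : Vec (Fin n) n} → UniqueVec σ → σ ∈ permutations n
  ∈-permutations⁺ uniq = ∈-filter⁺ uniqueVec? (words-complete _) uniq

  ∈-permutations⁻ : ∀ {n} {σ : Vec (Fin n) n} → σ ∈ permutations n → UniqueVec σ
  ∈-permutations⁻ {n} σ∈ = proj₂ (∈-filter⁻ uniqueVec? {xs = words n n} σ∈)

  -- If a value were missed, punching it out would inject `suc n` elements into `n`.
  injective⇒surjective : ∀ {n} (f : Fin n → Fin n) → (∀ {i j} → f i ≡ f j → i ≡ j) → ∀ j → ∃ λ i → f i ≡ j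
  injective⇒surjective {suc n} f inj j with Fin.any? (λ i → f i Fin.≟ j)
  ... | yes found = found
  ... | no  none  = ⊥-elim (ℕ.1+n≰n (Fin.injective⇒≤ {f = λ i → punchOut (none′ i)}
                      (λ {i} {k} eq → inj (Fin.punchOut-injective (none′ i) (none′ k) eq))))
    where
    none′ : ∀ i → j ≢ f i
    none′ i eq = none (i , ≡.sym eq)

  -- The tail is confined to the values from `suc lo` on and is determined by induction; its first
  -- value then leaves only `lo` for the head.
  strictly-increasing : ∀ {n} lo (f : Fin n → ℕ) → (∀ i j → i Fin.< j → f i < f j) →
                        (∀ i → lo ≤ f i) → (∀ i → f i < lo ℕ.+ n) → ∀ i → f i ≡ lo ℕ.+ toℕ i
  strictly-increasing {suc n} lo f mono low high = go
    where
    tail : ∀ i → f (suc i) ≡ suc lo ℕ.+ toℕ i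
    tail = strictly-increasing (suc lo) (f ∘ suc) (λ i j i<j → mono (suc i) (suc j) (s≤s i<j))
      (λ i → ℕ.≤-<-trans (low zero) (mono zero (suc i) (s≤s z≤n))) (λ i → ≡.subst (f (suc i) <_) (ℕ.+-suc lo n) (high (suc i)))
    head : ∀ {n} (f : Fin (suc n) → ℕ) → lo ≤ f zero → (∀ i → f (suc i) ≡ suc lo ℕ.+ toℕ i) →
           f zero < lo ℕ.+ suc n → (∀ i → f zero < f (suc i)) → f zero ≡ lo
    head {zero}  f low tl hi mn = ℕ.≤-antisym (ℕ.≤-pred (≡.subst (f zero <_) (ℕ.+-comm lo 1) hi)) low
    head {suc n} f low tl hi mn = ℕ.≤-antisym (ℕ.≤-pred (≡.subst (f zero <_) (≡.trans (tl zero) (ℕ.+-identityʳ _)) (mn zero))) low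
    go : ∀ i → f i ≡ lo ℕ.+ toℕ i
    go zero    = ≡.trans (head f (low zero) tail (high zero) (λ i → mono zero (suc i) (s≤s z≤n))) (≡.sym (ℕ.+-identityʳ lo))
    go (suc i) = ≡.trans (tail i) (≡.sym (ℕ.+-suc lo (toℕ i)))

  indicator-≤ : ∀ {a b} → (a ≡ true → b ≡ true) → (if a then 1 else 0) ≤ (if b then 1 else 0)
  indicator-≤ {false}        imp = z≤n
  indicator-≤ {true} {true}  imp = s≤s z≤n
  indicator-≤ {true} {false} imp with () ← imp ≡.refl

  boolSum-≤ : ∀ {n} {p q : Fin n → Bool} → (∀ i → p i ≡ true → q i ≡ true) → boolSum p ≤ boolSum q
  boolSum-≤ {zero}  imp = z≤n
  boolSum-≤ {suc n} imp = ℕ.+-mono-≤ (indicator-≤ (imp zero)) (boolSum-≤ (imp ∘ suc))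

  boolSum-< : ∀ {n} {p q : Fin n → Bool} → (∀ i → p i ≡ true → q i ≡ true) → ∀ k → p k ≡ false → q k ≡ true → boolSum p < boolSum q
  boolSum-< {suc n} {p} {q} imp zero    pk qk rewrite pk | qk = s≤s (boolSum-≤ (imp ∘ suc))
  boolSum-< {suc n} {p} {q} imp (suc k) pk qk = ≡.subst (_≤ boolSum q) (ℕ.+-suc (if p zero then 1 else 0) _)
    (ℕ.+-mono-≤ (indicator-≤ (imp zero)) (boolSum-< (imp ∘ suc) k pk qk))

  boolSum-true : ∀ n → boolSum {n} (λ _ → true) ≡ n
  boolSum-true zero    = ≡.refl
  boolSum-true (suc n) = ≡.cong suc (boolSum-true n)

  -- The propositional form of `allowed`: the weak sorting order on pairs of a letter and its place.
  Before : ℕ → ℕ → ℕ → ℕ → Set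
  Before e₀ s₀ e s = e < e₀ ⊎ (e₀ ≡ e × s₀ ≤ s)

  allowed⇒Before : ∀ e₀ s₀ e s → allowed e₀ s₀ e s ≡ true → Before e₀ s₀ e s
  allowed⇒Before e₀ s₀ e s eq with e ℕ.<? e₀ | e₀ ℕ.≟ e | s ℕ.<? s₀
  ... | yes e<e₀ | _        | _        = inj₁ e<e₀
  ... | no e≮e₀  | yes e≡e₀ | no s≮s₀  = inj₂ (e≡e₀ , ℕ.≮⇒≥ s≮s₀)
  ... | no e≮e₀  | yes e≡e₀ | yes s<s₀ rewrite dec-false (e ℕ.<? e₀) e≮e₀ | dec-true (s ℕ.<? s₀) s<s₀ | ∧-zeroʳ (e₀ ≡ᵇ e) with () ← eq
  ... | no e≮e₀  | no e≢e₀  | _        rewrite dec-false (e ℕ.<? e₀) e≮e₀ | dec-false (e₀ ℕ.≟ e) e≢e₀ with () ← eq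

  Before⇒allowed : ∀ e₀ s₀ e s → Before e₀ s₀ e s → allowed e₀ s₀ e s ≡ true
  Before⇒allowed e₀ s₀ e s (inj₁ e<e₀) rewrite dec-true (e ℕ.<? e₀) e<e₀ = ≡.refl
  Before⇒allowed e₀ s₀ e s (inj₂ (≡.refl , s₀≤s)) rewrite dec-false (e ℕ.<? e) (ℕ.<-irrefl ≡.refl) | dec-true (e ℕ.≟ e) ≡.refl | dec-false (s ℕ.<? s₀) (ℕ.≤⇒≯ s₀≤s) = ≡.refl

  Before-trans : ∀ {e₀ s₀ e₁ s₁ e₂ s₂} → Before e₀ s₀ e₁ s₁ → Before e₁ s₁ e₂ s₂ → Before e₀ s₀ e₂ s₂
  Before-trans (inj₁ p) (inj₁ q) = inj₁ (ℕ.<-trans q p)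
  Before-trans (inj₁ p) (inj₂ (≡.refl , q)) = inj₁ p
  Before-trans (inj₂ (≡.refl , p)) (inj₁ q) = inj₁ q
  Before-trans (inj₂ (≡.refl , p)) (inj₂ (≡.refl , q)) = inj₂ (≡.refl , ℕ.≤-trans p q)

  Before-total : ∀ e₀ s₀ e s → Before e₀ s₀ e s ⊎ Before e s e₀ s₀
  Before-total e₀ s₀ e s with ℕ.<-cmp e e₀
  ... | tri< e<e₀ _ _ = inj₁ (inj₁ e<e₀)
  ... | tri> _ _ e₀<e = inj₂ (inj₁ e₀<e)
  ... | tri≈ _ ≡.refl _ with ℕ.≤-total s₀ s
  ...   | inj₁ s₀≤s = inj₁ (inj₂ (≡.refl , s₀≤s))
  ...   | inj₂ s≤s₀ = inj₂ (inj₂ (≡.refl , s≤s₀))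

  Before-antisym : ∀ {e₀ s₀ e s} → Before e₀ s₀ e s → Before e s e₀ s₀ → s₀ ≡ s
  Before-antisym (inj₁ p) (inj₁ q) = ⊥-elim (ℕ.<-asym p q)
  Before-antisym (inj₁ p) (inj₂ (≡.refl , q)) = ⊥-elim (ℕ.<-irrefl ≡.refl p)
  Before-antisym (inj₂ (≡.refl , p)) (inj₁ q) = ⊥-elim (ℕ.<-irrefl ≡.refl q)
  Before-antisym (inj₂ (_ , p)) (inj₂ (_ , q)) = ℕ.≤-antisym p q

  ∧-true : ∀ {a b} → a ∧ b ≡ true → a ≡ true × b ≡ true
  ∧-true {true} {true} _ = ≡.refl , ≡.refl

  module _ {m m′ : ℕ} where
    ToBefore : ∀ {n} → Vec (Fin m) n → Vec (Fin m′) n → ℕ → ℕ → Fin n → Set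
    ToBefore es ss e₀ s₀ i = Before e₀ s₀ (toℕ (lookup es i)) (toℕ (lookup ss i))

    chain⇒first : ∀ {n} e₀ s₀ (es : Vec (Fin m) n) (ss : Vec (Fin m′) n) → chain e₀ s₀ (Vec.map toℕ es) (Vec.map toℕ ss) ≡ true →
                  ∀ i → ToBefore es ss e₀ s₀ i
    chain⇒first e₀ s₀ (e ∷ es) (s ∷ ss) eq zero    = allowed⇒Before e₀ s₀ _ _ (proj₁ (∧-true eq))
    chain⇒first e₀ s₀ (e ∷ es) (s ∷ ss) eq (suc i) = Before-trans (allowed⇒Before e₀ s₀ _ _ (proj₁ (∧-true eq)))
      (chain⇒first (toℕ e) (toℕ s) es ss (proj₂ (∧-true {allowed e₀ s₀ (toℕ e) (toℕ s)} eq)) i)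

    chain⇒pairs : ∀ {n} e₀ s₀ (es : Vec (Fin m) n) (ss : Vec (Fin m′) n) → chain e₀ s₀ (Vec.map toℕ es) (Vec.map toℕ ss) ≡ true →
                  ∀ i j → i Fin.< j → ToBefore es ss (toℕ (lookup es i)) (toℕ (lookup ss i)) j
    chain⇒pairs e₀ s₀ (e ∷ es) (s ∷ ss) eq zero    (suc j) _ =
      chain⇒first (toℕ e) (toℕ s) es ss (proj₂ (∧-true {allowed e₀ s₀ (toℕ e) (toℕ s)} eq)) j
    chain⇒pairs e₀ s₀ (e ∷ es) (s ∷ ss) eq (suc i) (suc j) (s≤s i<j) =
      chain⇒pairs (toℕ e) (toℕ s) es ss (proj₂ (∧-true {allowed e₀ s₀ (toℕ e) (toℕ s)} eq)) i j i<j

    pairs⇒chain : ∀ {n} e₀ s₀ (es : Vec (Fin m) n) (ss : Vec (Fin m′) n) → (∀ i → ToBefore es ss e₀ s₀ i) →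
                  (∀ i j → i Fin.< j → ToBefore es ss (toℕ (lookup es i)) (toℕ (lookup ss i)) j) →
                  chain e₀ s₀ (Vec.map toℕ es) (Vec.map toℕ ss) ≡ true
    pairs⇒chain e₀ s₀ []       []       first pairs = ≡.refl
    pairs⇒chain e₀ s₀ (e ∷ es) (s ∷ ss) first pairs rewrite Before⇒allowed e₀ s₀ _ _ (first zero) =
      pairs⇒chain (toℕ e) (toℕ s) es ss (λ i → pairs zero (suc i) (s≤s z≤n)) (λ i j i<j → pairs (suc i) (suc j) (s≤s i<j))

  module Sorting {K n : ℕ} (w : Vec (Fin K) n) where
    letterAt : Fin n → ℕ
    letterAt p = toℕ (lookup w p)

    before : Fin n → Fin n → Bool
    before p q = allowed (letterAt p) (toℕ p) (letterAt q) (toℕ q)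

    -- As `before` is a reflexive total order, its negation selects the places strictly ahead of
    -- `p`; the rank is the sorted place, counted from 0.
    rank : Fin n → ℕ
    rank p = boolSum (λ q → not (before p q))

    before-refl : ∀ p → before p p ≡ true
    before-refl p = Before⇒allowed (letterAt p) (toℕ p) _ _ (inj₂ (≡.refl , ℕ.≤-refl))

    rank<n : ∀ p → rank p < n
    rank<n p = ≡.subst (rank p <_) (boolSum-true n) (boolSum-< (λ _ _ → ≡.refl) p (≡.cong not (before-refl p)) ≡.refl)

    private
      not-true : ∀ {a b} → (b ≡ true → a ≡ true) → not a ≡ true → not b ≡ true
      not-true {false} {false} imp _ = ≡.refl
      not-true {false} {true}  imp _ with () ← imp ≡.refl

    rank-mono : ∀ p q → p ≢ q → before p q ≡ true → rank p < rank q
    rank-mono p q p≢q p≤q = boolSum-< (λ s → not-true λ q≤s → Before⇒allowed _ _ _ _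
        (Before-trans (allowed⇒Before (letterAt p) (toℕ p) _ _ p≤q) (allowed⇒Before (letterAt q) (toℕ q) _ _ q≤s)))
      p (≡.cong not (before-refl p)) (not-before (before q p) ≡.refl)
      where
      not-before : ∀ b → before q p ≡ b → not b ≡ true
      not-before false _   = ≡.refl
      not-before true  q≤p = ⊥-elim (p≢q (Fin.toℕ-injective (Before-antisym
        (allowed⇒Before (letterAt p) (toℕ p) _ _ p≤q) (allowed⇒Before (letterAt q) (toℕ q) _ _ q≤p))))

    rank-cancel : ∀ p q → rank p < rank q → before p q ≡ true
    rank-cancel p q rp<rq with Before-total (letterAt p) (toℕ p) (letterAt q) (toℕ q)
    ... | inj₁ p≤q = Before⇒allowed _ _ _ _ p≤q
    ... | inj₂ q≤p with p Fin.≟ q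
    ...   | yes ≡.refl = ⊥-elim (ℕ.<-irrefl ≡.refl rp<rq)
    ...   | no  p≢q    = ⊥-elim (ℕ.<-asym rp<rq (rank-mono q p (p≢q ∘ ≡.sym) (Before⇒allowed _ _ _ _ q≤p)))

    rankFin : Fin n → Fin n
    rankFin p = fromℕ< (rank<n p)

    rankFin-injective : ∀ {p q} → rankFin p ≡ rankFin q → p ≡ q
    rankFin-injective {p} {q} eq with p Fin.≟ q
    ... | yes p≡q = p≡q
    ... | no  p≢q = ⊥-elim (ne (Before-total (letterAt p) (toℕ p) (letterAt q) (toℕ q)))
      where
      req : rank p ≡ rank q
      req = ≡.trans (≡.sym (Fin.toℕ-fromℕ< _)) (≡.trans (≡.cong toℕ eq) (Fin.toℕ-fromℕ< _))
      ne : _ → _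
      ne (inj₁ b) = ℕ.<⇒≢ (rank-mono p q p≢q (Before⇒allowed _ _ _ _ b)) req
      ne (inj₂ b) = ℕ.<⇒≢ (rank-mono q p (p≢q ∘ ≡.sym) (Before⇒allowed _ _ _ _ b)) (≡.sym req)

    sort : Fin n → Fin n
    sort i = proj₁ (injective⇒surjective rankFin rankFin-injective i)

    rankFin-sort : ∀ i → rankFin (sort i) ≡ i
    rankFin-sort i = proj₂ (injective⇒surjective rankFin rankFin-injective i)

    rank-sort : ∀ i → rank (sort i) ≡ toℕ i
    rank-sort i = ≡.trans (≡.sym (Fin.toℕ-fromℕ< _)) (≡.cong toℕ (rankFin-sort i))

    sort-rankFin : ∀ p → sort (rankFin p) ≡ p
    sort-rankFin p = rankFin-injective (rankFin-sort (rankFin p))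

    sort-injective : ∀ {i j} → sort i ≡ sort j → i ≡ j
    sort-injective {i} {j} eq = ≡.trans (≡.sym (rankFin-sort i)) (≡.trans (≡.cong rankFin eq) (rankFin-sort j))

  sorted : ∀ {K n} → Vec (Fin K) n → Vec (Fin n) n × Vec (Fin K) n
  sorted w = tabulate sort , tabulate (lookup w ∘ sort)
    where open Sorting w

  module SortedWords (K′ n : ℕ) where
    -- The chain starts from the largest letter `K′` at place 0, which any first letter may follow.
    -- For `K′ = r * t` this is the initial bound `t` of the chains combined with colour 0.
    Valid : Vec (Fin n) n × Vec (Fin (suc K′)) n → Set
    Valid (σ , es) = T (chain K′ 0 (Vec.map toℕ es) (Vec.map toℕ σ))

    valid? : Decidable Valid
    valid? (σ , es) = T? _

    sorted-injective : ∀ {w w′ : Vec (Fin (suc K′)) n} → sorted w ≡ sorted w′ → w ≡ w′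
    sorted-injective {w} {w′} eq = vec-ext same
      where
      module W = Sorting w
      module W′ = Sorting w′
      sort≡ : ∀ i → W.sort i ≡ W′.sort i
      sort≡ = tabulate-injective (,-injectiveˡ eq)
      same : ∀ p → lookup w p ≡ lookup w′ p
      same p = begin
        lookup w p                           ≡⟨ ≡.cong (lookup w) (W.sort-rankFin p) ⟨
        lookup w (W.sort (W.rankFin p))      ≡⟨ tabulate-injective (,-injectiveʳ eq) (W.rankFin p) ⟩
        lookup w′ (W′.sort (W.rankFin p))    ≡⟨ ≡.cong (lookup w′) (≡.trans (≡.sym (sort≡ (W.rankFin p))) (W.sort-rankFin p)) ⟩
        lookup w′ p                          ∎
        where open ≡.≡-Reasoning

    sorted-valid : ∀ w → Valid (sorted w)
    sorted-valid w = Equivalence.from T-≡ (pairs⇒chain K′ 0 (tabulate (lookup w ∘ sort)) (tabulate sort) first pairs)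
      where
      open Sorting w
      first : ∀ i → ToBefore (tabulate (lookup w ∘ sort)) (tabulate sort) K′ 0 i
      first i with ℕ.m≤n⇒m<n∨m≡n (ℕ.≤-pred (Fin.toℕ<n (lookup (tabulate (lookup w ∘ sort)) i)))
      ... | inj₁ e<K = inj₁ e<K
      ... | inj₂ e≡K = inj₂ (≡.sym e≡K , z≤n)
      pairs : ∀ i j → i Fin.< j → ToBefore (tabulate (lookup w ∘ sort)) (tabulate sort)
        (toℕ (lookup (tabulate (lookup w ∘ sort)) i)) (toℕ (lookup (tabulate sort) i)) j
      pairs i j i<j rewrite Vec.lookup∘tabulate (lookup w ∘ sort) i | Vec.lookup∘tabulate (lookup w ∘ sort) j
                          | Vec.lookup∘tabulate sort i | Vec.lookup∘tabulate sort j =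
        allowed⇒Before _ _ _ _ (rank-cancel (sort i) (sort j) (≡.subst₂ _<_ (≡.sym (rank-sort i)) (≡.sym (rank-sort j)) i<j))

    -- Put the letter `es i` at place `σ i`. A chain is sorted for every pair of entries, so ranks
    -- increase strictly along `σ`; hence they are 0, 1, 2, ..., and `σ` is the sorting permutation.
    sorted-onto : ∀ σ es → UniqueVec σ → Valid (σ , es) → ∃ λ w → sorted w ≡ (σ , es)
    sorted-onto σ es uniq valid = w , ≡.cong₂ _,_ (vec-ext (λ i → ≡.trans (Vec.lookup∘tabulate sort i) (sort≡ i)))
        (vec-ext (λ i → ≡.trans (Vec.lookup∘tabulate (lookup w ∘ sort) i) (≡.trans (≡.cong (lookup w) (sort≡ i)) (w∘σ i))))
      where
      τ = injective⇒surjective (lookup σ) (λ {i} {j} → UniqueVec.lookup-injective uniq i j)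
      w = tabulate (λ p → lookup es (proj₁ (τ p)))
      open Sorting w
      w∘σ : ∀ i → lookup w (lookup σ i) ≡ lookup es i
      w∘σ i = ≡.trans (Vec.lookup∘tabulate _ (lookup σ i)) (≡.cong (lookup es) (UniqueVec.lookup-injective uniq _ _ (proj₂ (τ (lookup σ i)))))
      increasing : ∀ i j → i Fin.< j → rank (lookup σ i) < rank (lookup σ j)
      increasing i j i<j = rank-mono (lookup σ i) (lookup σ j) (λ eq → Fin.<⇒≢ i<j (UniqueVec.lookup-injective uniq i j eq))
        (Before⇒allowed _ _ _ _ (≡.subst₂ (λ a b → Before a _ b _) (≡.cong toℕ (≡.sym (w∘σ i))) (≡.cong toℕ (≡.sym (w∘σ j)))
          (chain⇒pairs K′ 0 es σ (Equivalence.to T-≡ valid) i j i<j)))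
      rank-σ : ∀ i → rank (lookup σ i) ≡ toℕ i
      rank-σ = strictly-increasing 0 (rank ∘ lookup σ) increasing (λ _ → z≤n) (λ i → rank<n (lookup σ i))
      sort≡ : ∀ i → sort i ≡ lookup σ i
      sort≡ i = rankFin-injective (Fin.toℕ-injective (≡.trans (Fin.toℕ-fromℕ< _) (≡.trans (≡.trans (rank-sort i) (≡.sym (rank-σ i))) (≡.sym (Fin.toℕ-fromℕ< _)))))

    -- Two duplicate-free lists with the same members; in this form the bijection can reindex a sum.
    sorted-↭ : List.map sorted (words (suc K′) n) ↭ filter valid? (cartesianProduct (permutations n) (words (suc K′) n))
    sorted-↭ = ∼bag⇒↭ (unique∧set⇒bag (Unique.map⁺ sorted-injective (words-unique (suc K′) n))
        (Unique.filter⁺ valid? (Unique.cartesianProduct⁺ (permutations-unique n) (words-unique (suc K′) n)))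
        (mk⇔ to from))
      where
      to : ∀ {p} → p ∈ List.map sorted (words (suc K′) n) → p ∈ filter valid? (cartesianProduct (permutations n) (words (suc K′) n))
      to p∈ with ∈-map⁻ sorted p∈
      ... | w , _ , ≡.refl = ∈-filter⁺ valid? (∈-cartesianProduct⁺
              (∈-permutations⁺ (UniqueVec.tabulate⁺ (Sorting.sort-injective w))) (words-complete _)) (sorted-valid w)
      from : ∀ {p} → p ∈ filter valid? (cartesianProduct (permutations n) (words (suc K′) n)) → p ∈ List.map sorted (words (suc K′) n)
      from {σ , es} p∈ = ≡.subst (_∈ List.map sorted (words (suc K′) n)) (proj₂ found) (∈-map⁺ sorted (words-complete (proj₁ found)))
        where
        p∈′ = ∈-filter⁻ valid? {xs = cartesianProduct (permutations n) (words (suc K′) n)} p∈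
        found = sorted-onto σ es (∈-permutations⁻ (proj₁ (∈-cartesianProduct⁻ (permutations n) (words (suc K′) n) (proj₁ p∈′)))) (proj₂ p∈′)

-- The flag excedance number of the sorting permutation

module SortedExcedances where
  open import Defs using (words; coloredPermutations; permutations; fexc)
  open IntegerSolver
  open Summation
  open Tokens
  open EquidistributedStatistics
  open WordStatistic
  open SeriesRings
  open ChainEnumeration
  open DescentSeries
  open StableSort
  open import Algebra.Bundles using (CommutativeRing)
  import Algebra.Properties.CommutativeMonoid.Sum
  open import Data.Bool.Base using (Bool; true; false; if_then_else_; _∨_; _∧_; not)
  open import Data.Fin.Base as Fin using (Fin; zero; suc; toℕ)
  import Data.Fin.Permutation as Permutation
  import Data.Fin.Properties as Fin
  open import Data.List.Base as List using (List; []; _∷_; allFin; filter; cartesianProduct)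
  open import Data.Nat.Base as ℕ using (ℕ; zero; suc; z≤n; s≤s; _≡ᵇ_; _≤ᵇ_; _<ᵇ_)
  import Data.Nat.Properties as ℕ
  import Data.Nat.DivMod as ℕ
  open import Data.Nat.DivMod using (_mod_)
  open import Data.Product.Base using (_×_; _,_; proj₁; proj₂)
  import Data.Rational.Properties as ℚ
  open import Data.Vec.Base as Vec using (Vec; []; _∷_; lookup; toList; tabulate)
  import Data.Vec.Properties as Vec
  open import Function.Base using (_∘_)
  open import Relation.Binary.PropositionalEquality as ≡ using (_≡_)
  open import Relation.Nullary.Decidable using (_×-dec_)

  open Algebra.Properties.CommutativeMonoid.Sum ℕ.+-0-commutativeMonoid using ()
    renaming (sum to ∑ᶠ; sum-cong-≗ to ∑ᶠ-cong; sum-permute to ∑ᶠ-permute; ∑-distrib-+ to ∑ᶠ-distrib-+)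

  toWord : ∀ {K n} → Vec (Fin K) n → List ℕ
  toWord w = toList (Vec.map toℕ w)

  boolSum-∑ᶠ : ∀ {n} (p : Fin n → Bool) → boolSum p ≡ ∑ᶠ (λ i → if p i then 1 else 0)
  boolSum-∑ᶠ {zero}  p = ≡.refl
  boolSum-∑ᶠ {suc n} p = ≡.cong ((if p zero then 1 else 0) ℕ.+_) (boolSum-∑ᶠ (p ∘ suc))

  boolSum-∨ : ∀ {n} (p q : Fin n → Bool) → (∀ i → p i ∧ q i ≡ false) →
              boolSum (λ i → p i ∨ q i) ≡ boolSum p ℕ.+ boolSum q
  boolSum-∨ {zero}  p q disj = ≡.refl
  boolSum-∨ {suc n} p q disj = ≡.trans (≡.cong₂ ℕ._+_ (or (p zero) (q zero) (disj zero)) (boolSum-∨ (p ∘ suc) (q ∘ suc) (disj ∘ suc)))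
    (solve 4 (λ a b c d → (a :+ b) :+ (c :+ d) := (a :+ c) :+ (b :+ d)) ≡.refl (if p zero then 1 else 0) (if q zero then 1 else 0) (boolSum (p ∘ suc)) (boolSum (q ∘ suc)))
    where
    open import Data.Nat.Solver using (module +-*-Solver)
    open +-*-Solver
    or : ∀ a b → a ∧ b ≡ false → (if a ∨ b then 1 else 0) ≡ (if a then 1 else 0) ℕ.+ (if b then 1 else 0)
    or true  false _ = ≡.refl
    or false true  _ = ≡.refl
    or false false _ = ≡.refl

  greater-boolSum : ∀ {K n} b (w : Vec (Fin K) n) → greater b (List.map pure (toWord w)) ≡ boolSum (λ q → b <ᵇ toℕ (lookup w q))
  greater-boolSum b []      = ≡.refl
  greater-boolSum b (a ∷ w) with b <ᵇ toℕ a
  ... | true  = ≡.cong suc (greater-boolSum b w)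
  ... | false = greater-boolSum b w

  othersBefore : ∀ {K n} → Vec (Fin K) n → (ℕ → ℕ) → Fin n → ℕ
  othersBefore (b ∷ w) others zero    = others (toℕ b)
  othersBefore (b ∷ w) others (suc p) = othersBefore w (seen (pure (toℕ b)) others) p

  equalsBefore : ∀ {K n} → Vec (Fin K) n → Fin n → ℕ
  equalsBefore w p = boolSum (λ q → (toℕ (lookup w p) ≡ᵇ toℕ (lookup w q)) ∧ (toℕ q <ᵇ toℕ p))

  othersBefore+equalsBefore : ∀ {K n} (w : Vec (Fin K) n) others p →
    othersBefore w others p ℕ.+ equalsBefore w p ≡ others (toℕ (lookup w p)) ℕ.+ toℕ p
  othersBefore+equalsBefore (b ∷ w) others zero = ≡.cong (others (toℕ b) ℕ.+_) (none (b ∷ w))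
    where
    open import Data.Bool.Properties using (∧-zeroʳ)
    allFalse : ∀ n → boolSum {n} (λ _ → false) ≡ 0
    allFalse zero    = ≡.refl
    allFalse (suc n) = allFalse n
    none : ∀ {K n} (w : Vec (Fin K) (suc n)) → equalsBefore w zero ≡ 0
    none {n = n} w = ≡.trans (boolSum-cong {q = λ _ → false} (λ q → ∧-zeroʳ (toℕ (lookup w zero) ≡ᵇ toℕ (lookup w q)))) (allFalse (suc n))
  othersBefore+equalsBefore (b ∷ w) others (suc p) with toℕ (lookup w p) ≡ᵇ toℕ b in eq
  ... | true  = ≡.trans (ℕ.+-suc _ _) (≡.trans (≡.cong suc (≡.trans (othersBefore+equalsBefore w _ p)
                  (≡.cong (λ x → (if x then others (toℕ (lookup w p)) else suc (others (toℕ (lookup w p)))) ℕ.+ toℕ p) eq)))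
                  (≡.sym (ℕ.+-suc _ _)))
  ... | false = ≡.trans (othersBefore+equalsBefore w _ p)
                  (≡.trans (≡.cong (λ x → (if x then others (toℕ (lookup w p)) else suc (others (toℕ (lookup w p)))) ℕ.+ toℕ p) eq) (≡.sym (ℕ.+-suc _ _)))

  module _ {K n : ℕ} (w : Vec (Fin K) n) where
    open Sorting w

    -- Ahead of `p` in the sorted order are the greater letters, and those equal letters that stand
    -- further left.
    rank-greater+equals : ∀ p → rank p ≡ greater (letterAt p) (List.map pure (toWord w)) ℕ.+ equalsBefore w p
    rank-greater+equals p = ≡.trans (boolSum-cong (λ q → split (letterAt q) (letterAt p) (toℕ q <ᵇ toℕ p)))
        (≡.trans (boolSum-∨ _ _ (λ q → disjoint (letterAt p) (letterAt q) _)) (≡.cong (ℕ._+ equalsBefore w p) (≡.sym (greater-boolSum (letterAt p) w))))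
      where
      split : ∀ b a c → not ((b <ᵇ a) ∨ ((a ≡ᵇ b) ∧ not c)) ≡ (a <ᵇ b) ∨ ((a ≡ᵇ b) ∧ c)
      split zero    zero    true  = ≡.refl
      split zero    zero    false = ≡.refl
      split zero    (suc a) c     = ≡.refl
      split (suc b) zero    c     = ≡.refl
      split (suc b) (suc a) c     = split b a c
      disjoint : ∀ a b c → (a <ᵇ b) ∧ ((a ≡ᵇ b) ∧ c) ≡ false
      disjoint zero    zero    c = ≡.refl
      disjoint zero    (suc b) c = ≡.refl
      disjoint (suc a) zero    c = ≡.refl
      disjoint (suc a) (suc b) c = disjoint a b c

    -- Adding the number of earlier equal letters to both sides turns the comparison used by `stat`
    -- into that of a place with its sorted place.
    othersBefore≤ : ∀ p → (othersBefore w (λ _ → 0) p ≤ᵇ greater (letterAt p) (List.map pure (toWord w))) ≡ (toℕ p ≤ᵇ rank p)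
    othersBefore≤ p = ≡.trans (≡.sym (shift (equalsBefore w p) _ _))
        (≡.cong₂ _≤ᵇ_ (≡.trans (ℕ.+-comm (equalsBefore w p) _) (othersBefore+equalsBefore w (λ _ → 0) p))
          (≡.trans (ℕ.+-comm (equalsBefore w p) _) (≡.sym (rank-greater+equals p))))
      where
      shift : ∀ c a b → (c ℕ.+ a ≤ᵇ c ℕ.+ b) ≡ (a ≤ᵇ b)
      shift zero    a b = ≡.refl
      shift (suc c) a b = ≡.trans (step (c ℕ.+ a) (c ℕ.+ b)) (shift c a b)
        where
        step : ∀ a b → (suc a ≤ᵇ suc b) ≡ (a ≤ᵇ b)
        step zero    b = ≡.refl
        step (suc a) b = ≡.refl

  module SortedStatistic (r′ : ℕ) where
    private
      r : ℕ
      r = suc r′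
    open Statistic r′

    contribution : Bool → ℕ → ℕ
    contribution x b = if x then colour b else exceeding b

    statFrom-∑ᶠ : ∀ {K n} s others (w : Vec (Fin K) n) → statFrom s others (toWord w) ≡
      ∑ᶠ (λ p → contribution (othersBefore w others p ≤ᵇ s (toℕ (lookup w p))) (toℕ (lookup w p)))
    statFrom-∑ᶠ s others []      = ≡.refl
    statFrom-∑ᶠ s others (b ∷ w) = ≡.cong (contribution (others (toℕ b) ≤ᵇ s (toℕ b)) (toℕ b) ℕ.+_) (statFrom-∑ᶠ s _ w)

    sum-lookup : ∀ {n} (v : Vec ℕ n) → Vec.sum v ≡ ∑ᶠ (lookup v)
    sum-lookup []      = ≡.refl
    sum-lookup (a ∷ v) = ≡.cong (a ℕ.+_) (sum-lookup v)

    ∑ᶠ-scale : ∀ {n} k (f : Fin n → ℕ) → k ℕ.* ∑ᶠ f ≡ ∑ᶠ (λ i → k ℕ.* f i)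
    ∑ᶠ-scale {zero}  k f = ℕ.*-zeroʳ k
    ∑ᶠ-scale {suc n} k f = ≡.trans (ℕ.*-distribˡ-+ k (f zero) _) (≡.cong (k ℕ.* f zero ℕ.+_) (∑ᶠ-scale k (f ∘ suc)))

    fexc-∑ᶠ : ∀ {n} (σ : Vec (Fin n) n) (c : Vec (Fin r) n) → fexc (σ , c) ≡
      ∑ᶠ (λ i → r ℕ.* (if (toℕ i <ᵇ toℕ (lookup σ i)) ∧ (toℕ (lookup c i) ≡ᵇ 0) then 1 else 0) ℕ.+ toℕ (lookup c i))
    fexc-∑ᶠ {n} σ c = ≡.trans (≡.cong₂ (λ a b → r ℕ.* a ℕ.+ b)
        (≡.trans (#≡boolSum (λ i → (toℕ i ℕ.<? toℕ (lookup σ i)) ×-dec (toℕ (lookup c i) ℕ.≟ 0))) (boolSum-∑ᶠ {n} _))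
        (≡.trans (sum-lookup (Vec.map toℕ c)) (∑ᶠ-cong (λ i → Vec.lookup-map i toℕ c))))
      (≡.trans (≡.cong (ℕ._+ ∑ᶠ (toℕ ∘ lookup c)) (∑ᶠ-scale r (λ i → if (toℕ i <ᵇ toℕ (lookup σ i)) ∧ (toℕ (lookup c i) ≡ᵇ 0) then 1 else 0)))
        (≡.sym (∑ᶠ-distrib-+ (λ i → r ℕ.* (if (toℕ i <ᵇ toℕ (lookup σ i)) ∧ (toℕ (lookup c i) ≡ᵇ 0) then 1 else 0)) (toℕ ∘ lookup c))))

    -- `fexc` sums over sorted places and `stat` over places in the word; `sort` permutes one into
    -- the other. An excedance at `i` means that `p = sort i` exceeds its rank.
    fexc-sorted : ∀ {K n} (w : Vec (Fin K) n) →
      fexc (proj₁ (sorted w) , Vec.map (λ e → toℕ e mod r) (proj₂ (sorted w))) ≡ stat (toWord w)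
    fexc-sorted {K} {n} w = begin
      fexc (proj₁ (sorted w) , Vec.map (λ e → toℕ e mod r) (proj₂ (sorted w)))
        ≡⟨ fexc-∑ᶠ (proj₁ (sorted w)) (Vec.map (λ e → toℕ e mod r) (proj₂ (sorted w))) ⟩
      ∑ᶠ (λ i → r ℕ.* (if (toℕ i <ᵇ toℕ (lookup (tabulate sort) i)) ∧ (toℕ (lookup (Vec.map (λ e → toℕ e mod r) (tabulate (lookup w ∘ sort))) i) ≡ᵇ 0) then 1 else 0)
                 ℕ.+ toℕ (lookup (Vec.map (λ e → toℕ e mod r) (tabulate (lookup w ∘ sort))) i))
        ≡⟨ ∑ᶠ-cong each ⟩
      ∑ᶠ (λ i → H (sort i))
        ≡⟨ ∑ᶠ-permute H π ⟨
      ∑ᶠ H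
        ≡⟨ ∑ᶠ-cong (λ p → ≡.cong (λ x → contribution x (letterAt p)) (≡.sym (othersBefore≤ w p))) ⟩
      ∑ᶠ (λ p → contribution (othersBefore w (λ _ → 0) p ≤ᵇ greater (letterAt p) (List.map pure (toWord w))) (letterAt p))
        ≡⟨ statFrom-∑ᶠ (λ b → greater b (List.map pure (toWord w))) (λ _ → 0) w ⟨
      stat (toWord w) ∎
      where
      open ≡.≡-Reasoning
      open Sorting w
      π : Permutation.Permutation n n
      π = Permutation.permutation sort rankFin sort-rankFin rankFin-sort
      H : Fin n → ℕ
      H p = contribution (toℕ p ≤ᵇ rank p) (letterAt p)
      case : ∀ i s b → r ℕ.* (if (i <ᵇ s) ∧ (colour b ≡ᵇ 0) then 1 else 0) ℕ.+ colour b ≡ contribution (s ≤ᵇ i) b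
      case i s b = go (i <ᵇ s) (s ≤ᵇ i) (flip i s)
        where
        flip : ∀ i s → (s ≤ᵇ i) ≡ not (i <ᵇ s)
        flip i       zero          = ≡.refl
        flip zero    (suc s)       = ≡.refl
        flip (suc i) (suc zero)    = ≡.refl
        flip (suc i) (suc (suc s)) = flip i (suc s)
        go : ∀ x y → y ≡ not x → r ℕ.* (if x ∧ (colour b ≡ᵇ 0) then 1 else 0) ℕ.+ colour b ≡ contribution y b
        go false y ≡.refl = ≡.cong (ℕ._+ colour b) (ℕ.*-zeroʳ r)
        go true  y ≡.refl with colour b
        ... | zero  = ≡.trans (ℕ.+-identityʳ _) (ℕ.*-identityʳ r)
        ... | suc c = ≡.cong (ℕ._+ suc c) (ℕ.*-zeroʳ r)
      each : ∀ i → r ℕ.* (if (toℕ i <ᵇ toℕ (lookup (tabulate sort) i)) ∧ (toℕ (lookup (Vec.map (λ e → toℕ e mod r) (tabulate (lookup w ∘ sort))) i) ≡ᵇ 0) then 1 else 0)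
                 ℕ.+ toℕ (lookup (Vec.map (λ e → toℕ e mod r) (tabulate (lookup w ∘ sort))) i) ≡ H (sort i)
      each i = ≡.trans (≡.cong₂ (λ s c → r ℕ.* (if (toℕ i <ᵇ s) ∧ (c ≡ᵇ 0) then 1 else 0) ℕ.+ c) (≡.cong toℕ (Vec.lookup∘tabulate sort i))
          (≡.trans (≡.cong toℕ (≡.trans (Vec.lookup-map i _ (tabulate (lookup w ∘ sort))) (≡.cong (λ e → toℕ e mod r) (Vec.lookup∘tabulate (lookup w ∘ sort) i)))) (Fin.toℕ-fromℕ< _)))
        (≡.trans (case (toℕ i) (toℕ (sort i)) (letterAt (sort i))) (≡.cong (λ k → contribution (toℕ (sort i) ≤ᵇ k) (letterAt (sort i))) (≡.sym (rank-sort i))))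

  module ChainSums {c ℓ} (R : CommutativeRing c ℓ) (r′ t : ℕ) where
    private
      r K : ℕ
      r = suc r′
      K = suc (r ℕ.* t)
    open CommutativeRing R hiding (zero)
    open FiniteSums R
    open ListSums R
    open Chains R
    open Statistic r′
    open import Relation.Binary.Reasoning.Setoid setoid

    ∑ₗ-words : ∀ N n (F : List ℕ → Carrier) → ∑ₗ (words N n) (F ∘ toWord) ≈ ∑words (∑< N) n F
    ∑ₗ-words N zero    F = +-identityʳ _
    ∑ₗ-words N (suc n) F = trans (∑ₗ-product _∷_ (allFin N) (words N n) (F ∘ toWord))
      (trans (Linear.cong (∑ₗ-linear (allFin N)) λ i → ∑ₗ-words N n (λ w → F (toℕ i ∷ w)))
        (∑ₗ-allFin N (λ i → ∑words (∑< N) n (λ w → F (i ∷ w)))))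

    -- Colours and chains merge into sorted letter sequences, and undoing the sort leaves arbitrary
    -- words.
    sum-coloured : ∀ n f →
      ∑ₗ (filter (λ π → fexc π ℕ.≟ f) (coloredPermutations r n))
         (λ (σ , c) → chainCount t (descents 0 0 (Vec.map toℕ c) (Vec.map toℕ σ))) ≈
      ∑words (∑< K) n (λ w → ind (stat w ≡ᵇ f))
    sum-coloured n f = begin
      ∑ₗ (filter (λ π → fexc π ℕ.≟ f) (coloredPermutations r n)) (λ (σ , c) → chainCount t (ds σ c))
        ≈⟨ ∑ₗ-filter (λ π → fexc π ℕ.≟ f) (coloredPermutations r n) _ ⟩
      ∑ₗ (coloredPermutations r n) (λ (σ , c) → ind (fexc (σ , c) ≡ᵇ f) * chainCount t (ds σ c))
        ≈⟨ ∑ₗ-product _,_ (permutations n) (words r n) _ ⟩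
      ∑ₗ (permutations n) (λ σ → ∑ₗ (words r n) (λ c → ind (fexc (σ , c) ≡ᵇ f) * chainCount t (ds σ c)))
        ≈⟨ Linear.cong (∑ₗ-linear (permutations n)) (λ σ → trans
             (ColourSums.sum-chainCount r t (Vec.map toℕ σ) t 0 0 ℕ.≤-refl (s≤s z≤n) (s≤s (ℕ.≤-reflexive t*r+0≡r*t)) (λ c → ind (fexc (σ , c) ≡ᵇ f)))
             (Linear.cong (∑ₗ-linear (words K n)) λ es → *-congʳ (reflexive (≡.cong (λ e₀ → ind (chain e₀ 0 (Vec.map toℕ es) (Vec.map toℕ σ))) t*r+0≡r*t)))) ⟩
      ∑ₗ (permutations n) (λ σ → ∑ₗ (words K n) (λ es → ind (chain (r ℕ.* t) 0 (Vec.map toℕ es) (Vec.map toℕ σ)) * Θ (σ , es)))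
        ≈⟨ sym (∑ₗ-product _,_ (permutations n) (words K n) (λ (σ , es) → ind (chain (r ℕ.* t) 0 (Vec.map toℕ es) (Vec.map toℕ σ)) * Θ (σ , es))) ⟩
      ∑ₗ (cartesianProduct (permutations n) (words K n)) (λ (σ , es) → ind (chain (r ℕ.* t) 0 (Vec.map toℕ es) (Vec.map toℕ σ)) * Θ (σ , es))
        ≈⟨ sym (∑ₗ-filter (SortedWords.valid? (r ℕ.* t) n) (cartesianProduct (permutations n) (words K n)) Θ) ⟩
      ∑ₗ (filter (SortedWords.valid? (r ℕ.* t) n) (cartesianProduct (permutations n) (words K n))) Θ
        ≈⟨ sym (∑ₗ-↭ (SortedWords.sorted-↭ (r ℕ.* t) n) Θ) ⟩
      ∑ₗ (List.map sorted (words K n)) Θ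
        ≡⟨ ∑ₗ-map sorted (words K n) Θ ⟩
      ∑ₗ (words K n) (Θ ∘ sorted)
        ≈⟨ Linear.cong (∑ₗ-linear (words K n)) (λ w → reflexive (≡.cong (λ m → ind (m ≡ᵇ f)) (SortedStatistic.fexc-sorted r′ w))) ⟩
      ∑ₗ (words K n) (λ w → ind (stat (toWord w) ≡ᵇ f))
        ≈⟨ ∑ₗ-words K n (λ w → ind (stat w ≡ᵇ f)) ⟩
      ∑words (∑< K) n (λ w → ind (stat w ≡ᵇ f)) ∎
      where
      ds : ∀ {n} → Vec (Fin n) n → Vec (Fin r) n → List Bool
      ds σ c = descents 0 0 (Vec.map toℕ c) (Vec.map toℕ σ)
      Θ : Vec (Fin n) n × Vec (Fin K) n → Carrier
      Θ (σ , es) = ind (fexc (σ , ColourSums.colours r t es) ≡ᵇ f)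
      t*r+0≡r*t : t ℕ.* r ℕ.+ 0 ≡ r ℕ.* t
      t*r+0≡r*t = ≡.trans (ℕ.+-identityʳ _) (ℕ.*-comm t r)

-- The polynomials of colored permutations as series of word counts

module ColoredPermutationSeries where
  open import Defs using (z₁; fdes*; ⌈_/_⌉; Colored; coloredPermutations; C-poly; fexc)
  open Summation
  open EquidistributedStatistics
  open WordStatistic
  open SeriesRings
  open ChainEnumeration
  open DescentSeries
  open SortedExcedances
  open import Algebra.Bundles using (CommutativeRing)
  open import Data.Bool.Base using (Bool)
  open import Data.Fin.Base as Fin using (toℕ)
  open import Data.List.Base as List using (List; []; _∷_; length; filter)
  open import Data.Nat.Base as ℕ using (ℕ; suc; _∸_; _≡ᵇ_)
  import Data.Nat.Properties as ℕ
  open import Data.Product.Base using (_,_)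
  import Data.Rational.Properties as ℚ
  open import Data.Vec.Base as Vec using (Vec; []; _∷_)
  open import Relation.Binary.PropositionalEquality as ≡ using (_≡_)

  length-descents : ∀ {n} c₀ s₀ (cs ss : Vec ℕ n) → length (descents c₀ s₀ cs ss) ≡ n
  length-descents c₀ s₀ []       []       = ≡.refl
  length-descents c₀ s₀ (c ∷ cs) (s ∷ ss) = ≡.cong suc (length-descents c s cs ss)

  module ListSeries {c ℓ} (R : CommutativeRing c ℓ) where
    private
      Z = PowerSeries.series R
      module Z = CommutativeRing Z
      module ZL = ListSums Z
      module RL = ListSums R
      module R = CommutativeRing R

    foldr-∑ₗ : ∀ {A : Set} (g : A → Z.Carrier) as → List.foldr Z._+_ Z.0# (List.map g as) ≡ ZL.∑ₗ as g
    foldr-∑ₗ g []       = ≡.refl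
    foldr-∑ₗ g (a ∷ as) = ≡.cong (g a Z.+_) (foldr-∑ₗ g as)

    ∑ₗ-coefficient : ∀ {A : Set} (as : List A) (g : A → Z.Carrier) i → ZL.∑ₗ as g i ≡ RL.∑ₗ as (λ a → g a i)
    ∑ₗ-coefficient []       g i = ≡.refl
    ∑ₗ-coefficient (a ∷ as) g i = ≡.cong (g a i R.+_) (∑ₗ-coefficient as g i)

  R : CommutativeRing _ _
  R = ℚ.+-*-commutativeRing

  Z : CommutativeRing _ _
  Z = PowerSeries.series R

  module R∑ = FiniteSums R
  module Z∑ = FiniteSums Z
  module Z = CommutativeRing Z

  -- Each power of `z₁` is the common factor times the chain series of its permutation, so only word
  -- counts remain after summation.
  C-series : ∀ r′ (let r = suc r′) n k → C-poly r (suc n) (suc k) Z.≈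
    (Z.1# Z.- z₁) Z∑.^ suc (suc n) Z.* (λ t → R∑.∑words (R∑.∑< (suc (r ℕ.* t))) (suc n)
      (λ w → R∑.ind (Statistic.stat r′ w ≡ᵇ r ℕ.* suc n ∸ suc k)))
  C-series r′ n k = begin
    C-poly r (suc n) (suc k)
      ≡⟨ foldr-∑ₗ (λ π → z₁ Z∑.^ ⌈ fdes* π / r ⌉) F ⟩
    ZL.∑ₗ F (λ π → z₁ Z∑.^ ⌈ fdes* π / r ⌉)
      ≈⟨ Z∑.Linear.cong (ZL.∑ₗ-linear F) {λ π → z₁ Z∑.^ ⌈ fdes* π / r ⌉} {λ π → p Z.* series π} each ⟩
    ZL.∑ₗ F (λ π → p Z.* series π)
      ≈⟨ Z∑.Linear.scale (ZL.∑ₗ-linear F) p series ⟩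
    p Z.* ZL.∑ₗ F series
      ≈⟨ Z.*-congˡ {p} {ZL.∑ₗ F series} {λ t → counts t} (λ t → ≡.trans (∑ₗ-coefficient F series t) (ChainSums.sum-coloured R r′ t (suc n) f)) ⟩
    p Z.* (λ t → counts t) ∎
    where
    open import Relation.Binary.Reasoning.Setoid Z.setoid
    open ListSeries R
    module ZL = ListSums Z
    open Chains R using (chainCount)
    open ChainSeries R using (chainSeries; chainSeries-closed)
    r = suc r′
    f = r ℕ.* suc n ∸ suc k
    F = filter (λ π → fexc π ℕ.≟ f) (coloredPermutations r (suc n))
    p = (Z.1# Z.- z₁) Z∑.^ suc (suc n)
    counts : ℕ → _
    counts t = R∑.∑words (R∑.∑< (suc (r ℕ.* t))) (suc n) (λ w → R∑.ind (Statistic.stat r′ w ≡ᵇ f))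
    ds : Colored r (suc n) → List Bool
    ds (σ , c) = descents 0 0 (Vec.map toℕ c) (Vec.map toℕ σ)
    series : Colored r (suc n) → Z.Carrier
    series π = chainSeries (ds π)
    each : ∀ π → z₁ Z∑.^ ⌈ fdes* π / r ⌉ Z.≈ p Z.* series π
    each π@(σ , c) = Z.trans {z₁ Z∑.^ ⌈ fdes* π / r ⌉} {z₁ Z∑.^ count-true (ds π)} {p Z.* series π}
      (Z.reflexive (≡.cong (z₁ Z∑.^_) (ceiling-fdes* r′ σ c)))
      (Z.sym {p Z.* series π} {z₁ Z∑.^ count-true (ds π)} (≡.subst (λ m → (Z.1# Z.- z₁) Z∑.^ suc m Z.* series π Z.≈ z₁ Z∑.^ count-true (ds π))
        (length-descents 0 0 (Vec.map toℕ c) (Vec.map toℕ σ)) (chainSeries-closed (ds π))))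

-- Lattice points of dilated slabs

module SlabLatticePoints where
  open import Defs using (words; fromℤ; fromℕ; 𝒜; dilate; latticePoints; HasCardinality)
  open Summation
  open ChainEnumeration
  open SortedExcedances using (toWord; module ChainSums)
  open StableSort using (words-unique; words-complete)
  open ColoredPermutationSeries using (R; module R∑)
  open import Data.Bool.Base using (Bool; true; false; _∧_; T)
  open import Data.Bool.Properties using (T?; T-≡)
  open import Data.Fin.Base as Fin using (Fin; suc; toℕ; fromℕ<)
  import Data.Fin.Properties as Fin
  open import Data.Integer.Base as ℤ using (ℤ; +_; 0ℤ)
  import Data.Integer.Properties as ℤ
  open import Data.List.Base as List using (List; []; _∷_; length; filter)
  import Data.List.Properties as List
  open import Data.List.Membership.Propositional using (_∈_)
  open import Data.List.Membership.Propositional.Properties using (∈-filter⁺; ∈-filter⁻; ∈-map⁺; ∈-map⁻)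
  open import Data.List.Membership.Propositional.Properties.WithK using (unique∧set⇒bag)
  open import Data.List.Relation.Binary.BagAndSetEquality using (∼bag⇒↭)
  open import Data.List.Relation.Binary.Permutation.Propositional.Properties using (↭-length)
  import Data.List.Relation.Unary.Unique.Propositional.Properties as Unique
  open import Data.Nat.Base as ℕ using (ℕ; suc; _≤_; _<_; z≤n; _≤ᵇ_; _<ᵇ_)
  open import Data.Nat.ListAction using (sum)
  import Data.Nat.Properties as ℕ
  open import Data.Product.Base using (_×_; _,_; proj₁; proj₂; ∃)
  open import Data.Rational.Base as ℚ using (ℚ; 0ℚ; 1ℚ)
  import Data.Rational.Properties as ℚ
  open import Data.Rational.Unnormalised.Base as ℚᵘ using (mkℚᵘ; *≤*; *<*; *≡*)
  import Data.Rational.Unnormalised.Properties as ℚᵘ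
  open import Data.Vec.Base as Vec using (Vec; []; _∷_)
  import Data.Vec.Properties as Vec
  open import Data.Vec.Relation.Unary.All using (All; []; _∷_)
  open import Function.Base using (_∘_)
  open import Function.Bundles using (Equivalence; mk⇔)
  open import Relation.Binary.PropositionalEquality as ≡ using (_≡_)
  open import Relation.Nullary using (does)
  open import Relation.Nullary.Decidable using (dec-true)
  open import Relation.Unary using (Decidable)

  toℚᵘ-fromℤ : ∀ a → ℚ.toℚᵘ (fromℤ a) ℚᵘ.≃ mkℚᵘ a 0
  toℚᵘ-fromℤ a = ℚ.toℚᵘ-fromℚᵘ (mkℚᵘ a 0)

  fromℤ-mono-≤ : ∀ {a b} → a ℤ.≤ b → fromℤ a ℚ.≤ fromℤ b
  fromℤ-mono-≤ {a} {b} a≤b = ℚ.toℚᵘ-cancel-≤ (ℚᵘ.≤-respˡ-≃ (ℚᵘ.≃-sym (toℚᵘ-fromℤ a)) (ℚᵘ.≤-respʳ-≃ (ℚᵘ.≃-sym (toℚᵘ-fromℤ b))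
    (*≤* (ℤ.*-monoʳ-≤-nonNeg (+ 1) a≤b))))

  fromℤ-cancel-≤ : ∀ {a b} → fromℤ a ℚ.≤ fromℤ b → a ℤ.≤ b
  fromℤ-cancel-≤ {a} {b} le with ℚᵘ.≤-respˡ-≃ (toℚᵘ-fromℤ a) (ℚᵘ.≤-respʳ-≃ (toℚᵘ-fromℤ b) (ℚ.toℚᵘ-mono-≤ le))
  ... | *≤* a≤b = ℤ.*-cancelʳ-≤-pos a b (+ 1) a≤b

  fromℤ-mono-< : ∀ {a b} → a ℤ.< b → fromℤ a ℚ.< fromℤ b
  fromℤ-mono-< {a} {b} a<b = ℚ.toℚᵘ-cancel-< (ℚᵘ.<-respˡ-≃ (ℚᵘ.≃-sym (toℚᵘ-fromℤ a)) (ℚᵘ.<-respʳ-≃ (ℚᵘ.≃-sym (toℚᵘ-fromℤ b))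
    (*<* (ℤ.*-monoʳ-<-pos (+ 1) a<b))))

  fromℤ-cancel-< : ∀ {a b} → fromℤ a ℚ.< fromℤ b → a ℤ.< b
  fromℤ-cancel-< {a} {b} lt with ℚᵘ.<-respˡ-≃ (toℚᵘ-fromℤ a) (ℚᵘ.<-respʳ-≃ (toℚᵘ-fromℤ b) (ℚ.toℚᵘ-mono-< lt))
  ... | *<* a<b = ℤ.*-cancelʳ-<-nonNeg (+ 1) a<b

  fromℤ-+ : ∀ a b → fromℤ (a ℤ.+ b) ≡ fromℤ a ℚ.+ fromℤ b
  fromℤ-+ a b = ℚ.toℚᵘ-injective (ℚᵘ.≃-trans (toℚᵘ-fromℤ (a ℤ.+ b)) (ℚᵘ.≃-trans
    (*≡* (≡.cong (ℤ._* (+ 1)) (≡.sym (≡.cong₂ ℤ._+_ (ℤ.*-identityʳ a) (ℤ.*-identityʳ b)))))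
    (ℚᵘ.≃-sym (ℚᵘ.≃-trans (ℚ.toℚᵘ-homo-+ (fromℤ a) (fromℤ b)) (ℚᵘ.+-cong (toℚᵘ-fromℤ a) (toℚᵘ-fromℤ b))))))

  fromℤ-* : ∀ a b → fromℤ (a ℤ.* b) ≡ fromℤ a ℚ.* fromℤ b
  fromℤ-* a b = ℚ.toℚᵘ-injective (ℚᵘ.≃-trans (toℚᵘ-fromℤ (a ℤ.* b)) (ℚᵘ.≃-trans (*≡* ≡.refl)
    (ℚᵘ.≃-sym (ℚᵘ.≃-trans (ℚ.toℚᵘ-homo-* (fromℤ a) (fromℤ b)) (ℚᵘ.*-cong (toℚᵘ-fromℤ a) (toℚᵘ-fromℤ b))))))

  fromℕ-+ : ∀ m n → fromℕ (m ℕ.+ n) ≡ fromℕ m ℚ.+ fromℕ n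
  fromℕ-+ m n = ≡.trans (≡.cong fromℤ (ℤ.pos-+ m n)) (fromℤ-+ (+ m) (+ n))

  fromℕ-* : ∀ m n → fromℕ (m ℕ.* n) ≡ fromℕ m ℚ.* fromℕ n
  fromℕ-* m n = ≡.trans (≡.cong fromℤ (ℤ.pos-* m n)) (fromℤ-* (+ m) (+ n))

  fromℕ-pos : ∀ t′ → ℚ.Positive (fromℕ (suc t′))
  fromℕ-pos t′ = ℚ.normalize-pos (suc t′) 1

  fromℕ-length-filter : ∀ {A : Set} {P : A → Set} (P? : Decidable P) as →
    fromℕ (length (filter P? as)) ≡ ListSums.∑ₗ R as (λ a → R∑.ind (does (P? a)))
  fromℕ-length-filter P? []       = ≡.refl
  fromℕ-length-filter P? (a ∷ as) with does (P? a)
  ... | true  = ≡.trans (fromℕ-+ 1 (length (filter P? as))) (≡.cong (1ℚ ℚ.+_) (fromℕ-length-filter P? as))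
  ... | false = ≡.trans (fromℕ-length-filter P? as) (≡.sym (ℚ.+-identityˡ _))

  -- `κ` stands for k - 1, so that the lower bound of the slab needs no subtraction.
  inSlab : ℕ → ℕ → ℕ → Bool
  inSlab κ t s = (κ ℕ.* t ≤ᵇ s) ∧ (s <ᵇ suc κ ℕ.* t)

  module LatticePoints (r t′ : ℕ) where
    private
      t : ℕ
      t = suc t′
      T⁺ = fromℕ t
      instance
        pos : ℚ.Positive T⁺
        pos = fromℕ-pos t′
        nonNeg : ℚ.NonNegative T⁺
        nonNeg = ℚ.pos⇒nonNeg T⁺
        nonZero : ℚ.NonZero T⁺
        nonZero = ℚ.pos⇒nonZero T⁺
    L = r ℕ.* t

    point : ∀ {n} → Vec (Fin L) n → Vec ℤ n
    point = Vec.map (+_ ∘ toℕ)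

    Bounds : ℚ → Set
    Bounds a = 0ℚ ℚ.≤ a × a ℚ.< fromℕ r

    L≡ : fromℕ L ≡ T⁺ ℚ.* fromℕ r
    L≡ = ≡.trans (≡.cong fromℕ (ℕ.*-comm r t)) (fromℕ-* t r)

    bounded⇒letter : ∀ a v → Bounds v → fromℤ a ≡ T⁺ ℚ.* v → ∃ λ (i : Fin L) → a ≡ + toℕ i
    bounded⇒letter a v (0≤v , v<r) eq = found a
        (fromℤ-cancel-≤ (≡.subst₂ ℚ._≤_ (ℚ.*-zeroʳ T⁺) (≡.sym eq) (ℚ.*-monoˡ-≤-nonNeg T⁺ 0≤v)))
        (fromℤ-cancel-< (≡.subst₂ ℚ._<_ (≡.sym eq) (≡.sym L≡) (ℚ.*-monoʳ-<-pos T⁺ v<r)))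
      where
      found : ∀ a → 0ℤ ℤ.≤ a → a ℤ.< + L → ∃ λ (i : Fin L) → a ≡ + toℕ i
      found (+ m) _ (ℤ.+<+ m<L) = fromℕ< m<L , ≡.cong +_ (≡.sym (Fin.toℕ-fromℕ< m<L))

    bounded⇒word : ∀ {n} (a : Vec ℤ n) v → All Bounds v → Vec.map fromℤ a ≡ Vec.map (T⁺ ℚ.*_) v → ∃ λ w → a ≡ point w
    bounded⇒word []      []      []       eq = [] , ≡.refl
    bounded⇒word (a ∷ as) (v ∷ vs) (b ∷ bs) eq =
      proj₁ first ∷ proj₁ rest , ≡.cong₂ _∷_ (proj₂ first) (proj₂ rest)
      where
      first = bounded⇒letter a v b (Vec.∷-injectiveˡ eq)
      rest  = bounded⇒word as vs bs (Vec.∷-injectiveʳ eq)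

    private
      Σℚ : ∀ {n} → Vec ℚ n → ℚ
      Σℚ = Vec.foldr′ ℚ._+_ 0ℚ

    Σ-scale : ∀ {n} (v : Vec ℚ n) → Σℚ (Vec.map (T⁺ ℚ.*_) v) ≡ T⁺ ℚ.* Σℚ v
    Σ-scale []      = ≡.sym (ℚ.*-zeroʳ T⁺)
    Σ-scale (x ∷ v) = ≡.trans (≡.cong (T⁺ ℚ.* x ℚ.+_) (Σ-scale v)) (≡.sym (ℚ.*-distribˡ-+ T⁺ x (Σℚ v)))

    Σ-point : ∀ {n} (w : Vec (Fin L) n) → Σℚ (Vec.map fromℤ (point w)) ≡ fromℕ (sum (toWord w))
    Σ-point []      = ≡.refl
    Σ-point (i ∷ w) = ≡.trans (≡.cong (fromℕ (toℕ i) ℚ.+_) (Σ-point w)) (≡.sym (fromℕ-+ (toℕ i) (sum (toWord w))))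

    κ≡ : ∀ κ → fromℕ (suc κ) ℚ.- 1ℚ ≡ fromℕ κ
    κ≡ κ = ≡.trans (≡.cong (ℚ._- 1ℚ) (≡.trans (fromℕ-+ 1 κ) (ℚ.+-comm (fromℕ 1) (fromℕ κ))))
      (≡.trans (ℚ.+-assoc (fromℕ κ) 1ℚ (ℚ.- 1ℚ)) (≡.trans (≡.cong (fromℕ κ ℚ.+_) (ℚ.+-inverseʳ 1ℚ)) (ℚ.+-identityʳ _)))

    fromℕ-dilated : ∀ m → fromℕ (m ℕ.* t) ≡ T⁺ ℚ.* fromℕ m
    fromℕ-dilated m = ≡.trans (≡.cong fromℕ (ℕ.*-comm m t)) (fromℕ-* t m)

    module _ (κ : ℕ) where
      Inside : ∀ {n} → Vec (Fin L) n → Set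
      Inside w = T (inSlab κ t (sum (toWord w)))

      inside? : ∀ {n} → Decidable (Inside {n})
      inside? w = T? _

      slab⇒ : ∀ S → κ ℕ.* t ≤ S → S < suc κ ℕ.* t → T (inSlab κ t S)
      slab⇒ S low high = Equivalence.from T-≡ (≡.cong₂ _∧_ (dec-true (κ ℕ.* t ℕ.≤? S) low) (dec-true (S ℕ.<? suc κ ℕ.* t) high))

      slab⇐ : ∀ S → T (inSlab κ t S) → κ ℕ.* t ≤ S × S < suc κ ℕ.* t
      slab⇐ S ok with κ ℕ.* t ≤ᵇ S in eq₁ | S <ᵇ suc κ ℕ.* t in eq₂
      ... | true | true = ℕ.≤ᵇ⇒≤ _ _ (Equivalence.from T-≡ eq₁) , ℕ.<ᵇ⇒< _ _ (Equivalence.from T-≡ eq₂)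

      lattice⇒ : ∀ {n} (a : Vec ℤ n) → latticePoints (dilate t (𝒜 r n (suc κ))) a → ∃ λ w → a ≡ point w × Inside w
      lattice⇒ a (v , (bounds , low , high) , eq) with bounded⇒word a v bounds eq
      ... | w , ≡.refl = w , ≡.refl , slab⇒ S
              (ℤ.drop‿+≤+ (fromℤ-cancel-≤ (≡.subst₂ ℚ._≤_ (≡.sym (fromℕ-dilated κ)) (≡.sym ΣS) (ℚ.*-monoˡ-≤-nonNeg T⁺ (≡.subst (ℚ._≤ Σℚ v) (κ≡ κ) low)))))
              (ℤ.drop‿+<+ (fromℤ-cancel-< (≡.subst₂ ℚ._<_ (≡.sym ΣS) (≡.sym (fromℕ-dilated (suc κ))) (ℚ.*-monoʳ-<-pos T⁺ high))))
        where
        S = sum (toWord w)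
        ΣS : fromℕ S ≡ T⁺ ℚ.* Σℚ v
        ΣS = ≡.trans (≡.sym (Σ-point w)) (≡.trans (≡.cong Σℚ eq) (Σ-scale v))

      unscale : ℚ → ℚ
      unscale x = ℚ.1/ T⁺ ℚ.* x

      T⁺-unscale : ∀ x → T⁺ ℚ.* unscale x ≡ x
      T⁺-unscale x = ≡.trans (≡.sym (ℚ.*-assoc T⁺ (ℚ.1/ T⁺) x)) (≡.trans (≡.cong (ℚ._* x) (ℚ.*-inverseʳ T⁺)) (ℚ.*-identityˡ x))

      lattice⇐ : ∀ {n} (w : Vec (Fin L) n) → Inside w → latticePoints (dilate t (𝒜 r n (suc κ))) (point w)
      lattice⇐ {n} w inside = v , (bounds w , low , high) , eq
        where
        v = Vec.map unscale (Vec.map fromℤ (point w))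
        eq : Vec.map fromℤ (point w) ≡ Vec.map (T⁺ ℚ.*_) v
        eq = ≡.sym (≡.trans (≡.sym (Vec.map-∘ (T⁺ ℚ.*_) unscale (Vec.map fromℤ (point w))))
               (≡.trans (Vec.map-cong T⁺-unscale (Vec.map fromℤ (point w))) (Vec.map-id _)))
        bounds : ∀ {n} (w : Vec (Fin L) n) → All Bounds (Vec.map unscale (Vec.map fromℤ (point w)))
        bounds []      = []
        bounds (i ∷ w) =
          ( ℚ.*-cancelˡ-≤-pos T⁺ (≡.subst₂ ℚ._≤_ (≡.sym (ℚ.*-zeroʳ T⁺)) (≡.sym (T⁺-unscale (fromℕ (toℕ i)))) (fromℤ-mono-≤ {0ℤ} {+ toℕ i} (ℤ.+≤+ z≤n)))
          , ℚ.*-cancelˡ-<-nonNeg T⁺ (≡.subst₂ ℚ._<_ (≡.sym (T⁺-unscale (fromℕ (toℕ i)))) L≡ (fromℤ-mono-< (ℤ.+<+ (Fin.toℕ<n i))))) ∷ bounds w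
        S = sum (toWord w)
        ΣS : T⁺ ℚ.* Σℚ v ≡ fromℕ S
        ΣS = ≡.trans (≡.sym (Σ-scale v)) (≡.trans (≡.cong Σℚ (≡.sym eq)) (Σ-point w))
        low : fromℕ (suc κ) ℚ.- 1ℚ ℚ.≤ Σℚ v
        low = ≡.subst (ℚ._≤ Σℚ v) (≡.sym (κ≡ κ)) (ℚ.*-cancelˡ-≤-pos T⁺ (≡.subst₂ ℚ._≤_ (fromℕ-dilated κ) (≡.sym ΣS)
                (fromℤ-mono-≤ (ℤ.+≤+ (proj₁ (slab⇐ S inside))))))
        high : Σℚ v ℚ.< fromℕ (suc κ)
        high = ℚ.*-cancelˡ-<-nonNeg T⁺ (≡.subst₂ ℚ._<_ (≡.sym ΣS) (fromℕ-dilated (suc κ)) (fromℤ-mono-< (ℤ.+<+ (proj₂ (slab⇐ S inside)))))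

      point-injective : ∀ {n} {w w′ : Vec (Fin L) n} → point w ≡ point w′ → w ≡ w′
      point-injective {w = []}    {[]}     eq = ≡.refl
      point-injective {w = i ∷ w} {j ∷ w′} eq = ≡.cong₂ _∷_ (Fin.toℕ-injective (ℤ.+-injective (Vec.∷-injectiveˡ eq))) (point-injective (Vec.∷-injectiveʳ eq))

      -- The lattice points of the dilated half-open cube have coordinates 0, ..., r t - 1, so they
      -- are words over `L` letters. Duplicate-free lists with the same members have equal length,
      -- which fixes `N`.
      cardinality : ∀ n N → HasCardinality (latticePoints (dilate t (𝒜 r n (suc κ)))) N →
        fromℕ N ≡ R∑.∑words (R∑.∑< L) n (λ a → R∑.ind (inSlab κ t (sum a)))
      cardinality n N (as , unique , as⇔ , len) = begin
        fromℕ N                                                          ≡⟨ ≡.cong fromℕ (≡.sym len) ⟩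
        fromℕ (length as)                                                ≡⟨ ≡.cong fromℕ (↭-length as↭) ⟩
        fromℕ (length (List.map point (filter inside? (words L n))))     ≡⟨ ≡.cong fromℕ (List.length-map point (filter inside? (words L n))) ⟩
        fromℕ (length (filter inside? (words L n)))                      ≡⟨ fromℕ-length-filter inside? (words L n) ⟩
        ∑ₗ (words L n) (λ w → R∑.ind (inSlab κ t (sum (toWord w))))       ≡⟨ ChainSums.∑ₗ-words R 0 0 L n (λ a → R∑.ind (inSlab κ t (sum a))) ⟩
        R∑.∑words (R∑.∑< L) n (λ a → R∑.ind (inSlab κ t (sum a)))        ∎
        where
        open ≡.≡-Reasoning
        open ListSums R using (∑ₗ)
        as↭ = ∼bag⇒↭ (unique∧set⇒bag unique (Unique.map⁺ point-injective (Unique.filter⁺ inside? (words-unique L n))) (mk⇔ to from))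
          where
          to : ∀ {a} → a ∈ as → a ∈ List.map point (filter inside? (words L n))
          to {a} a∈ = let w , a≡ , inside = lattice⇒ a (Equivalence.to (as⇔ a) a∈) in
            ≡.subst (_∈ List.map point (filter inside? (words L n))) (≡.sym a≡) (∈-map⁺ point (∈-filter⁺ inside? (words-complete w) inside))
          from : ∀ {a} → a ∈ List.map point (filter inside? (words L n)) → a ∈ as
          from {a} a∈ = let w , w∈ , a≡ = ∈-map⁻ point a∈ in
            ≡.subst (_∈ as) (≡.sym a≡) (Equivalence.from (as⇔ (point w)) (lattice⇐ w (proj₂ (∈-filter⁻ inside? {xs = words L n} w∈))))

-- Word counts compared with Ehrhart polynomials

module EhrhartComparison where
  open import Defs using (fromℕ; eval; Polynomial; IsEhrhartPolynomial; 𝒜; coloredPermutations; fexc)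
  open Summation
  open EquidistributedStatistics
  open WordStatistic
  open ChainEnumeration
  open SortedExcedances
  open ColoredPermutationSeries using (R; module R∑)
  open PolynomialSequences
  open SlabLatticePoints
  open import Data.Bool.Base using (true; false; if_then_else_)
  open import Data.List.Base as List using (List; []; _∷_; length; filter)
  open import Data.List.Relation.Unary.All using (All; []; _∷_)
  open import Data.Nat.Base as ℕ using (ℕ; zero; suc; _≤_; _<_; z≤n; s≤s; _≤ᵇ_; _≡ᵇ_; _∸_; _/_; _%_; NonZero)
  import Data.Nat.DivMod as ℕ
  open import Data.Nat.ListAction using (sum)
  import Data.Nat.Properties as ℕ
  open import Data.Nat.Solver using (module +-*-Solver)
  open import Data.Product.Base using (_×_; _,_; proj₁; proj₂)
  open import Data.Rational.Base as ℚ using (ℚ; 0ℚ)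
  import Data.Rational.Properties as ℚ
  open import Data.Fin.Base using (toℕ)
  open import Data.Vec.Base as Vec using ()
  open import Function.Bundles using (mk⇔)
  open import Relation.Binary.PropositionalEquality as ≡ using (_≡_)
  open import Relation.Nullary using (Dec; yes; no)
  open import Relation.Nullary.Decidable using (dec-true; dec-false; does-⇔; _×-dec_)

  open ZeroLetters R fromℕ ≡.refl ≡.refl fromℕ-+
  open Differences R using (IsPolynomial)
  private module Δ = Differences R

  if-true : ∀ {b} {p q : ℚ} → b ≡ true → (if b then p else q) ≡ p
  if-true ≡.refl = ≡.refl

  if-false : ∀ {b} {p q : ℚ} → b ≡ false → (if b then p else q) ≡ q
  if-false ≡.refl = ≡.refl

  -- The quotient is `f` exactly if f t < s + 1 ≤ (f + 1) t; subtraction from the total turns this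
  -- into κ t ≤ S < (κ + 1) t. The shift by one in the statistic thus produces slabs that are closed
  -- below and open above.
  quotient-slab : ∀ s S f κ t .{{_ : NonZero t}} → suc s ℕ.+ S ≡ (f ℕ.+ suc κ) ℕ.* t → (s / t ≡ᵇ f) ≡ inSlab κ t S
  quotient-slab s S f κ t eq = does-⇔ (mk⇔ to from) (s / t ℕ.≟ f) ((κ ℕ.* t ℕ.≤? S) ×-dec (S ℕ.<? suc κ ℕ.* t))
    where
    open +-*-Solver
    total : suc s ℕ.+ S ≡ f ℕ.* t ℕ.+ t ℕ.+ κ ℕ.* t
    total = ≡.trans eq (solve 3 (λ f κ t → (f :+ (con 1 :+ κ)) :* t := f :* t :+ t :+ κ :* t) ≡.refl f κ t)
    total′ : s ℕ.+ suc S ≡ f ℕ.* t ℕ.+ suc κ ℕ.* t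
    total′ = ≡.trans (ℕ.+-suc s S) (≡.trans total (ℕ.+-assoc (f ℕ.* t) t (κ ℕ.* t)))
    below⇒ : suc s ≤ f ℕ.* t ℕ.+ t → κ ℕ.* t ≤ S
    below⇒ le = ℕ.+-cancelˡ-≤ (f ℕ.* t ℕ.+ t) _ _ (≡.subst (_≤ f ℕ.* t ℕ.+ t ℕ.+ S) total (ℕ.+-monoˡ-≤ S le))
    above⇒ : f ℕ.* t ≤ s → S < suc κ ℕ.* t
    above⇒ le = ℕ.+-cancelˡ-≤ (f ℕ.* t) _ _ (ℕ.≤-trans (ℕ.+-monoˡ-≤ (suc S) le) (ℕ.≤-reflexive total′))
    to : s / t ≡ f → κ ℕ.* t ≤ S × S < suc κ ℕ.* t
    to ≡.refl = below⇒ (≡.subst (_≤ s / t ℕ.* t ℕ.+ t) (≡.cong suc (≡.sym (ℕ.m≡m%n+[m/n]*n s t)))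
                  (≡.subst (suc (s % t) ℕ.+ s / t ℕ.* t ≤_) (ℕ.+-comm t _) (ℕ.+-monoˡ-≤ (s / t ℕ.* t) (ℕ.m%n<n s t))))
              , above⇒ (ℕ.m/n*n≤m s t)
    from : κ ℕ.* t ≤ S × S < suc κ ℕ.* t → s / t ≡ f
    from (low , high) = ℕ.≤-antisym
      (ℕ.≤-pred (ℕ.m<n*o⇒m/o<n {s} {suc f} {t} (≡.subst (suc s ≤_) (ℕ.+-comm (f ℕ.* t) t)
        (ℕ.+-cancelʳ-≤ S _ _ (≡.subst (_≤ f ℕ.* t ℕ.+ t ℕ.+ S) (≡.sym total) (ℕ.+-monoʳ-≤ (f ℕ.* t ℕ.+ t) low))))))
      (≡.subst (_≤ s / t) (ℕ.m*n/n≡m f t) (ℕ./-monoˡ-≤ t (ℕ.+-cancelʳ-≤ (suc S) _ _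
        (≡.subst (f ℕ.* t ℕ.+ suc S ≤_) (≡.sym total′) (ℕ.+-monoʳ-≤ (f ℕ.* t) high)))))

  ∑words-cong-bounded : ∀ L n {F G : List ℕ → ℚ} → (∀ w → length w ≡ n → All (_< L) w → F w ≡ G w) →
    R∑.∑words (R∑.∑< L) n F ≡ R∑.∑words (R∑.∑< L) n G
  ∑words-cong-bounded L zero    eq = eq [] ≡.refl []
  ∑words-cong-bounded L (suc n) eq = R∑.∑-cong< L λ a a<L → ∑words-cong-bounded L n λ w |w|≡n bounded → eq (a ∷ w) (≡.cong suc |w|≡n) (a<L ∷ bounded)

  complementSum+sum : ∀ L w → All (_< L) w → complementSum L w ℕ.+ sum w ≡ length w ℕ.* L
  complementSum+sum L []      []            = ≡.refl
  complementSum+sum L (a ∷ w) (a<L ∷ bounded) = begin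
    (L ∸ a) ℕ.+ complementSum L w ℕ.+ (a ℕ.+ sum w)     ≡⟨ solve 4 (λ b c a s → (b :+ c) :+ (a :+ s) := (b :+ a) :+ (c :+ s)) ≡.refl (L ∸ a) (complementSum L w) a (sum w) ⟩
    (L ∸ a) ℕ.+ a ℕ.+ (complementSum L w ℕ.+ sum w)     ≡⟨ ≡.cong₂ ℕ._+_ (ℕ.m∸n+n≡m (ℕ.<⇒≤ a<L)) (complementSum+sum L w bounded) ⟩
    L ℕ.+ length w ℕ.* L                                ∎
    where
    open ≡.≡-Reasoning
    open +-*-Solver

  -- All complements are positive, so the truncated subtraction of 1 in `winding` is a genuine one.
  complementSum>0 : ∀ L w {n} → length w ≡ suc n → All (_< L) w → 0 < complementSum L w
  complementSum>0 L (a ∷ w) _ (a<L ∷ _) = ℕ.≤-trans (ℕ.m<n⇒0<n∸m a<L) (ℕ.m≤m+n (L ∸ a) (complementSum L w))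

  module SlabCount (r t′ : ℕ) where
    private
      t L : ℕ
      t = suc t′
      L = r ℕ.* t

    winding : ℕ → ℕ → ℚ
    winding f s = R∑.ind ((s ∸ 1) / t ≡ᵇ f)

    private
      Lj≡ : ∀ j → j ℕ.* L ≡ (r ℕ.* j) ℕ.* t
      Lj≡ j = solve 3 (λ r t j → j :* (r :* t) := (r :* j) :* t) ≡.refl r t j
        where open +-*-Solver

    -- A word of length `suc j` and its complement have letter sums adding up to `suc j * L`, that
    -- is, `r * suc j` times `t`.
    nonzeroWords-slab : ∀ j f κ → f ℕ.+ suc κ ≡ r ℕ.* suc j →
      nonzeroWords L (suc j) (winding f) ≡ R∑.∑words (R∑.∑< L) (suc j) (λ a → R∑.ind (inSlab κ t (sum a)))
    nonzeroWords-slab j f κ eq = ∑words-cong-bounded L (suc j) λ w |w|≡ bounded → ≡.cong R∑.ind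
      (each (complementSum L w) (sum w) (complementSum>0 L w |w|≡ bounded) (≡.trans (complementSum+sum L w bounded) (≡.cong (ℕ._* L) |w|≡)))
      where
      each : ∀ s S → 0 < s → s ℕ.+ S ≡ suc j ℕ.* L → ((s ∸ 1) / t ≡ᵇ f) ≡ inSlab κ t S
      each (suc s) S _ total = quotient-slab s S f κ t (≡.trans total (≡.trans (Lj≡ (suc j)) (≡.cong (ℕ._* t) (≡.sym eq))))

    nonzeroWords-high : ∀ j f → r ℕ.* suc j ≤ f → nonzeroWords L (suc j) (winding f) ≡ 0ℚ
    nonzeroWords-high j f rj≤f = ≡.trans (∑words-cong-bounded L (suc j) {G = λ _ → 0ℚ} λ w |w|≡ bounded → ≡.cong R∑.ind
        (each (complementSum L w) (sum w) (complementSum>0 L w |w|≡ bounded) (≡.trans (complementSum+sum L w bounded) (≡.cong (ℕ._* L) |w|≡))))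
      (R∑.Linear.vanish (R∑.∑words-linear (R∑.∑-linear L) (suc j)) (λ _ → ≡.refl))
      where
      each : ∀ s S → 0 < s → s ℕ.+ S ≡ suc j ℕ.* L → ((s ∸ 1) / t ≡ᵇ f) ≡ false
      each (suc s) S _ total = dec-false (s / t ℕ.≟ f) (ℕ.<⇒≢ (ℕ.<-≤-trans
        (ℕ.m<n*o⇒m/o<n {s} {r ℕ.* suc j} {t} (≡.subst (suc s ≤_) (≡.trans total (Lj≡ (suc j))) (ℕ.m≤m+n (suc s) S))) rj≤f))

  module EhrhartValues (r′ : ℕ) (E : ℕ → ℕ → Polynomial)
    (ehrhart : ∀ n k → 1 ≤ n → 1 ≤ k → k ≤ suc r′ ℕ.* n → IsEhrhartPolynomial (𝒜 (suc r′) n k) (E n k)) where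
    private
      r : ℕ
      r = suc r′

    -- The coefficient sequence of A_{n,k} / (1 - z)^{n+1}. The row `n = 0` and the column `k = 0`
    -- express the conventions, and beyond `k = r n` it is 0 as in `generatingFunction`.
    ehrhartValue : ℕ → ℕ → ℕ → ℚ
    ehrhartValue zero    k       t = R∑.ind (k ≡ᵇ 0)
    ehrhartValue (suc n) zero    t = 0ℚ
    ehrhartValue (suc n) (suc κ) t = if suc κ ≤ᵇ r ℕ.* suc n then eval (E (suc n) (suc κ)) (fromℕ t) else 0ℚ

    shifted : ℕ → ℕ → ℕ → ℕ → ℚ
    shifted n k m t = if r ℕ.* m ≤ᵇ k then ehrhartValue (n ∸ m) (k ∸ r ℕ.* m) t else 0ℚ

    -- The sum over m of (n choose m) (1 - z)^m A_{n-m, k-rm}, divided by (1 - z)^{n+1}, as a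
    -- coefficient sequence.
    combined : ℕ → ℕ → ℕ → ℚ
    combined n k t = R∑.∑< (suc n) (λ m → binomial n m ℚ.* shifted n k m t)

    statCount : ℕ → ℕ → ℕ → ℚ
    statCount n f t = R∑.∑words (R∑.∑< (suc (r ℕ.* t))) n (λ w → R∑.ind (Statistic.stat r′ w ≡ᵇ f))

    -- With `m` zeros removed, rn - k = r(n - m) - (k - rm), so the slab index drops by `r m`. If
    -- `k < r m`, the required quotient is too large for the remaining letters and both sides are 0.
    nonzeroWords-shifted : ∀ t′ (let t = suc t′) n k → k ≤ r ℕ.* n → ∀ m → m ≤ n →
      nonzeroWords (r ℕ.* t) (n ∸ m) (SlabCount.winding r t′ (r ℕ.* n ∸ k)) ≡ shifted n k m t
    nonzeroWords-shifted t′ n k k≤rn m m≤n = go (n ∸ m) (ℕ.m∸n+n≡m m≤n)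
      where
      t = suc t′
      f = r ℕ.* n ∸ k
      go : ∀ j → j ℕ.+ m ≡ n → nonzeroWords (r ℕ.* t) j (SlabCount.winding r t′ f) ≡ (if r ℕ.* m ≤ᵇ k then ehrhartValue j (k ∸ r ℕ.* m) t else 0ℚ)
      -- For the word of zeros only, truncation gives the quotient 0, which corresponds to
      -- `k = r n`.
      go zero ≡.refl = case (r ℕ.* m ℕ.≤? k)
        where
        case : Dec (r ℕ.* m ≤ k) → R∑.ind (0 ≡ᵇ f) ≡ (if r ℕ.* m ≤ᵇ k then R∑.ind (k ∸ r ℕ.* m ≡ᵇ 0) else 0ℚ)
        case (yes rm≤k) = ≡.trans (≡.cong R∑.ind (≡.trans (dec-true (0 ℕ.≟ f) (≡.sym (ℕ.m≤n⇒m∸n≡0 rm≤k)))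
            (≡.sym (dec-true (k ∸ r ℕ.* m ℕ.≟ 0) (ℕ.m≤n⇒m∸n≡0 k≤rn)))))
          (≡.sym (if-true (dec-true (r ℕ.* m ℕ.≤? k) rm≤k)))
        case (no rm≰k) = ≡.trans (≡.cong R∑.ind (dec-false (0 ℕ.≟ f) (λ eq → rm≰k (ℕ.m∸n≡0⇒m≤n (≡.sym eq)))))
          (≡.sym (if-false (dec-false (r ℕ.* m ℕ.≤? k) rm≰k)))
      go (suc j) ≡.refl = case (r ℕ.* m ℕ.≤? k)
        where
        inner : ∀ κ → κ ℕ.+ r ℕ.* m ≡ k → nonzeroWords (r ℕ.* t) (suc j) (SlabCount.winding r t′ f) ≡ ehrhartValue (suc j) κ t
        inner κ eq = rest κ κ≤rj (≡.trans (≡.cong (r ℕ.* (suc j ℕ.+ m) ∸_) (≡.sym eq)) (≡.trans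
            (≡.cong (_∸ (κ ℕ.+ r ℕ.* m)) (ℕ.*-distribˡ-+ r (suc j) m)) (≡.trans (≡.cong₂ _∸_ (ℕ.+-comm (r ℕ.* suc j) (r ℕ.* m)) (ℕ.+-comm κ (r ℕ.* m)))
              (ℕ.[m+n]∸[m+o]≡n∸o (r ℕ.* m) (r ℕ.* suc j) κ))))
          where
          κ≤rj : κ ≤ r ℕ.* suc j
          κ≤rj = ℕ.+-cancelʳ-≤ (r ℕ.* m) _ _ (≡.subst₂ _≤_ (≡.sym eq) (ℕ.*-distribˡ-+ r (suc j) m) k≤rn)
          rest : ∀ κ → κ ≤ r ℕ.* suc j → f ≡ r ℕ.* suc j ∸ κ → nonzeroWords (r ℕ.* t) (suc j) (SlabCount.winding r t′ f) ≡ ehrhartValue (suc j) κ t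
          rest zero    _    f≡ = SlabCount.nonzeroWords-high r t′ j f (ℕ.≤-reflexive (≡.sym f≡))
          rest (suc κ) κ≤ f≡ = ≡.trans (SlabCount.nonzeroWords-slab r t′ j f κ (≡.trans (≡.cong (ℕ._+ suc κ) f≡) (ℕ.m∸n+n≡m κ≤)))
            (≡.trans (≡.sym (LatticePoints.cardinality r t′ κ (suc j) (proj₁ points) (proj₁ (proj₂ points))))
              (≡.trans (≡.sym (proj₂ (proj₂ points)))
                (≡.sym (if-true (dec-true (suc κ ℕ.≤? r ℕ.* suc j) κ≤)))))
            where points = ehrhart (suc j) (suc κ) (s≤s z≤n) (s≤s z≤n) κ≤ t (s≤s z≤n)
        case : Dec (r ℕ.* m ≤ k) → nonzeroWords (r ℕ.* t) (suc j) (SlabCount.winding r t′ f) ≡ (if r ℕ.* m ≤ᵇ k then ehrhartValue (suc j) (k ∸ r ℕ.* m) t else 0ℚ)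
        case (yes rm≤k) = ≡.trans (inner (k ∸ r ℕ.* m) (ℕ.m∸n+n≡m rm≤k)) (≡.sym (if-true (dec-true (r ℕ.* m ℕ.≤? k) rm≤k)))
        case (no  rm≰k) = ≡.trans (SlabCount.nonzeroWords-high r t′ j f
              (≡.subst (_≤ f) (≡.trans (≡.cong (_∸ r ℕ.* m) (ℕ.*-distribˡ-+ r (suc j) m)) (ℕ.m+n∸n≡m (r ℕ.* suc j) (r ℕ.* m)))
                (ℕ.∸-monoʳ-≤ (r ℕ.* (suc j ℕ.+ m)) (ℕ.<⇒≤ (ℕ.≰⇒> rm≰k)))))
          (≡.sym (if-false (dec-false (r ℕ.* m ℕ.≤? k) rm≰k)))

    statCount-suc : ∀ n k → k ≤ r ℕ.* n → ∀ t′ → statCount n (r ℕ.* n ∸ k) (suc t′) ≡ combined n k (suc t′)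
    statCount-suc n k k≤rn t′ = ≡.trans (Equidistribution.equidistributed R r′ t′ n (r ℕ.* n ∸ k))
      (≡.trans (split-zeros (r ℕ.* suc t′) n (SlabCount.winding r t′ (r ℕ.* n ∸ k)))
        (R∑.∑-cong< (suc n) λ { m (s≤s m≤n) → ≡.cong (binomial n m ℚ.*_) (nonzeroWords-shifted t′ n k k≤rn m m≤n) }))

    -- Expressed through chains, the count is a sum of `chainCount` over a set of colored
    -- permutations independent of `t`.
    statCount-polynomial : ∀ n f → IsPolynomial (statCount n f)
    statCount-polynomial n f = Δ.polynomial-cong (λ t → ChainSums.sum-coloured R r′ t n f)
      (Δ.polynomial-∑ₗ (filter (λ π → fexc π ℕ.≟ f) (coloredPermutations r n))
        (λ { (σ , c) → Δ.polynomial-chainCount (descents 0 0 (Vec.map toℕ c) (Vec.map toℕ σ)) }))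

    eval-polynomial : ∀ p → IsPolynomial (λ t → eval p (fromℕ t))
    eval-polynomial []      = Δ.polynomial-0
    eval-polynomial (a ∷ p) = Δ.polynomial-+ (Δ.polynomial-constant a) (Δ.polynomial-* fromℕ (λ t → fromℕ-+ 1 t) (eval-polynomial p))

    polynomial-if : ∀ b {f} → IsPolynomial f → IsPolynomial (λ t → if b then f t else 0ℚ)
    polynomial-if true  f-polynomial = f-polynomial
    polynomial-if false f-polynomial = Δ.polynomial-0

    ehrhartValue-polynomial : ∀ n k → IsPolynomial (ehrhartValue n k)
    ehrhartValue-polynomial zero    k       = Δ.polynomial-constant (R∑.ind (k ≡ᵇ 0))
    ehrhartValue-polynomial (suc n) zero    = Δ.polynomial-0
    ehrhartValue-polynomial (suc n) (suc κ) = polynomial-if (suc κ ≤ᵇ r ℕ.* suc n) (eval-polynomial (E (suc n) (suc κ)))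

    combined-polynomial : ∀ n k → IsPolynomial (combined n k)
    combined-polynomial n k = Δ.polynomial-∑ (suc n) λ m _ → Δ.polynomial-scale (binomial n m)
      (polynomial-if (r ℕ.* m ≤ᵇ k) (ehrhartValue-polynomial (n ∸ m) (k ∸ r ℕ.* m)))

    -- Lattice points are counted for positive `t`; polynomiality on both sides supplies `t = 0`.
    statCount-combined : ∀ n k → k ≤ r ℕ.* n → ∀ t → statCount n (r ℕ.* n ∸ k) t ≡ combined n k t
    statCount-combined n k k≤rn zero     = Δ.agree-at-0 (statCount-polynomial n (r ℕ.* n ∸ k)) (combined-polynomial n k) (statCount-suc n k k≤rn)
    statCount-combined n k k≤rn (suc t′) = statCount-suc n k k≤rn t′

    combined-vanish : ∀ n k t → (∀ m → m ≤ n → shifted n k m t ≡ 0ℚ) → combined n k t ≡ 0ℚ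
    combined-vanish n k t eq = R∑.∑-zero< (suc n) {λ m → binomial n m ℚ.* shifted n k m t}
      λ { m (s≤s m≤n) → ≡.trans (≡.cong (binomial n m ℚ.*_) (eq m m≤n)) (ℚ.*-zeroʳ (binomial n m)) }

    combined-zero : ∀ n t → combined (suc n) 0 t ≡ 0ℚ
    combined-zero n t = combined-vanish (suc n) 0 t λ m _ → each m
      where
      each : ∀ m → shifted (suc n) 0 m t ≡ 0ℚ
      each zero    = ≡.trans (≡.cong (λ s → if s ≤ᵇ 0 then ehrhartValue (suc n) (0 ∸ s) t else 0ℚ) (ℕ.*-zeroʳ r′)) ≡.refl
      each (suc m) = ≡.refl

    ehrhartValue-high : ∀ j κ t → r ℕ.* j < κ → ehrhartValue j κ t ≡ 0ℚ
    ehrhartValue-high zero    (suc κ) t _    = ≡.refl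
    ehrhartValue-high (suc j) (suc κ) t rj<κ = if-false (dec-false (suc κ ℕ.≤? r ℕ.* suc j) (ℕ.<⇒≱ rj<κ))

    combined-high : ∀ n k t → r ℕ.* n < k → combined n k t ≡ 0ℚ
    combined-high n k t rn<k = combined-vanish n k t λ m m≤n → if-either (r ℕ.* m ≤ᵇ k)
        (ehrhartValue-high (n ∸ m) (k ∸ r ℕ.* m) t (≡.subst (_< k ∸ r ℕ.* m) (≡.sym (ℕ.*-distribˡ-∸ r n m))
          (ℕ.∸-monoˡ-< rn<k (ℕ.*-monoʳ-≤ r m≤n))))
      where
      if-either : ∀ b {p : ℚ} → p ≡ 0ℚ → (if b then p else 0ℚ) ≡ 0ℚ
      if-either true  eq = eq
      if-either false eq = ≡.refl

-- Powers of monomials in iterated series rings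

module MonomialSeries where
  open import Defs using (constant; indeterminate)
  open IntegerSolver
  open Summation
  open SeriesRings
  open import Algebra.Bundles using (CommutativeRing)
  import Algebra.Definitions.RawSemiring
  open import Data.Bool.Base using (if_then_else_)
  open import Data.Fin.Base using (toℕ)
  open import Data.Nat.Base as ℕ using (ℕ; zero; suc; _∸_; _≡ᵇ_; _≤ᵇ_)
  import Data.Nat.Properties as ℕ
  open import Data.Unit.Base using (⊤; tt)
  open import Function.Base using (_∘_)
  open import Relation.Binary.PropositionalEquality as ≡ using (_≡_)
  open import Relation.Nullary using (yes; no)
  open import Relation.Nullary.Decidable using (dec-true; dec-false)

  module RawSum {c ℓ} (S : CommutativeRing c ℓ) where
    open CommutativeRing S hiding (zero)
    open FiniteSums S
    open Algebra.Definitions.RawSemiring (Algebra.Bundles.Semiring.rawSemiring semiring) using () renaming (sum to sumᶠ)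

    sum-∑ : ∀ n (F : ℕ → Carrier) → sumᶠ {n} (λ i → F (toℕ i)) ≡ ∑< n F
    sum-∑ zero    F = ≡.refl
    sum-∑ (suc n) F = ≡.cong (λ s → F 0 + s) (sum-∑ n (F ∘ suc))

  module Constants {c ℓ} (Q : CommutativeRing c ℓ) where
    open CommutativeRing Q hiding (zero)
    private module P = CommutativeRing (PowerSeries.series Q)

    constant-cong : ∀ {a b} → a ≈ b → constant rawRing a P.≈ constant rawRing b
    constant-cong a≈b zero    = a≈b
    constant-cong a≈b (suc n) = refl

    constant-* : ∀ a b → constant rawRing a P.* constant rawRing b P.≈ constant rawRing (a * b)
    constant-* a b n = trans (PowerSeries.constant-⊛ Q a (constant rawRing b) n) (scaled n)
      where
      scaled : ∀ n → a * constant rawRing b n ≈ constant rawRing (a * b) n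
      scaled zero    = refl
      scaled (suc n) = zeroʳ a

    constant-1- : ∀ a → P.1# P.+ (P.- constant rawRing a) P.≈ constant rawRing (1# + (- a))
    constant-1- a zero    = refl
    constant-1- a (suc n) = -‿inverseʳ 0#

  module MonomialPowers {c ℓ} (Q : CommutativeRing c ℓ) where
    open CommutativeRing Q hiding (zero)
    open FiniteSums Q
    open Constants Q
    private
      P = PowerSeries.series Q
      module P = CommutativeRing P
      module P∑ = FiniteSums P
      module C = PowerSeries.Coefficients Q P.isCommutativeRing (λ _ → ⊤) (λ _ → tt) (λ eq i _ → eq i)
      open import Algebra.Properties.CommutativeSemiring.Exp P.commutativeSemiring using (^-distrib-*)
      open import Algebra.Properties.Semiring.Exp P.semiring using (^-assocʳ)
      u = indeterminate rawRing

    linear-power : ∀ f a → f P.≈ constant rawRing a P.* u → ∀ m n → (f P∑.^ m) n ≈ a ^ m * ind (m ≡ᵇ n)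
    linear-power f a f≈ m n = trans (P∑.^-congˡ m {f} {constant rawRing a P.* u} f≈ n)
      (trans (^-distrib-* (constant rawRing a) u m n)
      (trans (P.*-congʳ {u P∑.^ m} {constant rawRing a P∑.^ m} {constant rawRing (a ^ m)} (C.constant-power a m) n)
      (trans (PowerSeries.constant-⊛ Q (a ^ m) (u P∑.^ m) n) (*-congˡ (C.power-coefficient m n)))))

    power-coefficients : ∀ N g k → (u P∑.^ N P.* g) k ≈ (if N ≤ᵇ k then g (k ∸ N) else 0#)
    power-coefficients N g k with N ℕ.≤? k
    ... | yes N≤k rewrite dec-true (N ℕ.≤? k) N≤k = trans (reflexive (≡.cong (u P∑.^ N P.* g) (≡.sym (ℕ.m+[n∸m]≡n N≤k)))) (C.power-shift N g (k ∸ N) tt)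
    ... | no  N≰k rewrite dec-false (N ℕ.≤? k) N≰k = C.power-low N g k tt (ℕ.≰⇒> N≰k)

    monomial-power-* : ∀ a r m g k → ((constant rawRing a P.* u P∑.^ r) P∑.^ m P.* g) k ≈ a ^ m * (if r ℕ.* m ≤ᵇ k then g (k ∸ r ℕ.* m) else 0#)
    monomial-power-* a r m g k = trans
      (P.*-congʳ {g} {(constant rawRing a P.* u P∑.^ r) P∑.^ m} {constant rawRing a P∑.^ m P.* (u P∑.^ r) P∑.^ m} (^-distrib-* (constant rawRing a) (u P∑.^ r) m) k)
      (trans (P.*-assoc (constant rawRing a P∑.^ m) ((u P∑.^ r) P∑.^ m) g k)
      (trans (P.*-congʳ {(u P∑.^ r) P∑.^ m P.* g} {constant rawRing a P∑.^ m} {constant rawRing (a ^ m)} (C.constant-power a m) k)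
      (trans (PowerSeries.constant-⊛ Q (a ^ m) ((u P∑.^ r) P∑.^ m P.* g) k)
      (*-congˡ (trans (P.*-congʳ {g} {(u P∑.^ r) P∑.^ m} {u P∑.^ (r ℕ.* m)} (^-assocʳ u r m) k) (power-coefficients (r ℕ.* m) g k))))))

  module Exponent {c ℓ} (Q : CommutativeRing c ℓ) (z₀ : CommutativeRing.Carrier Q) (r : ℕ) where
    open CommutativeRing Q hiding (zero)
    private
      Y = PowerSeries.series Q
      X = PowerSeries.series Y
      module Y = CommutativeRing Y
      module X = CommutativeRing X
      module Y∑ = FiniteSums Y
      module X∑ = FiniteSums X
      module XC = PowerSeries.Coefficients Y X.isCommutativeRing (λ _ → ⊤) (λ _ → tt) (λ eq i _ → eq i)
      module KX = Constants Y
      module KY = Constants Q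
      kY = constant rawRing
      kX = constant Y.rawRing
      y₀ = indeterminate rawRing

    slope : Y.Carrier
    slope = kY (1# + (- z₀)) Y.* y₀ Y∑.^ r

    -- Being a single term linear in `x`, the exponent has monomials as its powers.
    exponent-linear : (X.1# X.+ (X.- kX (kY z₀))) X.* kX y₀ X∑.^ r X.* indeterminate Y.rawRing X.≈ kX slope X.* indeterminate Y.rawRing
    exponent-linear = X.*-congʳ {indeterminate Y.rawRing} {(X.1# X.+ (X.- kX (kY z₀))) X.* kX y₀ X∑.^ r} {kX slope}
      (X.trans {(X.1# X.+ (X.- kX (kY z₀))) X.* kX y₀ X∑.^ r} {kX d X.* kX (y₀ Y∑.^ r)} {kX slope}
        (X.*-cong {X.1# X.+ (X.- kX (kY z₀))} {kX d} {kX y₀ X∑.^ r} {kX (y₀ Y∑.^ r)} (KX.constant-1- (kY z₀)) (XC.constant-power y₀ r))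
        (X.trans {kX d X.* kX (y₀ Y∑.^ r)} {kX (d Y.* y₀ Y∑.^ r)} {kX slope}
          (KX.constant-* d (y₀ Y∑.^ r))
          (KX.constant-cong {d Y.* y₀ Y∑.^ r} {slope} (Y.*-congʳ {y₀ Y∑.^ r} {d} {kY (1# + (- z₀))} (KY.constant-1- z₀)))))
      where
      d = Y.1# Y.+ (Y.- kY z₀)

-- Comparison of the generating functions

module GeneratingFunctions where
  open import Defs
  open IntegerSolver
  open Summation
  open SeriesRings
  open MonomialSeries
  open DescentSeries
  open ColoredPermutationSeries using (R; Z; module R∑; module Z∑; module Z; C-series)
  open SlabLatticePoints
  open EhrhartComparison
  open PolynomialSequences
  open import Algebra.Bundles using (CommutativeRing)
  import Algebra.Definitions.RawSemiring
  open import Data.Bool.Base using (true; false; if_then_else_)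
  open import Data.Empty using (⊥-elim-irr)
  open import Data.List.Base using ([])
  open import Data.Integer.Base using (+_)
  open import Data.Nat.Base as ℕ using (ℕ; zero; suc; s≤s; z≤n; _∸_; _≡ᵇ_; _≤ᵇ_; _!; NonZero)
  open import Data.Nat.Combinatorics using (nCk≡n!/k![n-k]!; k![n∸k]!∣n!)
  import Data.Nat.DivMod as ℕ
  import Data.Nat.Combinatorics as ℕ using (_C_)
  import Data.Nat.Properties as ℕ
  open import Data.Rational.Base as ℚ using (ℚ; 0ℚ; 1ℚ)
  import Data.Rational.Properties as ℚ
  import Data.Rational.Unnormalised.Base as ℚᵘ
  import Data.Rational.Unnormalised.Properties as ℚᵘ
  open import Data.Unit.Base using (⊤; tt)
  open import Relation.Binary.PropositionalEquality as ≡ using (_≡_)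
  open import Relation.Nullary using (yes; no)
  open import Relation.Nullary.Decidable using (dec-true; dec-false)

  Yr : CommutativeRing _ _
  Yr = PowerSeries.series Z

  module Yr = CommutativeRing Yr
  module Y∑ = FiniteSums Yr

  •-* : ∀ a b (g h : Yr.Carrier) k i → ((a • g) Yr.* (b • h)) k i ≡ (a ℚ.* b) ℚ.* (g Yr.* h) k i
  •-* a b g h k i = begin
    ((a • g) Yr.* (b • h)) k i                          ≡⟨ left a g (b • h) k i ⟩
    a ℚ.* (g Yr.* (b • h)) k i                          ≡⟨ ≡.cong (a ℚ.*_) (Yr.*-comm g (b • h) k i) ⟩
    a ℚ.* ((b • h) Yr.* g) k i                          ≡⟨ ≡.cong (a ℚ.*_) (left b h g k i) ⟩
    a ℚ.* (b ℚ.* (h Yr.* g) k i)                        ≡⟨ ≡.cong (λ s → a ℚ.* (b ℚ.* s)) (Yr.*-comm h g k i) ⟩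
    a ℚ.* (b ℚ.* (g Yr.* h) k i)                        ≡⟨ ℚ.*-assoc a b _ ⟨
    (a ℚ.* b) ℚ.* (g Yr.* h) k i                        ∎
    where
    open ≡.≡-Reasoning
    kZ = constant (CommutativeRing.rawRing R)
    left : ∀ a g h k i → ((a • g) Yr.* h) k i ≡ a ℚ.* (g Yr.* h) k i
    left a g h k i = ≡.trans (Yr.*-congʳ {h} {a • g} {λ κ → kZ a Z.* g κ} (λ κ j → ≡.sym (PowerSeries.constant-⊛ R a (g κ) j)) k i)
      (≡.trans (Convolution.⊛-scale Z (kZ a) g h k i) (PowerSeries.constant-⊛ R a ((g Yr.* h) k) i))

  module _ (r : ℕ) where
    open Exponent Z z₁ r using (slope; exponent-linear)

    ≡ᵇ-comm : ∀ m n → (m ≡ᵇ n) ≡ (n ≡ᵇ m)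
    ≡ᵇ-comm zero    zero    = ≡.refl
    ≡ᵇ-comm zero    (suc n) = ≡.refl
    ≡ᵇ-comm (suc m) zero    = ≡.refl
    ≡ᵇ-comm (suc m) (suc n) = ≡ᵇ-comm m n

    -- The m-th power of the exponent is concentrated in `x`-degree m, so only one term of the
    -- exponential survives.
    exp-coefficient : ∀ n → exp ((1# - z) * y ^ r * x) n Yr.≈ 1/ n ! • (slope Y∑.^ n)
    exp-coefficient n = Yr.trans {exp f n} {Y∑.∑< (suc n) term} {1/ n ! • (slope Y∑.^ n)}
      (Yr.reflexive (RawSum.sum-∑ Yr (suc n) term))
      (Yr.trans {Y∑.∑< (suc n) term} {Y∑.∑< (suc n) (λ m → Y∑.ind (n ≡ᵇ m) Yr.* monomial m)} {1/ n ! • (slope Y∑.^ n)}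
        (Y∑.∑-cong (suc n) {term} {λ m → Y∑.ind (n ≡ᵇ m) Yr.* monomial m} each)
        (Y∑.∑-ind (suc n) n ℕ.≤-refl monomial))
      where
      f = (1# - z) * y ^ r * x
      term monomial : ℕ → Yr.Carrier
      term m     = 1/ m ! • (f ^ m) n
      monomial m = 1/ m ! • (slope Y∑.^ m)
      selected : ∀ b m → 1/ m ! • (slope Y∑.^ m Yr.* Y∑.ind b) Yr.≈ Y∑.ind b Yr.* monomial m
      selected true  m k i = ≡.trans (≡.cong (1/ m ! ℚ.*_) (Yr.*-identityʳ (slope Y∑.^ m) k i)) (≡.sym (Yr.*-identityˡ (monomial m) k i))
      selected false m k i = ≡.trans (≡.cong (1/ m ! ℚ.*_) (Yr.zeroʳ (slope Y∑.^ m) k i)) (≡.trans (ℚ.*-zeroʳ (1/ m !)) (≡.sym (Yr.zeroˡ (monomial m) k i)))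
      each : ∀ m → term m Yr.≈ Y∑.ind (n ≡ᵇ m) Yr.* monomial m
      each m k i = ≡.trans (≡.cong (1/ m ! ℚ.*_) (MonomialPowers.linear-power Yr f slope exponent-linear m n k i))
        (≡.trans (≡.cong (λ b → 1/ m ! ℚ.* (slope Y∑.^ m Yr.* Y∑.ind b) k i) (≡ᵇ-comm m n)) (selected (n ≡ᵇ m) m k i))

  factorial-inverse : ∀ n → fromℕ (n !) ℚ.* 1/ n ! ≡ 1ℚ
  factorial-inverse n = go (n !) {{n ℕ.!≢0}}
    where
    go : ∀ d .{{_ : NonZero d}} → fromℕ d ℚ.* ((+ 1) ℚ./ d) ≡ 1ℚ
    go (suc d) = ℚ.toℚᵘ-injective (ℚᵘ.≃-trans (ℚ.toℚᵘ-homo-* (fromℕ (suc d)) ((+ 1) ℚ./ suc d))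
      (ℚᵘ.≃-trans (ℚᵘ.*-cong (ℚ.toℚᵘ-fromℚᵘ (ℚᵘ.mkℚᵘ (+ suc d) 0)) (ℚ.toℚᵘ-fromℚᵘ (ℚᵘ.mkℚᵘ (+ 1) d)))
        (ℚᵘ.*-inverseʳ (ℚᵘ.mkℚᵘ (+ suc d) 0))))

  -- Inserting `m !` and `(n ∸ m) !` with their inverses reduces the claim to the identity for
  -- binomial coefficients in the natural numbers.
  binomial-factorials : ∀ n m → m ℕ.≤ n → 1/ n ! ℚ.* fromℕ (n ℕ.C m) ≡ 1/ m ! ℚ.* 1/ (n ∸ m) !
  binomial-factorials n m m≤n = begin
    N ℚ.* b                                              ≡⟨ ≡.sym (ℚ.*-identityʳ _) ⟩
    N ℚ.* b ℚ.* 1ℚ                                       ≡⟨ ≡.cong (N ℚ.* b ℚ.*_) (≡.sym (≡.cong₂ ℚ._*_ (factorial-inverse m) (factorial-inverse (n ∸ m)))) ⟩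
    N ℚ.* b ℚ.* ((fromℕ (m !) ℚ.* M) ℚ.* (fromℕ ((n ∸ m) !) ℚ.* J))
      ≡⟨ Identities.regroup R N b (fromℕ (m !)) M (fromℕ ((n ∸ m) !)) J ⟩
    (b ℚ.* (fromℕ (m !) ℚ.* fromℕ ((n ∸ m) !))) ℚ.* N ℚ.* (M ℚ.* J)
      ≡⟨ ≡.cong (λ s → s ℚ.* N ℚ.* (M ℚ.* J)) (≡.trans (≡.cong (b ℚ.*_) (≡.sym (fromℕ-* (m !) ((n ∸ m) !)))) (≡.trans (≡.sym (fromℕ-* (n ℕ.C m) _)) (≡.cong fromℕ product))) ⟩
    fromℕ (n !) ℚ.* N ℚ.* (M ℚ.* J)                      ≡⟨ ≡.cong (ℚ._* (M ℚ.* J)) (factorial-inverse n) ⟩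
    1ℚ ℚ.* (M ℚ.* J)                                     ≡⟨ ℚ.*-identityˡ _ ⟩
    M ℚ.* J                                              ∎
    where
    open ≡.≡-Reasoning
    N = 1/ n !
    M = 1/ m !
    J = 1/ (n ∸ m) !
    b = fromℕ (n ℕ.C m)
    product : (n ℕ.C m) ℕ.* (m ! ℕ.* (n ∸ m) !) ≡ n !
    product = ≡.trans (≡.cong (ℕ._* (m ! ℕ.* (n ∸ m) !)) (nCk≡n!/k![n-k]! m≤n)) (ℕ.m/n*n≡m {{m ℕ.!* (n ∸ m) !≢0}} (k![n∸k]!∣n! m≤n))

  module MainIdentity (r′ : ℕ) (E : ℕ → ℕ → Polynomial)
    (ehrhart : ∀ n k → 1 ℕ.≤ n → 1 ℕ.≤ k → k ℕ.≤ suc r′ ℕ.* n → IsEhrhartPolynomial (𝒜 (suc r′) n k) (E n k)) where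
    private
      r : ℕ
      r = suc r′
    open Exponent Z z₁ r using (slope)

    private
      d : ℕ → Z.Carrier
      d n = (Z.1# Z.- z₁) Z∑.^ n

      Σ⟨_⟩ : (ℕ → ℚ) → Z.Carrier
      Σ⟨ f ⟩ = f

      value : ℕ → ℕ → ℕ → ℚ
      value = EhrhartValues.ehrhartValue r′ E ehrhart

      shift : ℕ → ℕ → ℕ → ℕ → ℚ
      shift = EhrhartValues.shifted r′ E ehrhart

      total : ℕ → ℕ → ℕ → ℚ
      total = EhrhartValues.combined r′ E ehrhart

      A-row : ℕ → Yr.Carrier
      A-row n k = if k ≤ᵇ r ℕ.* n then A-poly E n k else Z.0#

      C-row : ℕ → Yr.Carrier
      C-row n k = if k ≤ᵇ r ℕ.* n then C-poly r n k else Z.0#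

      if-trueᶻ : ∀ {b} {p q : Z.Carrier} → b ≡ true → (if b then p else q) Z.≈ p
      if-trueᶻ ≡.refl i = ≡.refl

      if-falseᶻ : ∀ {b} {p q : Z.Carrier} → b ≡ false → (if b then p else q) Z.≈ q
      if-falseᶻ ≡.refl i = ≡.refl

      zero-series : ∀ n {f : ℕ → ℚ} → (∀ t → f t ≡ 0ℚ) → Z.0# Z.≈ d n Z.* Σ⟨ f ⟩
      zero-series n {f} f≡0 i = ≡.sym (≡.trans (Z.*-congˡ {d n} {f} {Z.0#} f≡0 i) (Z.zeroʳ (d n) i))

      one-series : Z.1# Z.≈ d 1 Z.* Σ⟨ (λ _ → 1ℚ) ⟩
      one-series i = ≡.sym (ChainSeries.chainSeries-closed R [] i)

    A-row-series : ∀ n k → A-row n k Z.≈ d (suc n) Z.* Σ⟨ value n k ⟩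
    A-row-series zero zero    = one-series
    A-row-series zero (suc k) = Z.trans {A-row 0 (suc k)} {Z.0#} {d 1 Z.* Σ⟨ value 0 (suc k) ⟩}
      (if-falseᶻ (dec-false (suc k ℕ.≤? r ℕ.* 0) (λ k<0 → ℕ.n≮0 (≡.subst (suc k ℕ.≤_) (ℕ.*-zeroʳ r) k<0)))) (zero-series 1 {value 0 (suc k)} (λ _ → ≡.refl))
    A-row-series (suc n) zero    = zero-series (suc (suc n)) {value (suc n) 0} (λ _ → ≡.refl)
    A-row-series (suc n) (suc k) = case (suc k ≤ᵇ r ℕ.* suc n)
      where
      p = d (suc (suc n))
      case : ∀ b → (if b then E* (suc n) (E (suc n) (suc k)) else Z.0#) Z.≈
                   p Z.* Σ⟨ (λ t → if b then eval (E (suc n) (suc k)) (fromℕ t) else 0ℚ) ⟩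
      case true  i = ≡.refl
      case false   = zero-series (suc (suc n)) {λ _ → 0ℚ} (λ _ → ≡.refl)

    -- For `1 ≤ k ≤ r n` this is the word count; elsewhere `combined` takes the values that the
    -- conventions prescribe.
    C-row-series : ∀ n k → C-row n k Z.≈ d (suc n) Z.* Σ⟨ total n k ⟩
    C-row-series zero zero = Z.trans {Z.1#} {d 1 Z.* Σ⟨ (λ _ → 1ℚ) ⟩} {d 1 Z.* Σ⟨ total 0 0 ⟩} one-series
      (Z.*-congˡ {d 1} {λ _ → 1ℚ} {total 0 0} (λ t → ≡.sym (≡.cong (λ s → 1ℚ ℚ.* (if s ≤ᵇ 0 then value 0 (0 ∸ s) t else 0ℚ) ℚ.+ 0ℚ) (ℕ.*-zeroʳ r))))
    C-row-series zero (suc k) = Z.trans {C-row 0 (suc k)} {Z.0#} {d 1 Z.* Σ⟨ total 0 (suc k) ⟩}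
      (if-falseᶻ (dec-false (suc k ℕ.≤? r ℕ.* 0) (λ k<0 → ℕ.n≮0 (≡.subst (suc k ℕ.≤_) (ℕ.*-zeroʳ r) k<0))))
      (zero-series 1 {total 0 (suc k)} (λ t → EhrhartValues.combined-high r′ E ehrhart 0 (suc k) t (s≤s (ℕ.≤-trans (ℕ.≤-reflexive (ℕ.*-zeroʳ r)) z≤n))))
    C-row-series (suc n) zero    = zero-series (suc (suc n)) {total (suc n) 0} (EhrhartValues.combined-zero r′ E ehrhart n)
    C-row-series (suc n) (suc k) with suc k ℕ.≤? r ℕ.* suc n
    ... | no  k≰rn = Z.trans {C-row (suc n) (suc k)} {Z.0#} {d (suc (suc n)) Z.* Σ⟨ total (suc n) (suc k) ⟩}
          (if-falseᶻ (dec-false (suc k ℕ.≤? r ℕ.* suc n) k≰rn))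
          (zero-series (suc (suc n)) {total (suc n) (suc k)} (λ t → EhrhartValues.combined-high r′ E ehrhart (suc n) (suc k) t (ℕ.≰⇒> k≰rn)))
    ... | yes k≤rn = Z.trans {C-row (suc n) (suc k)} {C-poly r (suc n) (suc k)} {d (suc (suc n)) Z.* Σ⟨ total (suc n) (suc k) ⟩}
          (if-trueᶻ (dec-true (suc k ℕ.≤? r ℕ.* suc n) k≤rn))
          (Z.trans {C-poly r (suc n) (suc k)} {d (suc (suc n)) Z.* Σ⟨ EhrhartValues.statCount r′ E ehrhart (suc n) (r ℕ.* suc n ∸ suc k) ⟩} {d (suc (suc n)) Z.* Σ⟨ total (suc n) (suc k) ⟩}
            (C-series r′ n k)
            (Z.*-congˡ {d (suc (suc n))} {EhrhartValues.statCount r′ E ehrhart (suc n) (r ℕ.* suc n ∸ suc k)} {total (suc n) (suc k)}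
              (EhrhartValues.statCount-combined r′ E ehrhart (suc n) (suc k) k≤rn)))

    -- `slope` to the power m shifts `k` by `r m` and supplies (1 - z)^m, which completes the
    -- exponent n - m + 1 to n + 1.
    product-row : ∀ n k m → m ℕ.≤ n → (slope Y∑.^ m Yr.* A-row (n ∸ m)) k Z.≈ d (suc n) Z.* Σ⟨ shift n k m ⟩
    product-row n k m m≤n = Z.trans {(slope Y∑.^ m Yr.* A-row (n ∸ m)) k} {d m Z.* (if r ℕ.* m ≤ᵇ k then A-row (n ∸ m) (k ∸ r ℕ.* m) else Z.0#)} {d (suc n) Z.* Σ⟨ shift n k m ⟩}
        (MonomialPowers.monomial-power-* Z (Z.1# Z.- z₁) r m (A-row (n ∸ m)) k) (case (r ℕ.* m ≤ᵇ k))
      where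
      open import Algebra.Properties.Semiring.Exp Z.semiring using (^-homo-*)
      κ = k ∸ r ℕ.* m
      j = n ∸ m
      case : ∀ b → d m Z.* (if b then A-row j κ else Z.0#) Z.≈ d (suc n) Z.* Σ⟨ (λ t → if b then value j κ t else 0ℚ) ⟩
      case false = Z.trans {d m Z.* Z.0#} {Z.0#} {d (suc n) Z.* Σ⟨ (λ _ → 0ℚ) ⟩} (Z.zeroʳ (d m)) (zero-series (suc n) {λ _ → 0ℚ} (λ _ → ≡.refl))
      case true  = Z.trans {d m Z.* A-row j κ} {d m Z.* (d (suc j) Z.* Σ⟨ value j κ ⟩)} {d (suc n) Z.* Σ⟨ value j κ ⟩}
        (Z.*-congˡ {d m} {A-row j κ} {d (suc j) Z.* Σ⟨ value j κ ⟩} (A-row-series j κ))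
        (Z.trans {d m Z.* (d (suc j) Z.* Σ⟨ value j κ ⟩)} {(d m Z.* d (suc j)) Z.* Σ⟨ value j κ ⟩} {d (suc n) Z.* Σ⟨ value j κ ⟩}
          (λ i → ≡.sym (Z.*-assoc (d m) (d (suc j)) Σ⟨ value j κ ⟩ i))
          (Z.*-congʳ {Σ⟨ value j κ ⟩} {d m Z.* d (suc j)} {d (suc n)} (λ i → ≡.trans (≡.sym (^-homo-* (Z.1# Z.- z₁) m (suc j) i))
            (≡.cong (λ e → d e i) (≡.trans (ℕ.+-suc m j) (≡.cong suc (ℕ.m+[n∸m]≡n m≤n)))))))

    total-linear : ∀ p n k i → (p Z.* Σ⟨ total n k ⟩) i ≡ R∑.∑< (suc n) (λ m → fromℕ (n ℕ.C m) ℚ.* (p Z.* Σ⟨ shift n k m ⟩) i)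
    total-linear p n k i = ≡.trans (Z.*-congˡ {p} {total n k} {Z∑.∑< (suc n) termwise} (λ t → ≡.sym (ZC.∑-coefficient (suc n) termwise t)) i)
      (≡.trans (≡.sym (Z∑.Linear.scale (Z∑.∑-linear (suc n)) p termwise i))
      (≡.trans (ZC.∑-coefficient (suc n) (λ m → p Z.* termwise m) i)
      (R∑.∑-cong (suc n) λ m → ≡.trans (Z.*-comm p (termwise m) i) (≡.trans (Convolution.⊛-scale R (fromℕ (n ℕ.C m)) (shift n k m) p i)
        (≡.cong (fromℕ (n ℕ.C m) ℚ.*_) (Z.*-comm (shift n k m) p i))))))
      where
      module ZC = PowerSeries.Coefficients R Z.isCommutativeRing (λ _ → ⊤) (λ _ → tt) (λ eq i _ → eq i)
      termwise : ℕ → Z.Carrier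
      termwise m t = fromℕ (n ℕ.C m) ℚ.* shift n k m t

    -- The factorials turn the Cauchy product in `x` into the binomial sum `combined`.
    coefficients-equal : C r ≈ exp ((1# - z) * y ^ r * x) * A r E
    coefficients-equal n k i = begin
      1/ n ! ℚ.* C-row n k i
        ≡⟨ ≡.cong (1/ n ! ℚ.*_) (≡.trans (C-row-series n k i) (total-linear p n k i)) ⟩
      1/ n ! ℚ.* R∑.∑< (suc n) (λ m → fromℕ (n ℕ.C m) ℚ.* W m)
        ≡⟨ ≡.sym (R∑.Linear.scale (R∑.∑-linear (suc n)) (1/ n !) (λ m → fromℕ (n ℕ.C m) ℚ.* W m)) ⟩
      R∑.∑< (suc n) (λ m → 1/ n ! ℚ.* (fromℕ (n ℕ.C m) ℚ.* W m))
        ≡⟨ R∑.∑-cong< (suc n) (λ { m (s≤s m≤n) → ≡.trans (≡.sym (ℚ.*-assoc (1/ n !) (fromℕ (n ℕ.C m)) (W m)))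
             (≡.trans (≡.cong (ℚ._* W m) (binomial-factorials n m m≤n)) (≡.sym (each m m≤n))) }) ⟩
      R∑.∑< (suc n) (λ m → (exp f m Yr.* A r E (n ∸ m)) k i)
        ≡⟨ ZC.∑-coefficient (suc n) (λ m → (exp f m Yr.* A r E (n ∸ m)) k) i ⟨
      Z∑.∑< (suc n) (λ m → (exp f m Yr.* A r E (n ∸ m)) k) i
        ≡⟨ ≡.cong (λ g → g i) (YC.∑-coefficient (suc n) (λ m → exp f m Yr.* A r E (n ∸ m)) k) ⟨
      Y∑.∑< (suc n) (λ m → exp f m Yr.* A r E (n ∸ m)) k i
        ≡⟨ ≡.cong (λ g → g k i) (RawSum.sum-∑ Yr (suc n) (λ m → exp f m Yr.* A r E (n ∸ m))) ⟨
      (exp f * A r E) n k i ∎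
      where
      open ≡.≡-Reasoning
      module ZC = PowerSeries.Coefficients R Z.isCommutativeRing (λ _ → ⊤) (λ _ → tt) (λ eq i _ → eq i)
      module YC = PowerSeries.Coefficients Z Yr.isCommutativeRing (λ _ → ⊤) (λ _ → tt) (λ eq i _ → eq i)
      f = (1# - z) * y ^ r * x
      p = d (suc n)
      W : ℕ → ℚ
      W m = (p Z.* Σ⟨ shift n k m ⟩) i
      each : ∀ m → m ℕ.≤ n → (exp f m Yr.* A r E (n ∸ m)) k i ≡ (1/ m ! ℚ.* 1/ (n ∸ m) !) ℚ.* W m
      each m m≤n = ≡.trans (Yr.*-congʳ {A r E (n ∸ m)} {exp f m} {1/ m ! • (slope Y∑.^ m)} (exp-coefficient r m) k i)
        (≡.trans (•-* (1/ m !) (1/ (n ∸ m) !) (slope Y∑.^ m) (A-row (n ∸ m)) k i)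
          (≡.cong ((1/ m ! ℚ.* 1/ (n ∸ m) !) ℚ.*_) (product-row n k m m≤n i)))

open import Defs
open import Data.Empty using (⊥-elim-irr)
open import Data.Nat.Base using (ℕ; zero; suc; NonZero) renaming (_≤_ to _≤ℕ_; _*_ to _*ℕ_)

theorem6p1 : (r : ℕ) .{{_ : NonZero r}}
    (E : ℕ → ℕ → Polynomial) →
    (∀ n k → 1 ≤ℕ n → 1 ≤ℕ k → k ≤ℕ r *ℕ n → IsEhrhartPolynomial (𝒜 r n k) (E n k)) →
    C r ≈ exp ((1# - z) * y ^ r * x) * A r E
theorem6p1 zero {{nz}} E ehrhart = ⊥-elim-irr (NonZero.nonZero nz)
theorem6p1 (suc r′) E ehrhart = GeneratingFunctions.MainIdentity.coefficients-equal r′ E ehrhart
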